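{- For $n\in\mathbb N$ define $$S_n(x)=\sum_{k=0}^n\binom nk^2\binom{2k}k(2k+1)x^k,\qquad S_n=S_n(1).$$ (i) For any positive integer $n$, $$\frac1{n^2}\sum_{k=0}^{n-1}S_k=\sum_{k=0}^{n-1}\binom{n-1}k^2C_k\in\mathbb Z,$$ where $C_k=\binom{2k}k/(k+1)$ is the $k$-th Catalan number, and $$\frac1n\sum_{k=0}^{n-1}S_k(x)\in\mathbb Z[x].$$ (ii) For any prime $p>3$, $$\sum_{k=1}^{p-1}\frac{S_k}k\equiv p\sum_{k=1}^{p-1}\frac{S_k}{k^2}\equiv-\frac p2\left(\frac p3\right)B_{p-2}\left(\frac13\right)\pmod{p^2},$$ where $B_m(x)$ denotes the Bernoulli polynomial of degree $m$.
   Context: $\left(\frac{\cdot}{3}\right)$ is the Legendre symbol. Congruences are in the ring of rational numbers with denominator prime to $p$. -}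

module Defs where

open import Data.Nat as ℕ using (ℕ; zero; suc; _∸_; _%_; _^_)
open import Data.Nat.Combinatorics using (_C_)
open import Data.Nat.Divisibility using (_∣_)
open import Data.Integer as ℤ using (ℤ; +_)
open import Data.Rational as ℚ using (ℚ; 0ℚ; 1ℚ; _/_; ↥_; ↧ₙ_)
open import Data.List using (List; []; _∷_; _++_; [_])
open import Data.Product using (_×_)
open import Relation.Nullary using (¬_)

Σℕ< : ℕ → (ℕ → ℕ) → ℕ
Σℕ< zero    f = 0
Σℕ< (suc n) f = Σℕ< n f ℕ.+ f n

Σℚ< : ℕ → (ℕ → ℚ) → ℚ
Σℚ< zero    f = 0ℚ
Σℚ< (suc n) f = Σℚ< n f ℚ.+ f n

-- coefficient of x^k in S_n(x) = Σ_{k=0}^n C(n,k)^2 C(2k,k) (2k+1) x^k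
-- (for k > n the coefficient C(n,k) is 0, so this is the full coefficient sequence)
Scoeff : ℕ → ℕ → ℕ
Scoeff n k = (n C k) ℕ.* (n C k) ℕ.* ((2 ℕ.* k) C k) ℕ.* (2 ℕ.* k ℕ.+ 1)

S : ℕ → ℕ
S n = Σℕ< (suc n) (Scoeff n)

catalan : ℕ → ℚ
catalan k = (+ ((2 ℕ.* k) C k)) / suc k

toℚ : ℤ → ℚ
toℚ z = z / 1

powℚ : ℚ → ℕ → ℚ
powℚ x zero    = 1ℚ
powℚ x (suc n) = x ℚ.* powℚ x n

-- Bernoulli numbers (convention B_1 = -1/2):
-- B_0 = 1,  B_{n+1} = - 1/(n+2) Σ_{k=0}^{n} C(n+2,k) B_k
private
  wsum : ℕ → ℕ → List ℚ → ℚ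
  wsum m k []       = 0ℚ
  wsum m k (b ∷ bs) = toℚ (+ (m C k)) ℚ.* b ℚ.+ wsum m (suc k) bs

bernoulliUpTo : ℕ → List ℚ
bernoulliUpTo zero    = 1ℚ ∷ []
bernoulliUpTo (suc n) =
  bernoulliUpTo n ++ [ ℚ.- (wsum (suc (suc n)) 0 (bernoulliUpTo n) ℚ.* ((+ 1) / suc (suc n))) ]

nth : List ℚ → ℕ → ℚ
nth []       _       = 0ℚ
nth (x ∷ xs) zero    = x
nth (x ∷ xs) (suc n) = nth xs n

bernoulli : ℕ → ℚ
bernoulli n = nth (bernoulliUpTo n) n

bernoulliPoly : ℕ → ℚ → ℚ
bernoulliPoly m x = Σℚ< (suc m) (λ k → toℚ (+ (m C k)) ℚ.* bernoulli k ℚ.* powℚ x (m ∸ k))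

legendre3 : ℕ → ℤ
legendre3 a with a % 3
... | 1 = + 1
... | 2 = ℤ.- (+ 1)
... | _ = + 0

-- a ≡ b (mod p^e) in the ring of rationals with denominator prime to p:
-- (a - b) = p^e * c with c ∈ ℤ_(p), i.e. in lowest terms a - b has
-- numerator divisible by p^e and denominator not divisible by p.
CongModPow : ℕ → ℕ → ℚ → ℚ → Set
CongModPow p e a b = ((p ^ e) ∣ ℤ.∣ ↥ (a ℚ.- b) ∣) × (¬ (p ∣ ↧ₙ (a ℚ.- b)))

{-# OPTIONS --safe #-}

-- (i) Expanding C(k,j)² in the binomials C(k,j+t) and summing over k < n makes
-- the divisibility of the coefficients by n visible.  With
-- T(n) = Σ_k (k+1) C(n,k+1)² C(2k,k), the difference T(n+1) − T(n) − S_n is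
-- Σ_k C(n,k)² C(2k,k) (2n − 3k), which vanishes by the symmetry of the squared
-- trinomial coefficients.
--
-- (ii) Interchanging summations and telescoping C(k,j+1)² reduces both sums,
-- modulo p², to −p Σ_j C(2j,j) (2j+1)/j².  Since C(2j,j) ≡ (−1)^j C(p−1−j,j)
-- modulo p, this is a Fibonacci-type sum, and exact recurrences turn it into
-- Σ_m (ζ^m + ζ^(−m))/m² with ζ a primitive sixth root of unity.  By Fermat
-- 1/m² ≡ m^(p−3), so this is a combination of the values at s/6 of the power
-- sum Σ_{i<x} i^(p−3) ≡ −B_{p−2}(x)/2; the reflection x ↦ 1 − x and the
-- duplication formula express all of them through the value at 1/3.

module Submission where

-- Arithmetic modulo p is all that (ii) needs: exact rational identities first bring out one factor
-- p, and a congruence modulo p for the cofactor then gives one modulo p². In the first congruence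
-- the cofactor vanishes because the harmonic number H_{p-1} is divisible by p² and because the
-- integer quotients found in (i), taken at n = p, are congruent to 1. The obstacle is the weight
-- 1/j² in the Fibonacci-type sum: its recurrence is driven by the sum with weight 1/j, so solving
-- it produces a nested double sum. Put v_m = ζ^m + ζ^(-m). Since 1 - ζ = ζ^(-1), the alternating
-- binomial transform fixes v, and the transform of v_j/j² obeys the same recurrence up to harmonic
-- terms. Subtraction removes the double sum; modulo p the transform itself becomes a single sum, as
-- (-1)^j C(p-1,j) ≡ 1. No root of unity is adjoined: v is an integer sequence of period six.
-- Likewise 1/6 is replaced by a natural number h with 6h ≡ 1, so that a power sum up to s/6 becomes
-- an ordinary sum of s h terms.

open import Defs
open import Data.Nat as ℕ using (ℕ; zero; suc; _∸_; _<_; _≤_; z≤n; s≤s)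
import Data.Nat.Properties as ℕ
open import Data.Nat.Combinatorics using (_C_; nCk+nC[k+1]≡[n+1]C[k+1]; nCk≡nC[n∸k])
open import Data.Nat.Combinatorics.Specification using (k>n⇒nCk≡0)
open import Data.Nat.Coprimality using (Coprime; recompute)
open import Data.Nat.Divisibility using (_∣_; _∤_; >⇒∤; ∣1⇒≡1; divides)
open import Data.Nat.DivMod using (_%_; m≡m%n+[m/n]*n; [m+kn]%n≡m%n; m%n<n)
open import Data.Nat.Primality using (Prime; prime; composite; euclidsLemma; prime⇒nonTrivial)
open import Data.Nat.Solver using (module +-*-Solver)
open import Data.Integer as ℤ using (ℤ; -[1+_])
import Data.Integer.Properties as ℤ
open import Data.Rational as ℚ using (ℚ; mkℚ; 0ℚ; 1ℚ; ↥_; ↧ₙ_)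
import Data.Rational.Properties as ℚ
open import Data.Rational.Unnormalised as ℚᵘ using (mkℚᵘ; *≡*)
import Data.Rational.Unnormalised.Properties as ℚᵘ
open import Data.List using (List; []; _∷_; [_]; _++_; length)
open import Data.Maybe using (Maybe; just; nothing)
open import Data.Product using (_×_; _,_; ∃; proj₁; proj₂)
open import Data.Sum using (_⊎_; inj₁; inj₂; [_,_]′)
open import Data.Empty using (⊥-elim)
open import Algebra.Structures using (IsCommutativeRing)
open import Algebra.Bundles using (CommutativeRing)
import Algebra.Solver.Ring as RingSolver
open import Algebra.Solver.Ring.AlmostCommutativeRing
  using (AlmostCommutativeRing; fromCommutativeRing; _-Raw-AlmostCommutative⟶_)
import Algebra.Properties.Ring as RingProperties
open import Function using (_∘_)
open import Level using (0ℓ)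
open import Relation.Nullary using (¬_; yes; no)
open import Relation.Binary.Bundles using (Setoid)
import Relation.Binary.Reasoning.Setoid as SetoidReasoning
open import Relation.Binary.PropositionalEquality
  using (_≡_; refl; sym; trans; cong; cong₂; subst; subst₂; module ≡-Reasoning)

-- The second clause makes numeral z o _⊕_ 1 equal to o itself, not to o ⊕ z.
numeral : {A : Set} → A → A → (A → A → A) → ℕ → A
numeral z o _⊕_ zero          = z
numeral z o _⊕_ (suc zero)    = o
numeral z o _⊕_ (suc (suc n)) = o ⊕ numeral z o _⊕_ (suc n)

-- The identities are proved over an abstract ℚ-algebra, because the operations
-- of ℚ unfold to normalised fractions.
record ℚ-Algebra : Set₁ where
  infix  8 -_
  infixl 7 _*_
  infixl 6 _+_ _-_
  field
    K     : Set
    _+_   : K → K → K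
    _*_   : K → K → K
    -_    : K → K
    0#    : K
    1#    : K
    isCommutativeRing : IsCommutativeRing _≡_ _+_ _*_ -_ 0# 1#
    ⅟suc    : ℕ → K
    ⅟suc-inverse : ∀ n → numeral 0# 1# _+_ (suc n) * ⅟suc n ≡ 1#

  ι : ℕ → K
  ι = numeral 0# 1# _+_

  _-_ : K → K → K
  x - y = x + (- y)

  commutativeRing : CommutativeRing 0ℓ 0ℓ
  commutativeRing = record { isCommutativeRing = isCommutativeRing }

≤⊎> : ∀ m n → (∃ λ d → n ≡ m ℕ.+ d) ⊎ n < m
≤⊎> m n with ℕ.≤-<-connex m n
... | inj₁ m≤n = inj₁ (n ∸ m , sym (ℕ.m+[n∸m]≡n m≤n))
... | inj₂ n<m = inj₂ n<m

module Identities (F : ℚ-Algebra) where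
  open ℚ-Algebra F public
  open IsCommutativeRing isCommutativeRing public
    using (+-assoc; +-comm; +-identityˡ; +-identityʳ; -‿inverseʳ; *-assoc; *-comm; *-identityˡ; *-identityʳ; distribˡ; distribʳ; zeroˡ; zeroʳ)
  open RingProperties (CommutativeRing.ring commutativeRing) using (-0#≈0#; -‿distribˡ-*; -‿distribʳ-*; -‿involutive; -‿+-comm)
  open ≡-Reasoning

  -- Numerals and the ring homomorphism from the integers

  ι-suc : ∀ n → ι (suc n) ≡ 1# + ι n
  ι-suc zero    = sym (+-identityʳ 1#)
  ι-suc (suc n) = refl

  ι-+ : ∀ m n → ι (m ℕ.+ n) ≡ ι m + ι n
  ι-+ zero    n = sym (+-identityˡ _)
  ι-+ (suc m) n = begin
    ι (suc (m ℕ.+ n))    ≡⟨ ι-suc (m ℕ.+ n) ⟩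
    1# + ι (m ℕ.+ n)     ≡⟨ cong (1# +_) (ι-+ m n) ⟩
    1# + (ι m + ι n)     ≡⟨ +-assoc _ _ _ ⟨
    1# + ι m + ι n       ≡⟨ cong (_+ ι n) (ι-suc m) ⟨
    ι (suc m) + ι n      ∎

  ι-* : ∀ m n → ι (m ℕ.* n) ≡ ι m * ι n
  ι-* zero    n = sym (zeroˡ _)
  ι-* (suc m) n = begin
    ι (n ℕ.+ m ℕ.* n)     ≡⟨ ι-+ n (m ℕ.* n) ⟩
    ι n + ι (m ℕ.* n)     ≡⟨ cong₂ _+_ (sym (*-identityˡ _)) (ι-* m n) ⟩
    1# * ι n + ι m * ι n  ≡⟨ distribʳ _ _ _ ⟨
    (1# + ι m) * ι n      ≡⟨ cong (_* ι n) (ι-suc m) ⟨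
    ι (suc m) * ι n       ∎

  ιℤ : ℤ → K
  ιℤ (ℤ.+ n)    = ι n
  ιℤ -[1+ n ] = - ι (suc n)

  ιℤ-neg : ∀ i → ιℤ (ℤ.- i) ≡ - ιℤ i
  ιℤ-neg (ℤ.+ zero)  = sym -0#≈0#
  ιℤ-neg (ℤ.+ suc n) = refl
  ιℤ-neg -[1+ n ]  = sym (-‿involutive _)

  private
    cancel-1+ : ∀ x y → x - y ≡ (1# + x) - (1# + y)
    cancel-1+ x y = sym (begin
      (1# + x) + (- (1# + y))    ≡⟨ cong₂ _+_ (+-comm 1# x) (sym (-‿+-comm 1# y)) ⟩
      (x + 1#) + (- 1# + - y)    ≡⟨ +-assoc _ _ _ ⟩
      x + (1# + (- 1# + - y))    ≡⟨ cong (x +_) (+-assoc _ _ _) ⟨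
      x + ((1# - 1#) + - y)      ≡⟨ cong (λ z → x + (z + - y)) (-‿inverseʳ 1#) ⟩
      x + (0# + - y)             ≡⟨ cong (x +_) (+-identityˡ _) ⟩
      x - y                      ∎)

    ιℤ-⊖ : ∀ m n → ιℤ (m ℤ.⊖ n) ≡ ι m - ι n
    ιℤ-⊖ zero    zero    = sym (-‿inverseʳ 0#)
    ιℤ-⊖ zero    (suc n) = sym (+-identityˡ _)
    ιℤ-⊖ (suc m) zero    = sym (trans (cong (ι (suc m) +_) -0#≈0#) (+-identityʳ _))
    ιℤ-⊖ (suc m) (suc n) = begin
      ιℤ (suc m ℤ.⊖ suc n)       ≡⟨ cong ιℤ (ℤ.[1+m]⊖[1+n]≡m⊖n m n) ⟩
      ιℤ (m ℤ.⊖ n)               ≡⟨ ιℤ-⊖ m n ⟩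
      ι m - ι n                  ≡⟨ cancel-1+ _ _ ⟩
      (1# + ι m) - (1# + ι n)    ≡⟨ cong₂ _-_ (ι-suc m) (ι-suc n) ⟨
      ι (suc m) - ι (suc n)      ∎

  ιℤ-+ : ∀ i j → ιℤ (i ℤ.+ j) ≡ ιℤ i + ιℤ j
  ιℤ-+ (ℤ.+ m)    (ℤ.+ n)    = ι-+ m n
  ιℤ-+ (ℤ.+ m)    -[1+ n ] = ιℤ-⊖ m (suc n)
  ιℤ-+ -[1+ m ] (ℤ.+ n)    = trans (ιℤ-⊖ n (suc m)) (+-comm _ _)
  ιℤ-+ -[1+ m ] -[1+ n ] = begin
    - ι (suc (suc (m ℕ.+ n)))   ≡⟨ cong (λ k → - ι (suc k)) (ℕ.+-suc m n) ⟨
    - ι (suc m ℕ.+ suc n)       ≡⟨ cong -_ (ι-+ (suc m) (suc n)) ⟩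
    - (ι (suc m) + ι (suc n))   ≡⟨ -‿+-comm _ _ ⟨
    - ι (suc m) - ι (suc n)     ∎

  ιℤ-* : ∀ i j → ιℤ (i ℤ.* j) ≡ ιℤ i * ιℤ j
  ιℤ-* (ℤ.+ m)    (ℤ.+ n)    = trans (cong ιℤ (sym (ℤ.pos-* m n))) (ι-* m n)
  ιℤ-* (ℤ.+ m)    -[1+ n ] = begin
    ιℤ (ℤ.+ m ℤ.* -[1+ n ])          ≡⟨ cong ιℤ (ℤ.neg-distribʳ-* (ℤ.+ m) (ℤ.+ suc n)) ⟨
    ιℤ (ℤ.- (ℤ.+ m ℤ.* ℤ.+ suc n))     ≡⟨ ιℤ-neg (ℤ.+ m ℤ.* ℤ.+ suc n) ⟩
    - ιℤ (ℤ.+ m ℤ.* ℤ.+ suc n)         ≡⟨ cong -_ (ιℤ-* (ℤ.+ m) (ℤ.+ suc n)) ⟩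
    - (ι m * ι (suc n))            ≡⟨ -‿distribʳ-* _ _ ⟩
    ι m * - ι (suc n)              ∎
  ιℤ-* -[1+ m ] (ℤ.+ n)    = begin
    ιℤ (-[1+ m ] ℤ.* ℤ.+ n)          ≡⟨ cong ιℤ (ℤ.neg-distribˡ-* (ℤ.+ suc m) (ℤ.+ n)) ⟨
    ιℤ (ℤ.- (ℤ.+ suc m ℤ.* ℤ.+ n))     ≡⟨ ιℤ-neg (ℤ.+ suc m ℤ.* ℤ.+ n) ⟩
    - ιℤ (ℤ.+ suc m ℤ.* ℤ.+ n)         ≡⟨ cong -_ (ιℤ-* (ℤ.+ suc m) (ℤ.+ n)) ⟩
    - (ι (suc m) * ι n)            ≡⟨ -‿distribˡ-* _ _ ⟩
    - ι (suc m) * ι n              ∎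
  ιℤ-* -[1+ m ] -[1+ n ] = begin
    ι (suc m ℕ.* suc n)            ≡⟨ ι-* (suc m) (suc n) ⟩
    ι (suc m) * ι (suc n)          ≡⟨ -‿involutive _ ⟨
    - - (ι (suc m) * ι (suc n))    ≡⟨ cong -_ (-‿distribʳ-* _ _) ⟩
    - (ι (suc m) * - ι (suc n))    ≡⟨ -‿distribˡ-* _ _ ⟩
    - ι (suc m) * - ι (suc n)      ∎

  private
    ring : AlmostCommutativeRing 0ℓ 0ℓ
    ring = fromCommutativeRing commutativeRing

    ιℤ-homomorphism : CommutativeRing.rawRing ℤ.+-*-commutativeRing -Raw-AlmostCommutative⟶ ring
    ιℤ-homomorphism = record
      { ⟦_⟧ = ιℤ ; +-homo = ιℤ-+ ; *-homo = ιℤ-* ; -‿homo = ιℤ-neg ; 0-homo = refl ; 1-homo = refl }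

    -- Coefficients stay integers, so that the solver can compare them by computation although
    -- equality on the abstract `K` is not decidable.
    _coeff≟_ : ∀ i j → Maybe (ιℤ i ≡ ιℤ j)
    i coeff≟ j with i ℤ.≟ j
    ... | yes i≡j = just (cong ιℤ i≡j)
    ... | no  _   = nothing

  open RingSolver _ ring ιℤ-homomorphism _coeff≟_ public
    using (Polynomial; solve; _:=_; _:+_; _:*_; _:-_; :-_; con)

  :ι : ∀ {n} → ℕ → Polynomial n
  :ι k = con (ℤ.+ k)

  -- Finite sums and binomial coefficients

  ∑ : ℕ → (ℕ → K) → K
  ∑ zero    f = 0#
  ∑ (suc n) f = ∑ n f + f n

  ∑-cong< : ∀ n {f g : ℕ → K} → (∀ i → i < n → f i ≡ g i) → ∑ n f ≡ ∑ n g
  ∑-cong< zero    f≡g = refl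
  ∑-cong< (suc n) f≡g =
    cong₂ _+_ (∑-cong< n (λ i i<n → f≡g i (ℕ.m<n⇒m<1+n i<n))) (f≡g n (ℕ.n<1+n n))

  ∑-cong : ∀ n {f g : ℕ → K} → (∀ i → f i ≡ g i) → ∑ n f ≡ ∑ n g
  ∑-cong n f≡g = ∑-cong< n (λ i _ → f≡g i)

  ∑-+ : ∀ n (f g : ℕ → K) → ∑ n (λ i → f i + g i) ≡ ∑ n f + ∑ n g
  ∑-+ zero    f g = sym (+-identityˡ _)
  ∑-+ (suc n) f g = begin
    ∑ n (λ i → f i + g i) + (f n + g n)  ≡⟨ cong (_+ (f n + g n)) (∑-+ n f g) ⟩
    ∑ n f + ∑ n g + (f n + g n)          ≡⟨ solve 4 (λ a b c d → a :+ b :+ (c :+ d) := a :+ c :+ (b :+ d)) refl _ _ _ _ ⟩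
    ∑ n f + f n + (∑ n g + g n)          ∎

  ∑-*ˡ : ∀ n a (f : ℕ → K) → ∑ n (λ i → a * f i) ≡ a * ∑ n f
  ∑-*ˡ zero    a f = sym (zeroʳ a)
  ∑-*ˡ (suc n) a f = trans (cong (_+ a * f n) (∑-*ˡ n a f)) (sym (distribˡ a _ _))

  ∑-- : ∀ n (f g : ℕ → K) → ∑ n (λ i → f i - g i) ≡ ∑ n f - ∑ n g
  ∑-- zero    f g = sym (-‿inverseʳ 0#)
  ∑-- (suc n) f g = begin
    ∑ n (λ i → f i - g i) + (f n - g n)  ≡⟨ cong (_+ (f n - g n)) (∑-- n f g) ⟩
    ∑ n f - ∑ n g + (f n - g n)          ≡⟨ solve 4 (λ a b c d → a :- b :+ (c :- d) := a :+ c :- (b :+ d)) refl _ _ _ _ ⟩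
    ∑ n f + f n - (∑ n g + g n)          ∎

  ∑-zero : ∀ n {f : ℕ → K} → (∀ i → i < n → f i ≡ 0#) → ∑ n f ≡ 0#
  ∑-zero zero    f≡0 = refl
  ∑-zero (suc n) f≡0 =
    trans (cong₂ _+_ (∑-zero n (λ i i<n → f≡0 i (ℕ.m<n⇒m<1+n i<n))) (f≡0 n (ℕ.n<1+n n))) (+-identityˡ 0#)

  ∑-split : ∀ m n (f : ℕ → K) → ∑ (m ℕ.+ n) f ≡ ∑ m f + ∑ n (λ i → f (m ℕ.+ i))
  ∑-split m zero    f = trans (cong (λ k → ∑ k f) (ℕ.+-identityʳ m)) (sym (+-identityʳ _))
  ∑-split m (suc n) f = begin
    ∑ (m ℕ.+ suc n) f                                    ≡⟨ cong (λ k → ∑ k f) (ℕ.+-suc m n) ⟩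
    ∑ (m ℕ.+ n) f + f (m ℕ.+ n)                          ≡⟨ cong (_+ f (m ℕ.+ n)) (∑-split m n f) ⟩
    ∑ m f + ∑ n (λ i → f (m ℕ.+ i)) + f (m ℕ.+ n)        ≡⟨ +-assoc _ _ _ ⟩
    ∑ m f + (∑ n (λ i → f (m ℕ.+ i)) + f (m ℕ.+ n))      ∎

  ∑-head : ∀ n (f : ℕ → K) → ∑ (suc n) f ≡ f 0 + ∑ n (λ i → f (suc i))
  ∑-head n f = trans (∑-split 1 n f) (cong (_+ ∑ n (λ i → f (suc i))) (+-identityˡ _))

  ∑-swap : ∀ m n (f : ℕ → ℕ → K) → ∑ m (λ i → ∑ n (f i)) ≡ ∑ n (λ j → ∑ m (λ i → f i j))
  ∑-swap zero    n f = sym (∑-zero n (λ _ _ → refl))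
  ∑-swap (suc m) n f = trans (cong (_+ ∑ n (f m)) (∑-swap m n f)) (sym (∑-+ n _ _))

  ∑-reverse : ∀ n (f : ℕ → K) → ∑ (suc n) f ≡ ∑ (suc n) (λ i → f (n ∸ i))
  ∑-reverse zero    f = refl
  ∑-reverse (suc n) f = begin
    ∑ (suc n) f + f (suc n)                          ≡⟨ +-comm _ _ ⟩
    f (suc n) + ∑ (suc n) f                          ≡⟨ cong (f (suc n) +_) (∑-reverse n f) ⟩
    f (suc n) + ∑ (suc n) (λ i → f (n ∸ i))          ≡⟨ ∑-head (suc n) (λ i → f (suc n ∸ i)) ⟨
    ∑ (suc (suc n)) (λ i → f (suc n ∸ i))            ∎

  ∑-extend : ∀ m n {f : ℕ → K} → m ≤ n → (∀ i → m ≤ i → f i ≡ 0#) → ∑ n f ≡ ∑ m f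
  ∑-extend m n {f} m≤n f≡0 = begin
    ∑ n f                                            ≡⟨ cong (λ k → ∑ k f) (ℕ.m+[n∸m]≡n m≤n) ⟨
    ∑ (m ℕ.+ (n ∸ m)) f                              ≡⟨ ∑-split m (n ∸ m) f ⟩
    ∑ m f + ∑ (n ∸ m) (λ i → f (m ℕ.+ i))            ≡⟨ cong (∑ m f +_) (∑-zero (n ∸ m) (λ i _ → f≡0 _ (ℕ.m≤m+n m i))) ⟩
    ∑ m f + 0#                                       ≡⟨ +-identityʳ _ ⟩
    ∑ m f                                            ∎

  ∑-telescope : ∀ n (f : ℕ → K) → ∑ n (λ i → f (suc i) - f i) ≡ f n - f 0
  ∑-telescope zero    f = sym (-‿inverseʳ _)
  ∑-telescope (suc n) f = trans (cong (_+ (f (suc n) - f n)) (∑-telescope n f))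
    (solve 3 (λ a b c → a :- b :+ (c :- a) := c :- b) refl _ _ _)

  ι-cancel : ∀ n {x y} → ι (suc n) * x ≡ ι (suc n) * y → x ≡ y
  ι-cancel n {x} {y} eq = begin
    x                              ≡⟨ lemma x ⟨
    ⅟suc n * (ι (suc n) * x)       ≡⟨ cong (⅟suc n *_) eq ⟩
    ⅟suc n * (ι (suc n) * y)       ≡⟨ lemma y ⟩
    y                              ∎
    where
    lemma : ∀ z → ⅟suc n * (ι (suc n) * z) ≡ z
    lemma z = begin
      ⅟suc n * (ι (suc n) * z)     ≡⟨ solve 3 (λ a b c → a :* (b :* c) := b :* a :* c) refl _ _ _ ⟩
      ι (suc n) * ⅟suc n * z       ≡⟨ cong (_* z) (⅟suc-inverse n) ⟩
      1# * z                       ≡⟨ *-identityˡ z ⟩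
      z                            ∎

  opaque
    -- Opaque, so that unification compares binomial coefficients by their arguments instead of
    -- unfolding `_C_`; later proofs rely on the laws of this block alone.
    bin : ℕ → ℕ → K
    bin n k = ι (n C k)

    bin≡ι : ∀ n k → bin n k ≡ ι (n C k)
    bin≡ι n k = refl

    bin-zero : ∀ n → bin n 0 ≡ 1#
    bin-zero n = refl

    bin-pascal : ∀ n k → bin (suc n) (suc k) ≡ bin n k + bin n (suc k)
    bin-pascal n k = trans (cong ι (sym (nCk+nC[k+1]≡[n+1]C[k+1] n k))) (ι-+ (n C k) _)

    bin-large : ∀ n k → n < k → bin n k ≡ 0#
    bin-large n k n<k = cong ι (k>n⇒nCk≡0 n<k)

    bin-sym : ∀ n k → k ≤ n → bin n k ≡ bin n (n ∸ k)
    bin-sym n k k≤n = cong ι (nCk≡nC[n∸k] k≤n)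

  bin-diag : ∀ n → bin n n ≡ 1#
  bin-diag zero    = bin-zero 0
  bin-diag (suc n) = trans (bin-pascal n n)
    (trans (cong₂ _+_ (bin-diag n) (bin-large n (suc n) (ℕ.n<1+n n))) (+-identityʳ 1#))

  bin-sym-+ : ∀ m n → bin (m ℕ.+ n) m ≡ bin (m ℕ.+ n) n
  bin-sym-+ m n = trans (bin-sym (m ℕ.+ n) m (ℕ.m≤m+n m n)) (cong (bin (m ℕ.+ n)) (ℕ.m+n∸m≡n m n))

  bin-absorb : ∀ n k → ι (suc k) * bin (suc n) (suc k) ≡ ι (suc n) * bin n k
  bin-absorb zero    zero    = cong (1# *_) (trans (bin-diag 1) (sym (bin-zero 0)))
  bin-absorb zero    (suc k) = trans (cong (ι (suc (suc k)) *_) (bin-large 1 (suc (suc k)) (s≤s (s≤s z≤n))))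
    (trans (zeroʳ _) (sym (trans (cong (1# *_) (bin-large 0 (suc k) (s≤s z≤n))) (zeroʳ _))))
  bin-absorb (suc n) zero    = begin
    1# * bin (suc (suc n)) 1                      ≡⟨ cong (1# *_) (trans (bin-pascal (suc n) 0) (cong (_+ bin (suc n) 1) (bin-zero (suc n)))) ⟩
    1# * (1# + bin (suc n) 1)                     ≡⟨ solve 1 (λ b → :ι 1 :* (:ι 1 :+ b) := :ι 1 :+ :ι 1 :* b) refl _ ⟩
    1# + 1# * bin (suc n) 1                       ≡⟨ cong (1# +_) (trans (bin-absorb n 0) (cong (ι (suc n) *_) (bin-zero n))) ⟩
    1# + ι (suc n) * 1#                           ≡⟨ solve 1 (λ x → :ι 1 :+ x :* :ι 1 := (:ι 1 :+ x) :* :ι 1) refl _ ⟩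
    ι (suc (suc n)) * 1#                          ≡⟨ cong (ι (suc (suc n)) *_) (bin-zero (suc n)) ⟨
    ι (suc (suc n)) * bin (suc n) 0               ∎
  bin-absorb (suc n) (suc k) = begin
    ι (suc (suc k)) * bin (suc (suc n)) (suc (suc k))                    ≡⟨ cong (ι (suc (suc k)) *_) (bin-pascal (suc n) (suc k)) ⟩
    (1# + ι (suc k)) * (bin (suc n) (suc k) + bin (suc n) (suc (suc k))) ≡⟨ solve 3 (λ x b c → (:ι 1 :+ x) :* (b :+ c) := b :+ x :* b :+ (:ι 1 :+ x) :* c) refl _ _ _ ⟩
    bin (suc n) (suc k) + ι (suc k) * bin (suc n) (suc k)
      + ι (suc (suc k)) * bin (suc n) (suc (suc k))                      ≡⟨ cong₂ (λ u v → bin (suc n) (suc k) + u + v) (bin-absorb n k) (bin-absorb n (suc k)) ⟩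
    bin (suc n) (suc k) + ι (suc n) * bin n k + ι (suc n) * bin n (suc k)
      ≡⟨ solve 4 (λ b x c d → b :+ x :* c :+ x :* d := b :+ x :* (c :+ d)) refl _ _ _ _ ⟩
    bin (suc n) (suc k) + ι (suc n) * (bin n k + bin n (suc k))          ≡⟨ cong (λ u → bin (suc n) (suc k) + ι (suc n) * u) (bin-pascal n k) ⟨
    bin (suc n) (suc k) + ι (suc n) * bin (suc n) (suc k)                ≡⟨ solve 2 (λ b x → b :+ x :* b := (:ι 1 :+ x) :* b) refl _ _ ⟩
    ι (suc (suc n)) * bin (suc n) (suc k)                                ∎

  -- Pascal's rule combined with absorption. With the difference taken in `K` it holds for k ≥ n as
  -- well, where natural subtraction would truncate.
  bin-step : ∀ n k → ι (suc k) * bin n (suc k) ≡ (ι n - ι k) * bin n k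
  bin-step n k = begin
    ι (suc k) * bin n (suc k)
      ≡⟨ solve 3 (λ x b c → x :* c := x :* (b :+ c) :- x :* b) refl _ (bin n k) _ ⟩
    ι (suc k) * (bin n k + bin n (suc k)) - ι (suc k) * bin n k
      ≡⟨ cong (λ u → ι (suc k) * u - ι (suc k) * bin n k) (bin-pascal n k) ⟨
    ι (suc k) * bin (suc n) (suc k) - ι (suc k) * bin n k
      ≡⟨ cong (_- ι (suc k) * bin n k) (bin-absorb n k) ⟩
    ι (suc n) * bin n k - ι (suc k) * bin n k
      ≡⟨ cong₂ (λ u v → u * bin n k - v * bin n k) (ι-suc n) (ι-suc k) ⟩
    (1# + ι n) * bin n k - (1# + ι k) * bin n k
      ≡⟨ solve 3 (λ x y b → (:ι 1 :+ x) :* b :- (:ι 1 :+ y) :* b := (x :- y) :* b) refl _ _ _ ⟩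
    (ι n - ι k) * bin n k ∎

  -- Nested subsets of sizes i and i + t can be chosen in either order. The offsets `d` and `t` keep
  -- truncated subtraction out of the statement.
  bin-trinomial : ∀ i d t → bin (i ℕ.+ d) (i ℕ.+ t) * bin (i ℕ.+ t) i ≡ bin (i ℕ.+ d) i * bin d t
  bin-trinomial zero    d t = trans (*-comm _ _) (cong (_* bin d t) (trans (bin-zero t) (sym (bin-zero d))))
  bin-trinomial (suc i) d t = ι-cancel i (begin
    ι (suc i) * (bin (suc (i ℕ.+ d)) (suc (i ℕ.+ t)) * bin (suc (i ℕ.+ t)) (suc i))
      ≡⟨ solve 3 (λ x b c → x :* (b :* c) := b :* (x :* c)) refl _ _ _ ⟩
    bin (suc (i ℕ.+ d)) (suc (i ℕ.+ t)) * (ι (suc i) * bin (suc (i ℕ.+ t)) (suc i))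
      ≡⟨ cong (bin (suc (i ℕ.+ d)) (suc (i ℕ.+ t)) *_) (bin-absorb (i ℕ.+ t) i) ⟩
    bin (suc (i ℕ.+ d)) (suc (i ℕ.+ t)) * (ι (suc (i ℕ.+ t)) * bin (i ℕ.+ t) i)
      ≡⟨ solve 3 (λ x b c → b :* (x :* c) := (x :* b) :* c) refl _ _ _ ⟩
    ι (suc (i ℕ.+ t)) * bin (suc (i ℕ.+ d)) (suc (i ℕ.+ t)) * bin (i ℕ.+ t) i
      ≡⟨ cong (_* bin (i ℕ.+ t) i) (bin-absorb (i ℕ.+ d) (i ℕ.+ t)) ⟩
    ι (suc (i ℕ.+ d)) * bin (i ℕ.+ d) (i ℕ.+ t) * bin (i ℕ.+ t) i
      ≡⟨ *-assoc _ _ _ ⟩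
    ι (suc (i ℕ.+ d)) * (bin (i ℕ.+ d) (i ℕ.+ t) * bin (i ℕ.+ t) i)
      ≡⟨ cong (ι (suc (i ℕ.+ d)) *_) (bin-trinomial i d t) ⟩
    ι (suc (i ℕ.+ d)) * (bin (i ℕ.+ d) i * bin d t)
      ≡⟨ *-assoc _ _ _ ⟨
    ι (suc (i ℕ.+ d)) * bin (i ℕ.+ d) i * bin d t
      ≡⟨ cong (_* bin d t) (bin-absorb (i ℕ.+ d) i) ⟨
    ι (suc i) * bin (suc (i ℕ.+ d)) (suc i) * bin d t
      ≡⟨ *-assoc _ _ _ ⟩
    ι (suc i) * (bin (suc (i ℕ.+ d)) (suc i) * bin d t) ∎)

  -- Pascal's rule as a summation by parts: it matches explicit binomial sums with sums defined by
  -- recursion on n.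
  ∑-pascal : ∀ n (f : ℕ → K) → ∑ (suc (suc n)) (λ k → bin (suc n) k * f k) ≡ ∑ (suc n) (λ k → bin n k * (f k + f (suc k)))
  ∑-pascal n f = begin
    ∑ (suc (suc n)) (λ k → bin (suc n) k * f k)
      ≡⟨ trans (∑-head (suc n) _) (cong₂ _+_ (cong (_* f 0) (bin-zero (suc n))) refl) ⟩
    1# * f 0 + ∑ (suc n) (λ k → bin (suc n) (suc k) * f (suc k))
      ≡⟨ cong (1# * f 0 +_) (∑-cong (suc n) (λ k → trans (cong (_* f (suc k)) (bin-pascal n k)) (distribʳ _ _ _))) ⟩
    1# * f 0 + ∑ (suc n) (λ k → bin n k * f (suc k) + bin n (suc k) * f (suc k))
      ≡⟨ cong (1# * f 0 +_) (∑-+ (suc n) _ _) ⟩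
    1# * f 0 + (∑ (suc n) (λ k → bin n k * f (suc k)) + ∑ (suc n) (λ k → bin n (suc k) * f (suc k)))
      ≡⟨ solve 3 (λ a b c → a :+ (b :+ c) := a :+ c :+ b) refl _ _ _ ⟩
    1# * f 0 + ∑ (suc n) (λ k → bin n (suc k) * f (suc k)) + ∑ (suc n) (λ k → bin n k * f (suc k))
      ≡⟨ cong (_+ ∑ (suc n) (λ k → bin n k * f (suc k)))
           (trans (∑-head (suc n) (λ k → bin n k * f k)) (cong₂ _+_ (cong (_* f 0) (bin-zero n)) refl)) ⟨
    ∑ (suc (suc n)) (λ k → bin n k * f k) + ∑ (suc n) (λ k → bin n k * f (suc k))
      ≡⟨ cong (_+ ∑ (suc n) (λ k → bin n k * f (suc k))) (∑-extend (suc n) (suc (suc n)) (ℕ.n≤1+n _)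
           (λ k n<k → trans (cong (_* f k) (bin-large n k n<k)) (zeroˡ _))) ⟩
    ∑ (suc n) (λ k → bin n k * f k) + ∑ (suc n) (λ k → bin n k * f (suc k))
      ≡⟨ ∑-+ (suc n) _ _ ⟨
    ∑ (suc n) (λ k → bin n k * f k + bin n k * f (suc k))
      ≡⟨ ∑-cong (suc n) (λ k → sym (distribˡ _ _ _)) ⟩
    ∑ (suc n) (λ k → bin n k * (f k + f (suc k))) ∎

  vandermonde : ∀ m n b → ∑ (suc m) (λ u → bin m u * bin n (b ℕ.+ u)) ≡ bin (m ℕ.+ n) (m ℕ.+ b)
  vandermonde zero    n b = begin
    0# + bin 0 0 * bin n (b ℕ.+ 0) ≡⟨ cong (λ u → 0# + u * bin n (b ℕ.+ 0)) (bin-zero 0) ⟩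
    0# + 1# * bin n (b ℕ.+ 0)     ≡⟨ solve 1 (λ x → :ι 0 :+ :ι 1 :* x := x) refl _ ⟩
    bin n (b ℕ.+ 0)               ≡⟨ cong (bin n) (ℕ.+-identityʳ b) ⟩
    bin n b                       ∎
  vandermonde (suc m) n b = begin
    ∑ (suc (suc m)) (λ u → bin (suc m) u * bin n (b ℕ.+ u))
      ≡⟨ ∑-pascal m _ ⟩
    ∑ (suc m) (λ u → bin m u * (bin n (b ℕ.+ u) + bin n (b ℕ.+ suc u)))
      ≡⟨ ∑-cong (suc m) (λ u → trans (distribˡ _ _ _) (cong (λ k → bin m u * bin n (b ℕ.+ u) + bin m u * bin n k) (ℕ.+-suc b u))) ⟩
    ∑ (suc m) (λ u → bin m u * bin n (b ℕ.+ u) + bin m u * bin n (suc b ℕ.+ u))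
      ≡⟨ ∑-+ (suc m) _ _ ⟩
    ∑ (suc m) (λ u → bin m u * bin n (b ℕ.+ u)) + ∑ (suc m) (λ u → bin m u * bin n (suc b ℕ.+ u))
      ≡⟨ cong₂ _+_ (vandermonde m n b) (vandermonde m n (suc b)) ⟩
    bin (m ℕ.+ n) (m ℕ.+ b) + bin (m ℕ.+ n) (m ℕ.+ suc b)
      ≡⟨ cong (λ k → bin (m ℕ.+ n) (m ℕ.+ b) + bin (m ℕ.+ n) k) (ℕ.+-suc m b) ⟩
    bin (m ℕ.+ n) (m ℕ.+ b) + bin (m ℕ.+ n) (suc (m ℕ.+ b))
      ≡⟨ bin-pascal (m ℕ.+ n) (m ℕ.+ b) ⟨
    bin (suc m ℕ.+ n) (suc m ℕ.+ b) ∎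

  vandermonde₀ : ∀ m n → ∑ (suc m) (λ u → bin m u * bin n u) ≡ bin (m ℕ.+ n) m
  vandermonde₀ m n = trans (vandermonde m n 0) (cong (bin (m ℕ.+ n)) (ℕ.+-identityʳ m))

  -- Trinomial revision extracts C(m,j) and leaves Vandermonde's Σ C(j,t) C(m-j,t) = C(m,j). The
  -- right side is linear in the C(m,j+t), so it can be summed over m by the hockey-stick identity.
  bin-square : ∀ m j → bin m j * bin m j ≡ ∑ (suc j) (λ t → bin m (j ℕ.+ t) * bin (j ℕ.+ t) j * bin j t)
  bin-square m j with ≤⊎> j m
  ... | inj₁ (d , refl) = sym (begin
    ∑ (suc j) (λ t → bin (j ℕ.+ d) (j ℕ.+ t) * bin (j ℕ.+ t) j * bin j t)
      ≡⟨ ∑-cong (suc j) (λ t → trans (cong (_* bin j t) (bin-trinomial j d t))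
           (solve 3 (λ a b c → a :* b :* c := a :* (c :* b)) refl _ _ _)) ⟩
    ∑ (suc j) (λ t → bin (j ℕ.+ d) j * (bin j t * bin d t))
      ≡⟨ ∑-*ˡ (suc j) _ _ ⟩
    bin (j ℕ.+ d) j * ∑ (suc j) (λ t → bin j t * bin d t)
      ≡⟨ cong (bin (j ℕ.+ d) j *_) (vandermonde₀ j d) ⟩
    bin (j ℕ.+ d) j * bin (j ℕ.+ d) j ∎)
  ... | inj₂ m<j = begin
    bin m j * bin m j   ≡⟨ cong (_* bin m j) (bin-large m j m<j) ⟩
    0# * bin m j        ≡⟨ zeroˡ _ ⟩
    0#                  ≡⟨ ∑-zero (suc j) (λ t _ → trans (cong (λ u → u * bin (j ℕ.+ t) j * bin j t)
                             (bin-large m (j ℕ.+ t) (ℕ.<-≤-trans m<j (ℕ.m≤m+n j t))))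
                             (trans (cong (_* bin j t) (zeroˡ _)) (zeroˡ _))) ⟨
    ∑ (suc j) (λ t → bin m (j ℕ.+ t) * bin (j ℕ.+ t) j * bin j t) ∎

  hockey-stick : ∀ n s → ∑ n (λ k → bin k s) ≡ bin n (suc s)
  hockey-stick zero    s = sym (bin-large 0 (suc s) (s≤s z≤n))
  hockey-stick (suc n) s = begin
    ∑ n (λ k → bin k s) + bin n s    ≡⟨ cong (_+ bin n s) (hockey-stick n s) ⟩
    bin n (suc s) + bin n s          ≡⟨ +-comm _ _ ⟩
    bin n s + bin n (suc s)          ≡⟨ bin-pascal n s ⟨
    bin (suc n) (suc s)              ∎

  -- Partial sums of S_n

  sq : K → K
  sq x = x * x

  cb : ℕ → K
  cb k = bin (k ℕ.+ k) k

  ∑-bin-square : ∀ n j → ∑ n (λ k → sq (bin k j)) ≡ ∑ (suc j) (λ t → bin n (suc (j ℕ.+ t)) * bin (j ℕ.+ t) j * bin j t)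
  ∑-bin-square n j = begin
    ∑ n (λ k → sq (bin k j))
      ≡⟨ ∑-cong n (λ k → bin-square k j) ⟩
    ∑ n (λ k → ∑ (suc j) (λ t → bin k (j ℕ.+ t) * bin (j ℕ.+ t) j * bin j t))
      ≡⟨ ∑-swap n (suc j) _ ⟩
    ∑ (suc j) (λ t → ∑ n (λ k → bin k (j ℕ.+ t) * bin (j ℕ.+ t) j * bin j t))
      ≡⟨ ∑-cong (suc j) (λ t → begin
           ∑ n (λ k → bin k (j ℕ.+ t) * bin (j ℕ.+ t) j * bin j t)
             ≡⟨ ∑-cong n (λ k → solve 3 (λ a b c → a :* b :* c := b :* c :* a) refl _ _ _) ⟩
           ∑ n (λ k → bin (j ℕ.+ t) j * bin j t * bin k (j ℕ.+ t))
             ≡⟨ ∑-*ˡ n _ _ ⟩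
           bin (j ℕ.+ t) j * bin j t * ∑ n (λ k → bin k (j ℕ.+ t))
             ≡⟨ cong (bin (j ℕ.+ t) j * bin j t *_) (hockey-stick n (j ℕ.+ t)) ⟩
           bin (j ℕ.+ t) j * bin j t * bin n (suc (j ℕ.+ t))
             ≡⟨ solve 3 (λ a b c → b :* c :* a := a :* b :* c) refl _ _ _ ⟩
           bin n (suc (j ℕ.+ t)) * bin (j ℕ.+ t) j * bin j t ∎) ⟩
    ∑ (suc j) (λ t → bin n (suc (j ℕ.+ t)) * bin (j ℕ.+ t) j * bin j t) ∎

  -- The coefficient of x^j in (1/n) Σ_{k<n} S_k(x) for n = m + 1, in a form that is visibly an
  -- integer.
  Q : ℕ → ℕ → K
  Q m j = ∑ (suc j) (λ t → bin m (j ℕ.+ t) * bin (suc (j ℕ.+ j)) (suc (j ℕ.+ t)) * sq (bin (j ℕ.+ t) j))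

  ι-odd : ∀ j → ι (suc (j ℕ.+ j)) ≡ ι 2 * ι j + 1#
  ι-odd j = trans (ι-suc (j ℕ.+ j)) (trans (cong (1# +_) (ι-+ j j))
    (solve 1 (λ x → :ι 1 :+ (x :+ x) := :ι 2 :* x :+ :ι 1) refl _))

  -- In each term trinomial revision turns C(2j,j) C(j,t) into C(2j,j+t) C(j+t,j). Two absorptions
  -- then trade the factor 2j + 1 for j + t + 1 and this for m + 1.
  ∑-bin-square-divisible : ∀ m j → (ι 2 * ι j + 1#) * cb j * ∑ (suc m) (λ k → sq (bin k j)) ≡ ι (suc m) * Q m j
  ∑-bin-square-divisible m j = begin
    (ι 2 * ι j + 1#) * cb j * ∑ (suc m) (λ k → sq (bin k j))
      ≡⟨ cong₂ (λ x y → x * cb j * y) (sym (ι-odd j)) (∑-bin-square (suc m) j) ⟩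
    o * cb j * ∑ (suc j) (λ t → bin (suc m) (suc (j ℕ.+ t)) * bin (j ℕ.+ t) j * bin j t)
      ≡⟨ ∑-*ˡ (suc j) _ _ ⟨
    ∑ (suc j) (λ t → o * cb j * (bin (suc m) (suc (j ℕ.+ t)) * bin (j ℕ.+ t) j * bin j t))
      ≡⟨ ∑-cong (suc j) term ⟩
    ∑ (suc j) (λ t → ι (suc m) * (bin m (j ℕ.+ t) * bin (suc (j ℕ.+ j)) (suc (j ℕ.+ t)) * sq (bin (j ℕ.+ t) j)))
      ≡⟨ ∑-*ˡ (suc j) _ _ ⟩
    ι (suc m) * Q m j ∎
    where
    o = ι (suc (j ℕ.+ j))
    term : ∀ t → o * cb j * (bin (suc m) (suc (j ℕ.+ t)) * bin (j ℕ.+ t) j * bin j t)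
               ≡ ι (suc m) * (bin m (j ℕ.+ t) * bin (suc (j ℕ.+ j)) (suc (j ℕ.+ t)) * sq (bin (j ℕ.+ t) j))
    term t = begin
      o * cb j * (A * B * bin j t)
        ≡⟨ solve 5 (λ o c a b d → o :* c :* (a :* b :* d) := o :* (c :* d) :* a :* b) refl _ _ _ _ _ ⟩
      o * (cb j * bin j t) * A * B
        ≡⟨ cong (λ x → o * x * A * B) (bin-trinomial j j t) ⟨
      o * (bin (j ℕ.+ j) (j ℕ.+ t) * B) * A * B
        ≡⟨ solve 4 (λ o c a b → o :* (c :* b) :* a :* b := (o :* c) :* (a :* (b :* b))) refl _ _ _ _ ⟩
      (o * bin (j ℕ.+ j) (j ℕ.+ t)) * (A * sq B)
        ≡⟨ cong (_* (A * sq B)) (bin-absorb (j ℕ.+ j) (j ℕ.+ t)) ⟨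
      (ι (suc (j ℕ.+ t)) * D) * (A * sq B)
        ≡⟨ solve 4 (λ i d a b → (i :* d) :* (a :* b) := (i :* a) :* (d :* b)) refl _ _ _ _ ⟩
      (ι (suc (j ℕ.+ t)) * A) * (D * sq B)
        ≡⟨ cong (_* (D * sq B)) (bin-absorb m (j ℕ.+ t)) ⟩
      (ι (suc m) * bin m (j ℕ.+ t)) * (D * sq B)
        ≡⟨ solve 4 (λ i c d b → (i :* c) :* (d :* b) := i :* (c :* d :* b)) refl _ _ _ _ ⟩
      ι (suc m) * (bin m (j ℕ.+ t) * D * sq B) ∎
      where
      A = bin (suc m) (suc (j ℕ.+ t))
      B = bin (j ℕ.+ t) j
      D = bin (suc (j ℕ.+ j)) (suc (j ℕ.+ t))

  ι-∸ : ∀ d i → i ≤ d → ι (d ∸ i) ≡ ι d - ι i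
  ι-∸ d i i≤d = begin
    ι (d ∸ i)                   ≡⟨ solve 2 (λ x y → y := x :+ y :- x) refl (ι i) _ ⟩
    ι i + ι (d ∸ i) - ι i       ≡⟨ cong (_- ι i) (ι-+ i (d ∸ i)) ⟨
    ι (i ℕ.+ (d ∸ i)) - ι i     ≡⟨ cong (λ k → ι k - ι i) (ℕ.m+[n∸m]≡n i≤d) ⟩
    ι d - ι i                   ∎

  ∑-sq-bin : ∀ k → ∑ (suc k) (λ a → sq (bin k a)) ≡ cb k
  ∑-sq-bin k = vandermonde₀ k k

  -- By the symmetry i ↦ d - i, the average of d - i under the weights C(d,i)² is d/2.
  ∑-sq-bin-weighted : ∀ d → ι 2 * ∑ (suc d) (λ i → (ι d - ι i) * sq (bin d i)) ≡ ι d * cb d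
  ∑-sq-bin-weighted d = begin
    ι 2 * P                           ≡⟨ solve 1 (λ x → :ι 2 :* x := x :+ x) refl _ ⟩
    P + P                             ≡⟨ cong (P +_) reversed ⟩
    P + ∑ (suc d) (λ i → ι i * sq (bin d i))
      ≡⟨ ∑-+ (suc d) _ _ ⟨
    ∑ (suc d) (λ i → (ι d - ι i) * sq (bin d i) + ι i * sq (bin d i))
      ≡⟨ ∑-cong (suc d) (λ i → solve 3 (λ d i b → (d :- i) :* b :+ i :* b := d :* b) refl _ _ _) ⟩
    ∑ (suc d) (λ i → ι d * sq (bin d i))
      ≡⟨ ∑-*ˡ (suc d) _ _ ⟩
    ι d * ∑ (suc d) (λ i → sq (bin d i))
      ≡⟨ cong (ι d *_) (∑-sq-bin d) ⟩
    ι d * cb d                        ∎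
    where
    P = ∑ (suc d) (λ i → (ι d - ι i) * sq (bin d i))
    reversed : P ≡ ∑ (suc d) (λ i → ι i * sq (bin d i))
    reversed = trans (∑-reverse d _) (∑-cong< (suc d) (λ { i (s≤s i≤d) → cong₂ (λ x y → x * sq y)
      (trans (cong (λ u → ι d - u) (ι-∸ d i i≤d)) (solve 2 (λ x y → x :- (x :- y) := y) refl _ _))
      (sym (bin-sym d i i≤d)) }))

  -- Σ_k C(n,k)²C(2k,k) is the sum of the squares of the multinomial
  -- coefficients n!/(a!b!c!)², whose symmetry in a, b, c makes the averages
  -- of c = n − k and of a = k/2 equal.
  ∑-multinomial-symmetry : ∀ n →
    ι 2 * ∑ (suc n) (λ k → (ι n - ι k) * (sq (bin n k) * cb k)) ≡ ∑ (suc n) (λ k → ι k * (sq (bin n k) * cb k))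
  ∑-multinomial-symmetry n = begin
    ι 2 * ∑ (suc n) (λ k → (ι n - ι k) * (sq (bin n k) * cb k))
      ≡⟨ cong (ι 2 *_) (∑-cong< (suc n) expand) ⟩
    ι 2 * ∑ (suc n) (λ k → ∑ (suc n) (λ a → (ι n - ι k) * sq (bin n k) * sq (bin k a)))
      ≡⟨ cong (ι 2 *_) (∑-swap (suc n) (suc n) _) ⟩
    ι 2 * ∑ (suc n) (λ a → ∑ (suc n) (λ k → (ι n - ι k) * sq (bin n k) * sq (bin k a)))
      ≡⟨ ∑-*ˡ (suc n) _ _ ⟨
    ∑ (suc n) (λ a → ι 2 * ∑ (suc n) (λ k → (ι n - ι k) * sq (bin n k) * sq (bin k a)))
      -- For fixed a only the other two parts of n vary; they share d = n - a equally on average.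
      ≡⟨ ∑-cong< (suc n) (λ { a (s≤s a≤n) → subst
           (λ m → ι 2 * ∑ (suc m) (λ k → (ι m - ι k) * sq (bin m k) * sq (bin k a)) ≡ sq (bin m a) * (ι (n ∸ a) * cb (n ∸ a)))
           (ℕ.m+[n∸m]≡n a≤n) (inner a (n ∸ a)) }) ⟩
    ∑ (suc n) (λ a → sq (bin n a) * (ι (n ∸ a) * cb (n ∸ a)))
      ≡⟨ ∑-cong< (suc n) (λ { a (s≤s a≤n) → trans (cong (λ b → sq b * (ι (n ∸ a) * cb (n ∸ a))) (bin-sym n a a≤n))
           (solve 3 (λ b i c → b :* (i :* c) := i :* (b :* c)) refl _ _ _) }) ⟩
    ∑ (suc n) (λ a → ι (n ∸ a) * (sq (bin n (n ∸ a)) * cb (n ∸ a)))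
      ≡⟨ ∑-reverse n _ ⟨
    ∑ (suc n) (λ k → ι k * (sq (bin n k) * cb k)) ∎
    where
    expand : ∀ k → k < suc n → (ι n - ι k) * (sq (bin n k) * cb k) ≡ ∑ (suc n) (λ a → (ι n - ι k) * sq (bin n k) * sq (bin k a))
    expand k k<n = begin
      (ι n - ι k) * (sq (bin n k) * cb k)
        ≡⟨ *-assoc _ _ _ ⟨
      (ι n - ι k) * sq (bin n k) * cb k
        ≡⟨ cong ((ι n - ι k) * sq (bin n k) *_) (trans (∑-extend (suc k) (suc n) k<n
             (λ a k<a → trans (cong (_* bin k a) (bin-large k a k<a)) (zeroˡ _))) (∑-sq-bin k)) ⟨
      (ι n - ι k) * sq (bin n k) * ∑ (suc n) (λ a → sq (bin k a))
        ≡⟨ ∑-*ˡ (suc n) _ _ ⟨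
      ∑ (suc n) (λ a → (ι n - ι k) * sq (bin n k) * sq (bin k a)) ∎
    inner : ∀ a d → ι 2 * ∑ (suc (a ℕ.+ d)) (λ k → (ι (a ℕ.+ d) - ι k) * sq (bin (a ℕ.+ d) k) * sq (bin k a))
                  ≡ sq (bin (a ℕ.+ d) a) * (ι d * cb d)
    inner a d = begin
      ι 2 * ∑ (suc (a ℕ.+ d)) g
        ≡⟨ cong (λ m → ι 2 * ∑ m g) (ℕ.+-suc a d) ⟨
      ι 2 * ∑ (a ℕ.+ suc d) g
        ≡⟨ cong (ι 2 *_) (∑-split a (suc d) g) ⟩
      ι 2 * (∑ a g + ∑ (suc d) (λ i → g (a ℕ.+ i)))
        ≡⟨ cong₂ (λ x y → ι 2 * (x + y))
             (∑-zero a (λ k k<a → trans (cong (λ b → (ι (a ℕ.+ d) - ι k) * sq (bin (a ℕ.+ d) k) * sq b) (bin-large k a k<a))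
                                        (solve 1 (λ x → x :* (:ι 0 :* :ι 0) := :ι 0) refl _)))
             (∑-cong (suc d) term) ⟩
      ι 2 * (0# + ∑ (suc d) (λ i → sq (bin (a ℕ.+ d) a) * ((ι d - ι i) * sq (bin d i))))
        ≡⟨ cong (λ x → ι 2 * (0# + x)) (∑-*ˡ (suc d) _ _) ⟩
      ι 2 * (0# + sq (bin (a ℕ.+ d) a) * ∑ (suc d) (λ i → (ι d - ι i) * sq (bin d i)))
        ≡⟨ solve 2 (λ b x → :ι 2 :* (:ι 0 :+ b :* x) := b :* (:ι 2 :* x)) refl _ _ ⟩
      sq (bin (a ℕ.+ d) a) * (ι 2 * ∑ (suc d) (λ i → (ι d - ι i) * sq (bin d i)))
        ≡⟨ cong (sq (bin (a ℕ.+ d) a) *_) (∑-sq-bin-weighted d) ⟩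
      sq (bin (a ℕ.+ d) a) * (ι d * cb d) ∎
      where
      g : ℕ → K
      g k = (ι (a ℕ.+ d) - ι k) * sq (bin (a ℕ.+ d) k) * sq (bin k a)
      term : ∀ i → g (a ℕ.+ i) ≡ sq (bin (a ℕ.+ d) a) * ((ι d - ι i) * sq (bin d i))
      term i = begin
        (ι (a ℕ.+ d) - ι (a ℕ.+ i)) * sq X * sq Y
          ≡⟨ cong₂ (λ u v → (u - v) * sq X * sq Y) (ι-+ a d) (ι-+ a i) ⟩
        (ι a + ι d - (ι a + ι i)) * sq X * sq Y
          ≡⟨ solve 5 (λ a d i x y → (a :+ d :- (a :+ i)) :* (x :* x) :* (y :* y) := (d :- i) :* ((x :* y) :* (x :* y))) refl _ _ _ _ _ ⟩
        (ι d - ι i) * sq (X * Y)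
          ≡⟨ cong (λ u → (ι d - ι i) * sq u) (bin-trinomial a d i) ⟩
        (ι d - ι i) * sq (bin (a ℕ.+ d) a * bin d i)
          ≡⟨ solve 3 (λ z u w → z :* ((u :* w) :* (u :* w)) := (u :* u) :* (z :* (w :* w))) refl _ _ _ ⟩
        sq (bin (a ℕ.+ d) a) * ((ι d - ι i) * sq (bin d i)) ∎
        where
        X = bin (a ℕ.+ d) (a ℕ.+ i)
        Y = bin (a ℕ.+ i) a

  s : ℕ → ℕ → K
  s n k = sq (bin n k) * cb k * (ι 2 * ι k + 1#)

  S′ : ℕ → K
  S′ n = ∑ (suc n) (s n)

  private
    -- By absorption T(n) is n² Σ_k C(n-1,k)² C_k, the value to be proved, written without division
    -- so that its increments can be computed.
    T : ℕ → K
    T n = ∑ n (λ k → ι (suc k) * sq (bin n (suc k)) * cb k)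

    T-step : ∀ n → T (suc n) ≡ T n + S′ n
    T-step n = begin
      T (suc n)
        ≡⟨ ∑-cong (suc n) term ⟩
      ∑ (suc n) (λ k → f k + s n k + (ι 2 * ((ι n - ι k) * g k) - ι k * g k))
        ≡⟨ ∑-+ (suc n) _ _ ⟩
      ∑ (suc n) (λ k → f k + s n k) + ∑ (suc n) (λ k → ι 2 * ((ι n - ι k) * g k) - ι k * g k)
        ≡⟨ cong₂ _+_ (∑-+ (suc n) _ _) (trans (∑-- (suc n) _ _) (cong (_- ∑ (suc n) (λ k → ι k * g k)) (∑-*ˡ (suc n) _ _))) ⟩
      ∑ (suc n) f + S′ n + (ι 2 * ∑ (suc n) (λ k → (ι n - ι k) * g k) - ∑ (suc n) (λ k → ι k * g k))
        ≡⟨ cong₂ (λ x y → x + S′ n + (y - ∑ (suc n) (λ k → ι k * g k)))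
             (∑-extend n (suc n) (ℕ.n≤1+n n) (λ k n≤k → trans (cong (λ b → ι (suc k) * sq b * cb k) (bin-large n (suc k) (s≤s n≤k)))
               (solve 2 (λ x y → x :* (:ι 0 :* :ι 0) :* y := :ι 0) refl _ _)))
             (∑-multinomial-symmetry n) ⟩
      T n + S′ n + (∑ (suc n) (λ k → ι k * g k) - ∑ (suc n) (λ k → ι k * g k))
        ≡⟨ solve 2 (λ x y → x :+ (y :- y) := x) refl _ _ ⟩
      T n + S′ n ∎
      where
      f g : ℕ → K
      f k = ι (suc k) * sq (bin n (suc k)) * cb k
      g k = sq (bin n k) * cb k
      term : ∀ k → ι (suc k) * sq (bin (suc n) (suc k)) * cb k ≡ f k + s n k + (ι 2 * ((ι n - ι k) * g k) - ι k * g k)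
      term k = begin
        ι (suc k) * sq (bin (suc n) (suc k)) * cb k
          ≡⟨ cong (λ x → ι (suc k) * sq x * cb k) (bin-pascal n k) ⟩
        ι (suc k) * sq (b + b′) * cb k
          ≡⟨ solve 4 (λ i b b′ c → i :* ((b :+ b′) :* (b :+ b′)) :* c := i :* (b′ :* b′) :* c :+ (i :* b :+ :ι 2 :* (i :* b′)) :* (b :* c)) refl _ _ _ _ ⟩
        f k + (ι (suc k) * b + ι 2 * (ι (suc k) * b′)) * (b * cb k)
          -- The mixed product loses its C(n,k+1), so that apart from the term of T(n) only C(n,k)²
          -- C(2k,k) times a linear polynomial remains.
          ≡⟨ cong₂ (λ x y → f k + (x * b + ι 2 * y) * (b * cb k)) (ι-suc k) (bin-step n k) ⟩
        f k + ((1# + ι k) * b + ι 2 * ((ι n - ι k) * b)) * (b * cb k)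
          ≡⟨ solve 5 (λ f k n b c → f :+ ((:ι 1 :+ k) :* b :+ :ι 2 :* ((n :- k) :* b)) :* (b :* c)
                := f :+ b :* b :* c :* (:ι 2 :* k :+ :ι 1) :+ (:ι 2 :* ((n :- k) :* (b :* b :* c)) :- k :* (b :* b :* c))) refl _ _ _ _ _ ⟩
        f k + s n k + (ι 2 * ((ι n - ι k) * g k) - ι k * g k) ∎
        where
        b  = bin n k
        b′ = bin n (suc k)

  ∑S : ∀ m → ∑ (suc m) S′ ≡ ι (suc m) * ι (suc m) * ∑ (suc m) (λ k → sq (bin m k) * (⅟suc k * cb k))
  ∑S m = begin
    ∑ (suc m) S′
      ≡⟨ partial (suc m) ⟩
    T (suc m)
      ≡⟨ ∑-cong (suc m) term ⟩
    ∑ (suc m) (λ k → ι (suc m) * ι (suc m) * (sq (bin m k) * (⅟suc k * cb k)))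
      ≡⟨ ∑-*ˡ (suc m) _ _ ⟩
    ι (suc m) * ι (suc m) * ∑ (suc m) (λ k → sq (bin m k) * (⅟suc k * cb k)) ∎
    where
    partial : ∀ n → ∑ n S′ ≡ T n
    partial zero    = refl
    partial (suc n) = trans (cong (_+ S′ n) (partial n)) (sym (T-step n))
    term : ∀ k → ι (suc k) * sq (bin (suc m) (suc k)) * cb k ≡ ι (suc m) * ι (suc m) * (sq (bin m k) * (⅟suc k * cb k))
    term k = begin
      ι (suc k) * sq B * cb k
        ≡⟨ solve 3 (λ i b c → i :* (b :* b) :* c := :ι 1 :* (i :* (b :* b) :* c)) refl _ _ _ ⟩
      1# * (ι (suc k) * sq B * cb k)
        ≡⟨ cong (_* (ι (suc k) * sq B * cb k)) (⅟suc-inverse k) ⟨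
      ι (suc k) * ⅟suc k * (ι (suc k) * sq B * cb k)
        ≡⟨ solve 4 (λ i v b c → i :* v :* (i :* (b :* b) :* c) := (i :* b) :* (i :* b) :* (v :* c)) refl _ _ _ _ ⟩
      sq (ι (suc k) * B) * (⅟suc k * cb k)
        ≡⟨ cong (λ x → sq x * (⅟suc k * cb k)) (bin-absorb m k) ⟩
      sq (ι (suc m) * bin m k) * (⅟suc k * cb k)
        ≡⟨ solve 3 (λ i b c → (i :* b) :* (i :* b) :* c := i :* i :* (b :* b :* c)) refl _ _ _ ⟩
      ι (suc m) * ι (suc m) * (sq (bin m k) * (⅟suc k * cb k)) ∎
      where B = bin (suc m) (suc k)

  -- C(2k,k+1) is k/(k+1) times C(2k,k). The difference form shows that Catalan numbers are
  -- integers.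
  catalan-integral : ∀ k → ⅟suc k * cb k ≡ cb k - bin (k ℕ.+ k) (suc k)
  catalan-integral k = ι-cancel k (begin
    ι (suc k) * (⅟suc k * cb k)     ≡⟨ *-assoc _ _ _ ⟨
    ι (suc k) * ⅟suc k * cb k       ≡⟨ cong (_* cb k) (⅟suc-inverse k) ⟩
    1# * cb k                       ≡⟨ solve 2 (λ x c → :ι 1 :* c := (:ι 1 :+ x) :* c :- (x :+ x :- x) :* c) refl (ι k) _ ⟩
    (1# + ι k) * cb k - (ι k + ι k - ι k) * cb k
      ≡⟨ cong₂ (λ x y → x * cb k - (y - ι k) * cb k) (ι-suc k) (ι-+ k k) ⟨
    ι (suc k) * cb k - (ι (k ℕ.+ k) - ι k) * cb k
      ≡⟨ cong (λ x → ι (suc k) * cb k - x) (bin-step (k ℕ.+ k) k) ⟨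
    ι (suc k) * cb k - ι (suc k) * bin (k ℕ.+ k) (suc k)
      ≡⟨ solve 3 (λ i c d → i :* c :- i :* d := i :* (c :- d)) refl _ _ _ ⟩
    ι (suc k) * (cb k - bin (k ℕ.+ k) (suc k)) ∎)

  -- The sums of S_k/k and S_k/k²

  -- Absorption moves a denominator from the outer index to the inner one, where it can be taken out
  -- of the sum over the outer index.
  ⅟suc*bin : ∀ n k → ⅟suc n * bin (suc n) (suc k) ≡ ⅟suc k * bin n k
  ⅟suc*bin n k = ι-cancel n (ι-cancel k (begin
    ι (suc k) * (ι (suc n) * (⅟suc n * bin (suc n) (suc k)))
      ≡⟨ solve 4 (λ x y v b → x :* (y :* (v :* b)) := (y :* v) :* (x :* b)) refl _ _ _ _ ⟩
    (ι (suc n) * ⅟suc n) * (ι (suc k) * bin (suc n) (suc k))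
      ≡⟨ cong₂ _*_ (trans (⅟suc-inverse n) (sym (⅟suc-inverse k))) (bin-absorb n k) ⟩
    (ι (suc k) * ⅟suc k) * (ι (suc n) * bin n k)
      ≡⟨ solve 4 (λ x y v b → (x :* v) :* (y :* b) := x :* (y :* (v :* b))) refl _ _ _ _ ⟩
    ι (suc k) * (ι (suc n) * (⅟suc k * bin n k)) ∎))

  -- With x = C(i+1,j+1) and y = C(i,j), Pascal gives x - y = C(i,j+1), and 2xy = x² - (x - y)² +
  -- y²; the difference of squares telescopes in i.
  bin-sq-difference : ∀ n j → ι 2 * ∑ n (λ i → bin (suc i) (suc j) * bin i j) ≡ sq (bin n (suc j)) + ∑ n (λ i → sq (bin i j))
  bin-sq-difference n j = begin
    ι 2 * ∑ n (λ i → bin (suc i) (suc j) * bin i j)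
      ≡⟨ ∑-*ˡ n _ _ ⟨
    ∑ n (λ i → ι 2 * (bin (suc i) (suc j) * bin i j))
      ≡⟨ ∑-cong n (λ i → trans (cong (λ x → ι 2 * (x * bin i j)) (bin-pascal i j))
           (trans (solve 2 (λ b c → :ι 2 :* ((b :+ c) :* b) := (b :+ c) :* (b :+ c) :- c :* c :+ b :* b) refl _ _)
             (cong (λ x → sq x - sq (bin i (suc j)) + sq (bin i j)) (sym (bin-pascal i j))))) ⟩
    ∑ n (λ i → sq (bin (suc i) (suc j)) - sq (bin i (suc j)) + sq (bin i j))
      ≡⟨ ∑-+ n _ _ ⟩
    ∑ n (λ i → sq (bin (suc i) (suc j)) - sq (bin i (suc j))) + ∑ n (λ i → sq (bin i j))
      ≡⟨ cong (_+ ∑ n (λ i → sq (bin i j))) (∑-telescope n (λ i → sq (bin i (suc j)))) ⟩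
    sq (bin n (suc j)) - sq (bin 0 (suc j)) + ∑ n (λ i → sq (bin i j))
      ≡⟨ cong (λ x → sq (bin n (suc j)) - sq x + ∑ n (λ i → sq (bin i j))) (bin-large 0 (suc j) (s≤s z≤n)) ⟩
    sq (bin n (suc j)) - sq 0# + ∑ n (λ i → sq (bin i j))
      ≡⟨ solve 2 (λ x y → x :- :ι 0 :* :ι 0 :+ y := x :+ y) refl _ _ ⟩
    sq (bin n (suc j)) + ∑ n (λ i → sq (bin i j)) ∎

  cb-suc : ∀ j → cb (suc j) ≡ ι 2 * ⅟suc j * ((ι 2 * ι j + 1#) * cb j)
  cb-suc j = begin
    cb (suc j)
      ≡⟨ trans (cong (λ k → bin (suc k) (suc j)) (ℕ.+-suc j j)) (bin-pascal (suc (j ℕ.+ j)) j) ⟩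
    bin (suc (j ℕ.+ j)) j + bin (suc (j ℕ.+ j)) (suc j)
      ≡⟨ cong (_+ bin (suc (j ℕ.+ j)) (suc j)) (trans (cong (λ k → bin k j) (sym (ℕ.+-suc j j)))
           (trans (bin-sym-+ j (suc j)) (cong (λ k → bin k (suc j)) (ℕ.+-suc j j)))) ⟩
    B + B
      ≡⟨ solve 1 (λ b → b :+ b := :ι 2 :* (:ι 1 :* b)) refl _ ⟩
    ι 2 * (1# * B)
      ≡⟨ cong (λ x → ι 2 * (x * B)) (⅟suc-inverse j) ⟨
    ι 2 * (ι (suc j) * ⅟suc j * B)
      ≡⟨ solve 4 (λ t i v b → t :* (i :* v :* b) := t :* v :* (i :* b)) refl _ _ _ _ ⟩
    ι 2 * ⅟suc j * (ι (suc j) * B)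
      ≡⟨ cong (ι 2 * ⅟suc j *_) (trans (bin-absorb (j ℕ.+ j) j) (cong (_* cb j) (ι-odd j))) ⟩
    ι 2 * ⅟suc j * ((ι 2 * ι j + 1#) * cb j) ∎
    where B = bin (suc (j ℕ.+ j)) (suc j)

  module _ (N : ℕ) where
    private
      P : K
      P = ι (suc N)
      -- The term k = 0 is split off below, so `j` stands for k = j + 1: `o`, `b`, `v` are 2k + 1,
      -- C(2k,k) and 1/k, whereas `c` and `q` are taken at j itself.
      o b v c q : ℕ → K
      o j = ι 2 * ι (suc j) + 1#
      b j = cb (suc j)
      v = ⅟suc
      c j = bin N j
      q j = Q N j
      -- What is left of Σ_i C(i+1,j+1)²/(i+1), respectively with (i+1)², once 1/(j+1) or its square
      -- has been taken out.
      E D : ℕ → K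
      E j = ∑ N (λ i → bin (suc i) (suc j) * bin i j)
      D j = ∑ N (λ i → sq (bin i j))

    ∑1/i ∑1/i² ∑S/i ∑S/i² : K
    ∑1/i  = ∑ N (λ i → ⅟suc i)
    ∑1/i² = ∑ N (λ i → ⅟suc i * ⅟suc i)
    ∑S/i  = ∑ N (λ i → S′ (suc i) * ⅟suc i)
    ∑S/i² = ∑ N (λ i → S′ (suc i) * (⅟suc i * ⅟suc i))

    private
      s-zero : ∀ n → s n 0 ≡ 1#
      s-zero n = trans (cong₂ (λ x y → sq x * y * (ι 2 * 0# + 1#)) (bin-zero n) (bin-zero 0))
        (solve 0 (:ι 1 :* :ι 1 :* :ι 1 :* (:ι 2 :* :ι 0 :+ :ι 1) := :ι 1) refl)

      -- The term k = 0 of each S_{i+1} equals 1 and yields `∑ N w`. The inner sums are first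
      -- extended by zeros to the common length N + 1.
      interchange : ∀ (w : ℕ → K) (g : ℕ → ℕ → K) → (∀ i j → s (suc i) (suc j) * w i ≡ o j * b j * g i j) →
        ∑ N (λ i → S′ (suc i) * w i) ≡ ∑ N w + ∑ N (λ j → o j * b j * ∑ N (λ i → g i j))
      interchange w g eq = begin
        ∑ N (λ i → S′ (suc i) * w i)
          ≡⟨ ∑-cong< N (λ i i<N → trans (*-comm _ _) (trans (cong (w i *_) (sym (∑-extend (suc (suc i)) (suc N) (s≤s i<N)
               (λ j i<j → trans (cong (λ x → sq x * cb j * (ι 2 * ι j + 1#)) (bin-large (suc i) j i<j))
                 (solve 2 (λ x y → :ι 0 :* :ι 0 :* x :* y := :ι 0) refl _ _))))) (sym (∑-*ˡ (suc N) _ _)))) ⟩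
        ∑ N (λ i → ∑ (suc N) (λ j → w i * s (suc i) j))
          ≡⟨ ∑-swap N (suc N) _ ⟩
        ∑ (suc N) (λ j → ∑ N (λ i → w i * s (suc i) j))
          ≡⟨ ∑-head N _ ⟩
        ∑ N (λ i → w i * s (suc i) 0) + ∑ N (λ j → ∑ N (λ i → w i * s (suc i) (suc j)))
          ≡⟨ cong₂ _+_ (∑-cong N (λ i → trans (cong (w i *_) (s-zero (suc i))) (*-identityʳ _)))
               (∑-cong N (λ j → trans (∑-cong N (λ i → trans (*-comm _ _) (eq i j))) (∑-*ˡ N _ _))) ⟩
        ∑ N w + ∑ N (λ j → o j * b j * ∑ N (λ i → g i j)) ∎

      ∑S/i-expand : ∑S/i ≡ ∑1/i + ∑ N (λ j → o j * b j * (v j * E j))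
      ∑S/i-expand = trans (interchange ⅟suc (λ i j → v j * (bin (suc i) (suc j) * bin i j)) (λ i j → begin
        sq (bin (suc i) (suc j)) * b j * o j * ⅟suc i
          ≡⟨ solve 4 (λ x b o w → x :* x :* b :* o :* w := o :* b :* (w :* x :* x)) refl _ _ _ _ ⟩
        o j * b j * (⅟suc i * bin (suc i) (suc j) * bin (suc i) (suc j))
          ≡⟨ cong (λ x → o j * b j * (x * bin (suc i) (suc j))) (⅟suc*bin i j) ⟩
        o j * b j * (v j * bin i j * bin (suc i) (suc j))
          ≡⟨ solve 4 (λ ob v y x → ob :* (v :* y :* x) := ob :* (v :* (x :* y))) refl _ _ _ _ ⟩
        o j * b j * (v j * (bin (suc i) (suc j) * bin i j)) ∎))
        (cong (∑1/i +_) (∑-cong N (λ j → cong (o j * b j *_) (∑-*ˡ N _ _))))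

      ∑S/i²-expand : ∑S/i² ≡ ∑1/i² + ∑ N (λ j → o j * b j * (v j * v j * D j))
      ∑S/i²-expand = trans (interchange (λ i → ⅟suc i * ⅟suc i) (λ i j → v j * v j * sq (bin i j)) (λ i j → begin
        sq (bin (suc i) (suc j)) * b j * o j * (⅟suc i * ⅟suc i)
          ≡⟨ solve 4 (λ x b o w → x :* x :* b :* o :* (w :* w) := o :* b :* ((w :* x) :* (w :* x))) refl _ _ _ _ ⟩
        o j * b j * sq (⅟suc i * bin (suc i) (suc j))
          ≡⟨ cong (λ x → o j * b j * sq x) (⅟suc*bin i j) ⟩
        o j * b j * sq (v j * bin i j)
          ≡⟨ solve 3 (λ ob v y → ob :* ((v :* y) :* (v :* y)) := ob :* (v :* v :* (y :* y))) refl _ _ _ ⟩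
        o j * b j * (v j * v j * sq (bin i j)) ∎))
        (cong (∑1/i² +_) (∑-cong N (λ j → cong (o j * b j *_) (∑-*ˡ N _ _))))

      -- `D j` stops one term short: adding C(N,j)² completes the sum over k < N + 1, to which the
      -- divisibility by P = N + 1 from (i) applies.
      divisible : ∀ j → b j * (D j + sq (c j)) ≡ ι 2 * v j * (P * q j)
      divisible j = begin
        b j * (D j + sq (c j))
          ≡⟨ cong (_* (D j + sq (c j))) (cb-suc j) ⟩
        ι 2 * v j * ((ι 2 * ι j + 1#) * cb j) * (D j + sq (c j))
          ≡⟨ *-assoc _ _ _ ⟩
        ι 2 * v j * ((ι 2 * ι j + 1#) * cb j * (D j + sq (c j)))
          ≡⟨ cong (ι 2 * v j *_) (∑-bin-square-divisible N j) ⟩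
        ι 2 * v j * (P * q j) ∎

      -- The congruence C(P-1,j+1) ≡ -C(P-1,j) modulo P, with the multiple of P kept exactly.
      c-suc : ∀ j → bin N (suc j) ≡ v j * (P * c j) - c j
      c-suc j = begin
        bin N (suc j)
          ≡⟨ solve 2 (λ x y → y := :ι 1 :* (x :+ y) :- x) refl (c j) _ ⟩
        1# * (c j + bin N (suc j)) - c j
          ≡⟨ cong₂ (λ x y → x * y - c j) (⅟suc-inverse j) (bin-pascal N j) ⟨
        ι (suc j) * v j * bin (suc N) (suc j) - c j
          ≡⟨ solve 4 (λ i v b c → i :* v :* b :- c := v :* (i :* b) :- c) refl _ _ _ _ ⟩
        v j * (ι (suc j) * bin (suc N) (suc j)) - c j
          ≡⟨ cong (λ x → v j * x - c j) (bin-absorb N j) ⟩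
        v j * (P * c j) - c j ∎

      ½ : K
      ½ = ⅟suc 1

      X Y Z : ℕ → K
      X j = o j * (v j * v j) * q j
      Y j = o j * b j * (v j * v j) * sq (c j)
      Z j = ι 2 * o j * (v j * v j * v j) * q j

      -- Squaring `c-suc` produces exactly the C(N,j)² that completes `D j`, so every term acquires
      -- a factor P.
      E-eq : ∀ j → b j * E j ≡ v j * P * q j + b j * (½ * (P * v j) * (P * v j) - P * v j) * sq (c j)
      E-eq j = ι-cancel 1 (begin
        ι 2 * (b j * E j)
          ≡⟨ solve 3 (λ t b e → t :* (b :* e) := b :* (t :* e)) refl _ _ _ ⟩
        b j * (ι 2 * E j)
          ≡⟨ cong (b j *_) (bin-sq-difference N j) ⟩
        b j * (sq (bin N (suc j)) + D j)
          ≡⟨ cong (λ x → b j * (sq x + D j)) (c-suc j) ⟩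
        b j * (sq (v j * (P * c j) - c j) + D j)
          ≡⟨ solve 5 (λ b v P c D → b :* ((v :* (P :* c) :- c) :* (v :* (P :* c) :- c) :+ D)
               := b :* (D :+ c :* c) :+ b :* (:ι 1 :* (P :* v) :* (P :* v) :- :ι 2 :* (P :* v)) :* (c :* c)) refl _ _ _ _ _ ⟩
        b j * (D j + sq (c j)) + b j * (1# * (P * v j) * (P * v j) - ι 2 * (P * v j)) * sq (c j)
          ≡⟨ cong₂ (λ x y → x + b j * (y * (P * v j) * (P * v j) - ι 2 * (P * v j)) * sq (c j)) (divisible j) (sym (⅟suc-inverse 1)) ⟩
        ι 2 * v j * (P * q j) + b j * (ι 2 * ½ * (P * v j) * (P * v j) - ι 2 * (P * v j)) * sq (c j)
          ≡⟨ solve 7 (λ t h b v P c q → t :* v :* (P :* q) :+ b :* (t :* h :* (P :* v) :* (P :* v) :- t :* (P :* v)) :* c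
               := t :* (v :* P :* q :+ b :* (h :* (P :* v) :* (P :* v) :- P :* v) :* c)) refl (ι 2) _ _ _ _ _ _ ⟩
        ι 2 * (v j * P * q j + b j * (½ * (P * v j) * (P * v j) - P * v j) * sq (c j)) ∎)

    ∑S/i²-decomposition : ∑S/i² ≡ ∑1/i² - ∑ N (λ j → (ι 2 * ι (suc j) + 1#) * cb (suc j) * (⅟suc j * ⅟suc j) * sq (bin N j))
      + ι (suc N) * ∑ N (λ j → ι 2 * (ι 2 * ι (suc j) + 1#) * (⅟suc j * ⅟suc j * ⅟suc j) * Q N j)
    ∑S/i²-decomposition = begin
      ∑S/i²
        ≡⟨ ∑S/i²-expand ⟩
      ∑1/i² + ∑ N (λ j → o j * b j * (v j * v j * D j))
        ≡⟨ cong (∑1/i² +_) (∑-cong N term) ⟩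
      ∑1/i² + ∑ N (λ j → P * Z j - Y j)
        ≡⟨ cong (∑1/i² +_) (trans (∑-- N _ _) (cong (_- ∑ N Y) (∑-*ˡ N _ _))) ⟩
      ∑1/i² + (P * ∑ N Z - ∑ N Y)
        ≡⟨ solve 3 (λ x y z → x :+ (z :- y) := x :- y :+ z) refl _ _ _ ⟩
      ∑1/i² - ∑ N Y + P * ∑ N Z ∎
      where
      term : ∀ j → o j * b j * (v j * v j * D j) ≡ P * Z j - Y j
      term j = begin
        o j * b j * (v j * v j * D j)
          ≡⟨ solve 5 (λ o b v D c → o :* b :* (v :* v :* D) := o :* v :* v :* (b :* (D :+ c :* c)) :- o :* b :* (v :* v) :* (c :* c)) refl _ _ _ _ (c j) ⟩
        o j * v j * v j * (b j * (D j + sq (c j))) - Y j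
          ≡⟨ cong (λ x → o j * v j * v j * x - Y j) (divisible j) ⟩
        o j * v j * v j * (ι 2 * v j * (P * q j)) - Y j
          ≡⟨ solve 6 (λ o v t P q y → o :* v :* v :* (t :* v :* (P :* q)) :- y := P :* (t :* o :* (v :* v :* v) :* q) :- y) refl _ _ _ _ _ _ ⟩
        P * Z j - Y j ∎

    -- The sum with C(N,j)² occurs to first order in P both here and in P times `∑S/i²`, with the
    -- same coefficient. Subtraction therefore leaves, up to order P², only harmonic sums and the
    -- sum with `Q N j`.
    ∑S/i-decomposition : ∑S/i ≡ ι (suc N) * ∑S/i² + (∑1/i - ι (suc N) * ∑1/i²)
      + ι (suc N) * ∑ N (λ j → (ι 2 * ι (suc j) + 1#) * (⅟suc j * ⅟suc j) * Q N j)
      + ι (suc N) * ι (suc N) * ∑ N (λ j → ⅟suc 1 * ((ι 2 * ι (suc j) + 1#) * cb (suc j) * (⅟suc j * ⅟suc j) * sq (bin N j)) * ⅟suc j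
                                         - ι 2 * (ι 2 * ι (suc j) + 1#) * (⅟suc j * ⅟suc j * ⅟suc j) * Q N j)
    ∑S/i-decomposition = begin
      ∑S/i
        ≡⟨ ∑S/i-expand ⟩
      ∑1/i + ∑ N (λ j → o j * b j * (v j * E j))
        ≡⟨ cong (∑1/i +_) (∑-cong N term) ⟩
      ∑1/i + ∑ N (λ j → P * X j - P * Y j + P * P * (½ * Y j * v j))
        ≡⟨ cong (∑1/i +_) (trans (∑-+ N _ _) (cong₂ _+_ (trans (∑-- N _ _) (cong₂ _-_ (∑-*ˡ N _ _) (∑-*ˡ N _ _))) (∑-*ˡ N _ _))) ⟩
      ∑1/i + (P * ∑ N X - P * ∑ N Y + P * P * ∑ N (λ j → ½ * Y j * v j))
        ≡⟨ solve 7 (λ P h h2 x y w z → h :+ (P :* x :- P :* y :+ P :* P :* w)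
             := P :* (h2 :- y :+ P :* z) :+ (h :- P :* h2) :+ P :* x :+ P :* P :* (w :- z)) refl P ∑1/i ∑1/i² (∑ N X) (∑ N Y) _ (∑ N Z) ⟩
      P * (∑1/i² - ∑ N Y + P * ∑ N Z) + (∑1/i - P * ∑1/i²) + P * ∑ N X + P * P * (∑ N (λ j → ½ * Y j * v j) - ∑ N Z)
        ≡⟨ cong₂ (λ x y → P * x + (∑1/i - P * ∑1/i²) + P * ∑ N X + P * P * y) ∑S/i²-decomposition (∑-- N _ _) ⟨
      P * ∑S/i² + (∑1/i - P * ∑1/i²) + P * ∑ N X + P * P * ∑ N (λ j → ½ * Y j * v j - Z j) ∎
      where
      term : ∀ j → o j * b j * (v j * E j) ≡ P * X j - P * Y j + P * P * (½ * Y j * v j)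
      term j = begin
        o j * b j * (v j * E j)
          ≡⟨ solve 4 (λ o b v e → o :* b :* (v :* e) := o :* v :* (b :* e)) refl _ _ _ _ ⟩
        o j * v j * (b j * E j)
          ≡⟨ cong (o j * v j *_) (E-eq j) ⟩
        o j * v j * (v j * P * q j + b j * (½ * (P * v j) * (P * v j) - P * v j) * sq (c j))
          ≡⟨ solve 7 (λ o v P q b h c → o :* v :* (v :* P :* q :+ b :* (h :* (P :* v) :* (P :* v) :- P :* v) :* (c :* c))
               := P :* (o :* (v :* v) :* q) :- P :* (o :* b :* (v :* v) :* (c :* c)) :+ P :* P :* (h :* (o :* b :* (v :* v) :* (c :* c)) :* v)) refl _ _ _ _ _ _ _ ⟩
        P * X j - P * Y j + P * P * (½ * Y j * v j) ∎

  -- Sums attached to the sixth roots of unity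

  sgn : ℕ → K
  sgn zero    = 1#
  sgn (suc k) = - sgn k

  -- The Euler operator on coefficient sequences. It lowers the exponent of a weight 1/j^s, so it
  -- links the sums with weights 1, 1/j and 1/j².
  θ : (ℕ → K) → ℕ → K
  θ w j = ι j * w j

  δ₀ : ℕ → K
  δ₀ zero    = 1#
  δ₀ (suc _) = 0#

  -- The value 0 at 0 removes the term j = 0 from all sums. In exchange `θ recip` misses the
  -- constant 1 at 0, which `δ₀` restores.
  recip : ℕ → K
  recip zero    = 0#
  recip (suc j) = ⅟suc j

  recip² : ℕ → K
  recip² j = recip j * recip j

  θ-suc : ∀ (w : ℕ → K) j → θ w (suc j) ≡ θ (w ∘ suc) j + w (suc j)
  θ-suc w j = trans (cong (_* w (suc j)) (ι-suc j)) (solve 2 (λ x y → (:ι 1 :+ x) :* y := x :* y :+ y) refl _ _)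

  θ-recip : ∀ j → θ recip j + δ₀ j ≡ 1#
  θ-recip zero    = solve 0 (:ι 0 :* :ι 0 :+ :ι 1 := :ι 1) refl
  θ-recip (suc j) = trans (+-identityʳ _) (⅟suc-inverse j)

  θ-*recip² : ∀ (w : ℕ → K) j → θ (λ k → w k * recip² k) j ≡ w j * recip j
  θ-*recip² w zero    = solve 1 (λ x → :ι 0 :* (x :* (:ι 0 :* :ι 0)) := x :* :ι 0) refl _
  θ-*recip² w (suc j) = begin
    ι (suc j) * (w (suc j) * (⅟suc j * ⅟suc j))  ≡⟨ solve 3 (λ i w v → i :* (w :* (v :* v)) := (i :* v) :* (w :* v)) refl _ _ _ ⟩
    (ι (suc j) * ⅟suc j) * (w (suc j) * ⅟suc j)  ≡⟨ cong (_* (w (suc j) * ⅟suc j)) (⅟suc-inverse j) ⟩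
    1# * (w (suc j) * ⅟suc j)                    ≡⟨ *-identityˡ _ ⟩
    w (suc j) * ⅟suc j                           ∎

  solve-step : ∀ n {x y z} → ι (suc n) * (x - y) ≡ z → x ≡ y + ⅟suc n * z
  solve-step n {x} {y} {z} eq = begin
    x                                      ≡⟨ solve 2 (λ x y → x := y :+ :ι 1 :* (x :- y)) refl _ _ ⟩
    y + 1# * (x - y)                       ≡⟨ cong (λ u → y + u * (x - y)) (⅟suc-inverse n) ⟨
    y + ι (suc n) * ⅟suc n * (x - y)       ≡⟨ solve 4 (λ y i v d → y :+ i :* v :* d := y :+ v :* (i :* d)) refl _ _ _ _ ⟩
    y + ⅟suc n * (ι (suc n) * (x - y))     ≡⟨ cong (λ u → y + ⅟suc n * u) eq ⟩
    y + ⅟suc n * z                         ∎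

  -- fib n w is Σ_j (−1)^j C(n−j,j) w_j.
  fib : ℕ → (ℕ → K) → K
  fib zero          w = w 0
  fib (suc zero)    w = w 0
  fib (suc (suc n)) w = fib (suc n) w - fib n (w ∘ suc)

  fib-cong : ∀ n {w w′ : ℕ → K} → (∀ j → w j ≡ w′ j) → fib n w ≡ fib n w′
  fib-cong zero          eq = eq 0
  fib-cong (suc zero)    eq = eq 0
  fib-cong (suc (suc n)) eq = cong₂ _-_ (fib-cong (suc n) eq) (fib-cong n (λ j → eq (suc j)))

  fib-+ : ∀ n w w′ → fib n (λ j → w j + w′ j) ≡ fib n w + fib n w′
  fib-+ zero          w w′ = refl
  fib-+ (suc zero)    w w′ = refl
  fib-+ (suc (suc n)) w w′ = trans (cong₂ _-_ (fib-+ (suc n) w w′) (fib-+ n (w ∘ suc) (w′ ∘ suc)))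
    (solve 4 (λ a b c d → a :+ b :- (c :+ d) := a :- c :+ (b :- d)) refl _ _ _ _)

  fib-zero : ∀ n → fib n (λ _ → 0#) ≡ 0#
  fib-zero zero          = refl
  fib-zero (suc zero)    = refl
  fib-zero (suc (suc n)) = trans (cong₂ _-_ (fib-zero (suc n)) (fib-zero n)) (-‿inverseʳ 0#)

  fib-δ₀ : ∀ n → fib n δ₀ ≡ 1#
  fib-δ₀ zero          = refl
  fib-δ₀ (suc zero)    = refl
  fib-δ₀ (suc (suc n)) = trans (cong₂ _-_ (fib-δ₀ (suc n)) (fib-zero n))
    (solve 0 (:ι 1 :- :ι 0 := :ι 1) refl)

  fib-θ-suc : ∀ n w → fib n (θ w ∘ suc) ≡ fib n (θ (w ∘ suc)) + fib n (w ∘ suc)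
  fib-θ-suc n w = trans (fib-cong n (θ-suc w)) (fib-+ n _ _)

  -- The recursion of `fib` is Pascal's rule C(n+2-j,j) = C(n+1-j,j) + C(n+1-j,j-1).
  fib-explicit : ∀ n w → fib n w ≡ ∑ (suc n) (λ j → bin (n ∸ j) j * (sgn j * w j))
  fib-explicit zero          w = trans (solve 1 (λ x → x := :ι 0 :+ :ι 1 :* (:ι 1 :* x)) refl _)
    (cong (λ b → 0# + b * (1# * w 0)) (sym (bin-zero 0)))
  fib-explicit (suc zero)    w = begin
    w 0                                         ≡⟨ solve 2 (λ x y → x := :ι 0 :+ :ι 1 :* (:ι 1 :* x) :+ :ι 0 :* y) refl _ (- 1# * w 1) ⟩
    0# + 1# * (1# * w 0) + 0# * (- 1# * w 1)    ≡⟨ cong₂ (λ a b → 0# + a * (1# * w 0) + b * (- 1# * w 1)) (bin-zero 1) (bin-large 0 1 (s≤s z≤n)) ⟨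
    0# + bin 1 0 * (1# * w 0) + bin 0 1 * (- 1# * w 1) ∎
  fib-explicit (suc (suc n)) w = begin
    fib (suc n) w - fib n (w ∘ suc)
      ≡⟨ cong₂ _-_ (fib-explicit (suc n) w) (fib-explicit n (w ∘ suc)) ⟩
    ∑ (suc (suc n)) f - ∑ (suc n) (λ j → bin (n ∸ j) j * (sgn j * w (suc j)))
      ≡⟨ cong (_- ∑ (suc n) g) (∑-head (suc n) f) ⟩
    f 0 + ∑ (suc n) (λ j → f (suc j)) - ∑ (suc n) g
      ≡⟨ solve 3 (λ x y z → x :+ y :- z := x :+ (y :- z)) refl _ _ _ ⟩
    f 0 + (∑ (suc n) (λ j → f (suc j)) - ∑ (suc n) g)
      ≡⟨ cong₂ _+_ (cong (_* (1# * w 0)) (trans (bin-zero (suc n)) (sym (bin-zero (suc (suc n)))))) (sym (∑-- (suc n) _ _)) ⟩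
    h 0 + ∑ (suc n) (λ j → f (suc j) - g j)
      ≡⟨ cong (h 0 +_) (trans (∑-cong< (suc n) (λ { j (s≤s j≤n) → term j j≤n })) (sym last-zero)) ⟩
    h 0 + ∑ (suc (suc n)) (λ j → h (suc j))
      ≡⟨ ∑-head (suc (suc n)) h ⟨
    ∑ (suc (suc (suc n))) h ∎
    where
    f g h : ℕ → K
    f j = bin (suc n ∸ j) j * (sgn j * w j)
    g j = bin (n ∸ j) j * (sgn j * w (suc j))
    h j = bin (suc (suc n) ∸ j) j * (sgn j * w j)
    term : ∀ j → j ≤ n → f (suc j) - g j ≡ h (suc j)
    term j j≤n = begin
      bin (n ∸ j) (suc j) * (- sgn j * w (suc j)) - bin (n ∸ j) j * (sgn j * w (suc j))
        ≡⟨ solve 4 (λ a b s w → a :* (:- s :* w) :- b :* (s :* w) := (b :+ a) :* (:- s :* w)) refl _ _ _ _ ⟩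
      (bin (n ∸ j) j + bin (n ∸ j) (suc j)) * (- sgn j * w (suc j))
        ≡⟨ cong (_* (- sgn j * w (suc j))) (trans (sym (bin-pascal (n ∸ j) j)) (cong (λ k → bin k (suc j)) (sym (ℕ.+-∸-assoc 1 j≤n)))) ⟩
      bin (suc n ∸ j) (suc j) * (- sgn j * w (suc j)) ∎
    last-zero : ∑ (suc (suc n)) (λ j → h (suc j)) ≡ ∑ (suc n) (λ j → h (suc j))
    last-zero = trans (cong (∑ (suc n) (λ j → h (suc j)) +_) (trans (cong (_* (sgn (suc (suc n)) * w (suc (suc n))))
      (bin-large (n ∸ n) (suc (suc n)) (s≤s (ℕ.≤-trans (ℕ.m∸n≤m n n) (ℕ.n≤1+n n))))) (zeroˡ _))) (+-identityʳ _)

  -- Termwise this is (j+1) C(n-j,j+1) = (n-2j) C(n-j,j); the induction works with the recursion of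
  -- `fib` instead.
  fib-θ : ∀ n w → fib (suc n) (θ w) ≡ ι 2 * fib n (θ (w ∘ suc)) - ι n * fib n (w ∘ suc)
  fib-θ zero          w = solve 2 (λ x y → :ι 0 :* x := :ι 2 :* (:ι 0 :* y) :- :ι 0 :* y) refl _ _
  fib-θ (suc zero)    w = solve 2 (λ x y → :ι 0 :* x :- :ι 1 :* y := :ι 2 :* (:ι 0 :* y) :- :ι 1 :* y) refl _ _
  fib-θ (suc (suc n)) w = begin
    fib (suc (suc n)) (θ w) - fib (suc n) (θ w ∘ suc)
      ≡⟨ cong₂ _-_ (fib-θ (suc n) w) (fib-θ-suc (suc n) w) ⟩
    ι 2 * a - ι (suc n) * b - (a + b)
      ≡⟨ cong (λ u → ι 2 * a - u * b - (a + b)) (ι-suc n) ⟩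
    ι 2 * a - (1# + ι n) * b - (a + b)
      ≡⟨ solve 5 (λ a b n c d → :ι 2 :* a :- (:ι 1 :+ n) :* b :- (a :+ b)
           := (:ι 2 :* c :- n :* d) :+ (a :- :ι 2 :* c :+ n :* d :- (:ι 1 :+ (:ι 1 :+ n)) :* b)) refl a b (ι n) c d ⟩
    (ι 2 * c - ι n * d) + (a - ι 2 * c + ι n * d - (1# + (1# + ι n)) * b)
      ≡⟨ cong (_+ (a - ι 2 * c + ι n * d - (1# + (1# + ι n)) * b)) (fib-θ n (w ∘ suc)) ⟨
    a + (a - ι 2 * c + ι n * d - (1# + (1# + ι n)) * b)
      ≡⟨ solve 5 (λ a b n c d → a :+ (a :- :ι 2 :* c :+ n :* d :- (:ι 1 :+ (:ι 1 :+ n)) :* b)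
           := :ι 2 :* (a :- (c :+ d)) :- (:ι 1 :+ (:ι 1 :+ n)) :* (b :- d)) refl a b (ι n) c d ⟩
    ι 2 * (a - (c + d)) - (1# + (1# + ι n)) * (b - d)
      ≡⟨ cong₂ (λ x y → ι 2 * (a - x) - y * (b - d)) (fib-θ-suc n (w ∘ suc)) (cong (1# +_) (ι-suc n)) ⟨
    ι 2 * fib (suc (suc n)) (θ (w ∘ suc)) - ι (suc (suc n)) * fib (suc (suc n)) (w ∘ suc) ∎
    where
    a = fib (suc n) (θ (w ∘ suc))
    b = fib (suc n) (w ∘ suc)
    c = fib n (θ (w ∘ suc ∘ suc))
    d = fib n (w ∘ suc ∘ suc)

  -- Termwise (n+1) C(n-j,j-1) = j (C(n+1-j,j) + C(n-j,j-1)). The increment in n is thus governed by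
  -- the simpler weight `θ w`.
  fib-step : ∀ n w → ι (suc n) * (fib (suc n) w - fib n w) ≡ ι 2 * fib (suc n) (θ w) - fib n (θ w)
  fib-step zero    w = solve 1 (λ x → :ι 1 :* (x :- x) := :ι 2 :* (:ι 0 :* x) :- :ι 0 :* x) refl _
  fib-step (suc n) w = begin
    ι (suc (suc n)) * (fib (suc n) w - d - fib (suc n) w)
      ≡⟨ cong (λ u → (1# + u) * (fib (suc n) w - d - fib (suc n) w)) (ι-suc n) ⟩
    (1# + (1# + ι n)) * (fib (suc n) w - d - fib (suc n) w)
      ≡⟨ solve 4 (λ n d f c → (:ι 1 :+ (:ι 1 :+ n)) :* (f :- d :- f) := (:ι 2 :* c :- n :* d) :- :ι 2 :* (c :+ d)) refl (ι n) d (fib (suc n) w) c ⟩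
    (ι 2 * c - ι n * d) - ι 2 * (c + d)
      ≡⟨ cong₂ (λ x y → x - ι 2 * y) (fib-θ n w) (fib-θ-suc n w) ⟨
    a - ι 2 * fib n (θ w ∘ suc)
      ≡⟨ solve 2 (λ a c → a :- :ι 2 :* c := :ι 2 :* (a :- c) :- a) refl _ _ ⟩
    ι 2 * (a - fib n (θ w ∘ suc)) - a ∎
    where
    a = fib (suc n) (θ w)
    c = fib n (θ (w ∘ suc))
    d = fib n (w ∘ suc)

  -- v n = ζⁿ + ζ⁻ⁿ for a primitive sixth root of unity ζ.
  v : ℕ → K
  v zero          = ι 2
  v (suc zero)    = 1#
  v (suc (suc n)) = v (suc n) - v n

  -- For constant weight `fib` is a shift of the Lucas sequence U with parameters (1, 1), and `v` is
  -- its companion: V_m = 2 U_{m+1} - U_m.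
  fib-one : ∀ n → ι 2 * fib (suc n) (λ _ → 1#) - fib n (λ _ → 1#) ≡ v (suc n)
  fib-one zero          = solve 0 (:ι 2 :* :ι 1 :- :ι 1 := :ι 1) refl
  fib-one (suc zero)    = solve 0 (:ι 2 :* (:ι 1 :- :ι 1) :- :ι 1 := :ι 1 :- :ι 2) refl
  fib-one (suc (suc n)) = trans
    (solve 3 (λ a b c → :ι 2 :* (a :- b) :- (b :- c) := (:ι 2 :* a :- b) :- (:ι 2 :* b :- c)) refl _ _ _)
    (cong₂ _-_ (fib-one (suc n)) (fib-one n))

  -- The source term has weight 1 except at j = 0, where the missing contribution is the subtracted
  -- 1.
  fib-recip-step : ∀ n → fib (suc n) recip ≡ fib n recip + ⅟suc n * (v (suc n) - 1#)
  fib-recip-step n = solve-step n (begin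
    ι (suc n) * (fib (suc n) recip - fib n recip)
      ≡⟨ fib-step n recip ⟩
    ι 2 * fib (suc n) (θ recip) - fib n (θ recip)
      ≡⟨ solve 2 (λ x y → :ι 2 :* x :- y := :ι 2 :* (x :+ :ι 1) :- (y :+ :ι 1) :- :ι 1) refl _ _ ⟩
    ι 2 * (fib (suc n) (θ recip) + 1#) - (fib n (θ recip) + 1#) - 1#
      ≡⟨ cong₂ (λ x y → ι 2 * x - y - 1#) (total (suc n)) (total n) ⟩
    ι 2 * fib (suc n) (λ _ → 1#) - fib n (λ _ → 1#) - 1#
      ≡⟨ cong (_- 1#) (fib-one n) ⟩
    v (suc n) - 1# ∎)
    where
    total : ∀ k → fib k (θ recip) + 1# ≡ fib k (λ _ → 1#)
    total k = trans (cong (fib k (θ recip) +_) (sym (fib-δ₀ k))) (trans (sym (fib-+ k _ _)) (fib-cong k θ-recip))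

  θ-recip² : ∀ j → θ recip² j ≡ recip j
  θ-recip² j = trans (cong (ι j *_) (sym (*-identityˡ _))) (trans (θ-*recip² (λ _ → 1#) j) (*-identityˡ _))

  -- The factor n + 1 is kept: at n + 1 = p it makes the right side divisible by p, which is how the
  -- sum with weight 1/j is seen to vanish.
  fib-recip²-step : ∀ n → ι (suc n) * (fib (suc n) recip² - fib n recip²) ≡ ι 2 * fib (suc n) recip - fib n recip
  fib-recip²-step n = trans (fib-step n recip²)
    (cong₂ (λ x y → ι 2 * x - y) (fib-cong (suc n) θ-recip²) (fib-cong n θ-recip²))

  -- alt n w is Σ_k (−1)^k C(n,k) w_k.
  alt : ℕ → (ℕ → K) → K
  alt zero    w = w 0
  alt (suc n) w = alt n w - alt n (w ∘ suc)

  alt-cong : ∀ n {w w′ : ℕ → K} → (∀ j → w j ≡ w′ j) → alt n w ≡ alt n w′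
  alt-cong zero    eq = eq 0
  alt-cong (suc n) eq = cong₂ _-_ (alt-cong n eq) (alt-cong n (λ j → eq (suc j)))

  alt-+ : ∀ n w w′ → alt n (λ j → w j + w′ j) ≡ alt n w + alt n w′
  alt-+ zero    w w′ = refl
  alt-+ (suc n) w w′ = trans (cong₂ _-_ (alt-+ n w w′) (alt-+ n (w ∘ suc) (w′ ∘ suc)))
    (solve 4 (λ a b c d → a :+ b :- (c :+ d) := a :- c :+ (b :- d)) refl _ _ _ _)

  alt-const : ∀ n a → alt (suc n) (λ _ → a) ≡ 0#
  alt-const n a = -‿inverseʳ _

  alt-zero : ∀ n → alt n (λ _ → 0#) ≡ 0#
  alt-zero zero    = refl
  alt-zero (suc n) = alt-const n 0#

  alt-δ₀ : ∀ n a → alt n (λ j → a * δ₀ j) ≡ a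
  alt-δ₀ zero    a = *-identityʳ a
  alt-δ₀ (suc n) a = trans (cong₂ _-_ (alt-δ₀ n a) (trans (alt-cong n (λ _ → zeroʳ a)) (alt-zero n)))
    (solve 1 (λ x → x :- :ι 0 := x) refl _)

  alt-explicit : ∀ n w → alt n w ≡ ∑ (suc n) (λ k → bin n k * (sgn k * w k))
  alt-explicit zero    w = trans (solve 1 (λ x → x := :ι 0 :+ :ι 1 :* (:ι 1 :* x)) refl _)
    (cong (λ b → 0# + b * (1# * w 0)) (sym (bin-zero 0)))
  alt-explicit (suc n) w = begin
    alt n w - alt n (w ∘ suc)
      ≡⟨ cong₂ _-_ (alt-explicit n w) (alt-explicit n (w ∘ suc)) ⟩
    ∑ (suc n) (λ k → bin n k * (sgn k * w k)) - ∑ (suc n) (λ k → bin n k * (sgn k * w (suc k)))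
      ≡⟨ ∑-- (suc n) _ _ ⟨
    ∑ (suc n) (λ k → bin n k * (sgn k * w k) - bin n k * (sgn k * w (suc k)))
      ≡⟨ ∑-cong (suc n) (λ k → solve 4 (λ b s x y → b :* (s :* x) :- b :* (s :* y) := b :* (s :* x :+ (:- s) :* y)) refl _ _ _ _) ⟩
    ∑ (suc n) (λ k → bin n k * (sgn k * w k + sgn (suc k) * w (suc k)))
      ≡⟨ ∑-pascal n (λ k → sgn k * w k) ⟨
    ∑ (suc (suc n)) (λ k → bin (suc n) k * (sgn k * w k)) ∎

  -- This is k C(n+1,k) = (n+1) C(n,k-1), the sign coming from the shift of k.
  alt-θ : ∀ n w → alt (suc n) (θ w) ≡ - (ι (suc n) * alt n (w ∘ suc))
  alt-θ zero    w = solve 2 (λ x y → :ι 0 :* x :- :ι 1 :* y := :- (:ι 1 :* y)) refl _ _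
  alt-θ (suc n) w = begin
    alt (suc n) (θ w) - alt (suc n) (θ w ∘ suc)
      ≡⟨ cong (λ x → alt (suc n) (θ w) - x) (trans (alt-cong (suc n) (θ-suc w)) (alt-+ (suc n) _ _)) ⟩
    alt (suc n) (θ w) - (alt (suc n) (θ (w ∘ suc)) + alt (suc n) (w ∘ suc))
      ≡⟨ cong₂ (λ x y → x - (y + alt (suc n) (w ∘ suc))) (alt-θ n w) (alt-θ n (w ∘ suc)) ⟩
    - (ι (suc n) * alt n (w ∘ suc)) - (- (ι (suc n) * alt n (w ∘ suc ∘ suc)) + (alt n (w ∘ suc) - alt n (w ∘ suc ∘ suc)))
      ≡⟨ solve 3 (λ i a b → :- (i :* a) :- (:- (i :* b) :+ (a :- b)) := :- ((:ι 1 :+ i) :* (a :- b))) refl _ _ _ ⟩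
    - ((1# + ι (suc n)) * (alt n (w ∘ suc) - alt n (w ∘ suc ∘ suc))) ∎

  alt-step : ∀ n w → ι (suc n) * (alt (suc n) w - alt n w) ≡ alt (suc n) (θ w)
  alt-step n w = trans (solve 3 (λ i a b → i :* (a :- b :- a) := :- (i :* b)) refl _ _ _) (sym (alt-θ n w))

  -- The transform of ζ^k is (1 - ζ)^n = ζ^(-n), hence v is fixed. The transform of the shifted
  -- sequence is v_{n-1} for the same reason; it is carried along to close the induction.
  alt-v : ∀ n → alt n v ≡ v n × alt n (v ∘ suc) ≡ v n - v (suc n)
  alt-v zero    = refl , solve 0 (:ι 1 := :ι 2 :- :ι 1) refl
  alt-v (suc n) with alt-v n
  ... | eq₀ , eq₁ =
      trans (cong₂ _-_ eq₀ eq₁) (solve 2 (λ a b → a :- (a :- b) := b) refl _ _)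
    , (begin
        alt n (v ∘ suc) - alt n (v ∘ suc ∘ suc)
          ≡⟨ solve 3 (λ a b c → a :- c := b :- (c :+ b :- a)) refl _ (alt n v) _ ⟩
        alt n v - (alt n (v ∘ suc ∘ suc) + alt n v - alt n (v ∘ suc))
          ≡⟨ cong (λ x → alt n v - (x - alt n (v ∘ suc))) (trans (sym (alt-+ n _ _))
               (alt-cong n (λ j → solve 2 (λ a b → a :- b :+ b := a) refl (v (suc j)) (v j)))) ⟩
        alt n v - (alt n (v ∘ suc) - alt n (v ∘ suc))
          ≡⟨ cong (_- (alt n (v ∘ suc) - alt n (v ∘ suc))) eq₀ ⟩
        v n - (alt n (v ∘ suc) - alt n (v ∘ suc))
          ≡⟨ solve 3 (λ a b x → a :- (x :- x) := b :- (b :- a)) refl _ (v (suc n)) _ ⟩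
        v (suc n) - v (suc (suc n)) ∎)

  private
    vr vr² : ℕ → K
    vr  j = v j * recip j
    vr² j = v j * recip² j

  -- The subtracted 2 is v_0, which the weight v_j/j loses at j = 0.
  alt-vr-step : ∀ n → alt (suc n) vr ≡ alt n vr + ⅟suc n * (v (suc n) - ι 2)
  alt-vr-step n = solve-step n (begin
    ι (suc n) * (alt (suc n) vr - alt n vr)
      ≡⟨ alt-step n vr ⟩
    alt (suc n) (θ vr)
      ≡⟨ solve 1 (λ x → x := x :+ :ι 2 :- :ι 2) refl _ ⟩
    alt (suc n) (θ vr) + ι 2 - ι 2
      ≡⟨ cong (λ x → alt (suc n) (θ vr) + x - ι 2) (alt-δ₀ (suc n) (ι 2)) ⟨
    alt (suc n) (θ vr) + alt (suc n) (λ j → ι 2 * δ₀ j) - ι 2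
      ≡⟨ cong (_- ι 2) (trans (sym (alt-+ (suc n) _ _)) (trans (alt-cong (suc n) θ-vr) (proj₁ (alt-v (suc n))))) ⟩
    v (suc n) - ι 2 ∎)
    where
    θ-vr : ∀ j → θ vr j + ι 2 * δ₀ j ≡ v j
    θ-vr zero    = solve 0 (:ι 0 :* (:ι 2 :* :ι 0) :+ :ι 2 :* :ι 1 := :ι 2) refl
    θ-vr (suc j) = trans (solve 3 (λ i v r → i :* (v :* r) :+ :ι 2 :* :ι 0 := v :* (i :* r)) refl _ _ _)
      (trans (cong (v (suc j) *_) (⅟suc-inverse j)) (*-identityʳ _))

  alt-vr²-step : ∀ n → alt (suc n) vr² ≡ alt n vr² + ⅟suc n * alt (suc n) vr
  alt-vr²-step n = solve-step n (trans (alt-step n vr²) (alt-cong (suc n) (θ-*recip² v)))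

  -- Both sides are Σ (v_m - 1)/m over 1 ≤ m ≤ n.
  fib-recip-alt : ∀ n → fib n recip ≡ alt n vr + ∑ n ⅟suc
  fib-recip-alt zero    = solve 0 (:ι 0 := :ι 2 :* :ι 0 :+ :ι 0) refl
  fib-recip-alt (suc n) = begin
    fib (suc n) recip
      ≡⟨ fib-recip-step n ⟩
    fib n recip + ⅟suc n * (v (suc n) - 1#)
      ≡⟨ cong (_+ ⅟suc n * (v (suc n) - 1#)) (fib-recip-alt n) ⟩
    alt n vr + ∑ n ⅟suc + ⅟suc n * (v (suc n) - 1#)
      ≡⟨ solve 4 (λ x h a v → x :+ h :+ a :* (v :- :ι 1) := x :+ a :* (v :- :ι 2) :+ (h :+ a)) refl _ _ _ _ ⟩
    alt n vr + ⅟suc n * (v (suc n) - ι 2) + (∑ n ⅟suc + ⅟suc n)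
      ≡⟨ cong (_+ (∑ n ⅟suc + ⅟suc n)) (alt-vr-step n) ⟨
    alt (suc n) vr + ∑ (suc n) ⅟suc ∎

  -- Both sums with weight 1/j² accumulate 1/m times the corresponding sum with weight 1/j, and the
  -- latter differ by H_m. So the nested sums cancel up to Σ H_m/m = (H_n² + Σ 1/m²)/2; the factor 2
  -- clears this denominator.
  fib-recip²-alt : ∀ n → ι 2 * fib n recip² ≡
    ι 2 * alt n (λ j → v j * recip² j) + ι 2 * ∑ n (λ m → v (suc m) * (⅟suc m * ⅟suc m))
      + (∑ n ⅟suc * ∑ n ⅟suc - ∑ n (λ m → ⅟suc m * ⅟suc m))
  fib-recip²-alt zero    = solve 0 (:ι 2 :* (:ι 0 :* :ι 0) := :ι 2 :* (:ι 2 :* (:ι 0 :* :ι 0)) :+ :ι 2 :* :ι 0 :+ (:ι 0 :* :ι 0 :- :ι 0)) refl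
  fib-recip²-alt (suc n) = begin
    ι 2 * fib (suc n) recip²
      ≡⟨ cong (ι 2 *_) (solve-step n (fib-recip²-step n)) ⟩
    ι 2 * (fib n recip² + a * (ι 2 * fib (suc n) recip - fib n recip))
      ≡⟨ cong (λ x → ι 2 * (fib n recip² + a * (ι 2 * x - fib n recip))) (fib-recip-step n) ⟩
    ι 2 * (fib n recip² + a * (ι 2 * (fib n recip + a * (w - 1#)) - fib n recip))
      ≡⟨ solve 4 (λ y a x w → :ι 2 :* (y :+ a :* (:ι 2 :* (x :+ a :* (w :- :ι 1)) :- x))
           := :ι 2 :* y :+ :ι 2 :* a :* (x :+ a :* (w :- :ι 1)) :+ :ι 2 :* (a :* a :* (w :- :ι 1))) refl _ _ _ _ ⟩
    ι 2 * fib n recip² + ι 2 * a * (fib n recip + a * (w - 1#)) + ι 2 * (a * a * (w - 1#))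
      ≡⟨ cong₂ (λ x y → x + ι 2 * a * y + ι 2 * (a * a * (w - 1#))) (fib-recip²-alt n) (trans (sym (fib-recip-step n)) (fib-recip-alt (suc n))) ⟩
    ι 2 * y′ + ι 2 * V + (H * H - H₂) + ι 2 * a * (alt (suc n) vr + (H + a)) + ι 2 * (a * a * (w - 1#))
      ≡⟨ solve 7 (λ y V H H₂ a x w → :ι 2 :* y :+ :ι 2 :* V :+ (H :* H :- H₂) :+ :ι 2 :* a :* (x :+ (H :+ a)) :+ :ι 2 :* (a :* a :* (w :- :ι 1))
           := :ι 2 :* (y :+ a :* x) :+ :ι 2 :* (V :+ w :* (a :* a)) :+ ((H :+ a) :* (H :+ a) :- (H₂ :+ a :* a))) refl _ _ _ _ _ _ _ ⟩
    ι 2 * (y′ + a * alt (suc n) vr) + ι 2 * (V + w * (a * a)) + ((H + a) * (H + a) - (H₂ + a * a))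
      ≡⟨ cong (λ x → ι 2 * x + ι 2 * (V + w * (a * a)) + ((H + a) * (H + a) - (H₂ + a * a))) (alt-vr²-step n) ⟨
    ι 2 * alt (suc n) vr² + ι 2 * (V + w * (a * a)) + ((H + a) * (H + a) - (H₂ + a * a)) ∎
    where
    a  = ⅟suc n
    w  = v (suc n)
    H  = ∑ n ⅟suc
    H₂ = ∑ n (λ m → ⅟suc m * ⅟suc m)
    V  = ∑ n (λ m → v (suc m) * (⅟suc m * ⅟suc m))
    y′ = alt n vr²

  -- Bernoulli numbers

  infixr 8 _^_
  _^_ : K → ℕ → K
  x ^ zero  = 1#
  x ^ suc n = x * x ^ n

  1^n≡1 : ∀ n → 1# ^ n ≡ 1#
  1^n≡1 zero    = refl
  1^n≡1 (suc n) = trans (*-identityˡ _) (1^n≡1 n)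

  -- appell x n b is Σ_k C(n,k) b_k x^(n−k).
  appell : K → ℕ → (ℕ → K) → K
  appell x zero    b = b 0
  appell x (suc n) b = x * appell x n b + appell x n (b ∘ suc)

  appell-cong : ∀ x n {b b′ : ℕ → K} → (∀ j → b j ≡ b′ j) → appell x n b ≡ appell x n b′
  appell-cong x zero    eq = eq 0
  appell-cong x (suc n) eq = cong₂ (λ a b → x * a + b) (appell-cong x n eq) (appell-cong x n (λ j → eq (suc j)))

  appell-+ : ∀ x n b b′ → appell x n (λ j → b j + b′ j) ≡ appell x n b + appell x n b′
  appell-+ x zero    b b′ = refl
  appell-+ x (suc n) b b′ = trans (cong₂ (λ u w → x * u + w) (appell-+ x n b b′) (appell-+ x n (b ∘ suc) (b′ ∘ suc)))
    (solve 5 (λ x a b c d → x :* (a :+ b) :+ (c :+ d) := x :* a :+ c :+ (x :* b :+ d)) refl _ _ _ _ _)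

  appell-*ˡ : ∀ x n a b → appell x n (λ j → a * b j) ≡ a * appell x n b
  appell-*ˡ x zero    a b = refl
  appell-*ˡ x (suc n) a b = trans (cong₂ (λ u w → x * u + w) (appell-*ˡ x n a b) (appell-*ˡ x n a (b ∘ suc)))
    (solve 4 (λ x a b c → x :* (a :* b) :+ a :* c := a :* (x :* b :+ c)) refl _ _ _ _)

  -- Umbrally `appell x n b` is (x + b)^n, and this is the binomial theorem for x + (y + b).
  appell-translate : ∀ x y n b → appell (x + y) n b ≡ appell x n (λ j → appell y j b)
  appell-translate x y zero    b = refl
  appell-translate x y (suc n) b = begin
    (x + y) * appell (x + y) n b + appell (x + y) n (b ∘ suc)
      ≡⟨ cong₂ (λ u w → (x + y) * u + w) (appell-translate x y n b) (appell-translate x y n (b ∘ suc)) ⟩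
    (x + y) * A + appell x n (λ j → appell y j (b ∘ suc))
      ≡⟨ solve 4 (λ x y a c → (x :+ y) :* a :+ c := x :* a :+ (y :* a :+ c)) refl _ _ _ _ ⟩
    x * A + (y * A + appell x n (λ j → appell y j (b ∘ suc)))
      ≡⟨ cong (x * A +_) (trans (appell-+ x n _ _) (cong (_+ appell x n (λ j → appell y j (b ∘ suc))) (appell-*ˡ x n y _))) ⟨
    x * A + appell x n (λ j → appell y (suc j) b) ∎
    where A = appell x n (λ j → appell y j b)

  appell-explicit : ∀ x n b → appell x n b ≡ ∑ (suc n) (λ k → bin n k * (b k * x ^ (n ∸ k)))
  appell-explicit x zero    b = trans (solve 1 (λ x → x := :ι 0 :+ :ι 1 :* (x :* :ι 1)) refl _)
    (cong (λ u → 0# + u * (b 0 * 1#)) (sym (bin-zero 0)))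
  appell-explicit x (suc n) b = begin
    x * appell x n b + appell x n (b ∘ suc)
      ≡⟨ cong₂ (λ u w → x * u + w) (appell-explicit x n b) (appell-explicit x n (b ∘ suc)) ⟩
    x * ∑ (suc n) (λ k → bin n k * (b k * x ^ (n ∸ k))) + ∑ (suc n) (λ k → bin n k * (b (suc k) * x ^ (n ∸ k)))
      ≡⟨ cong (_+ ∑ (suc n) (λ k → bin n k * (b (suc k) * x ^ (n ∸ k)))) (∑-*ˡ (suc n) _ _) ⟨
    ∑ (suc n) (λ k → x * (bin n k * (b k * x ^ (n ∸ k)))) + ∑ (suc n) (λ k → bin n k * (b (suc k) * x ^ (n ∸ k)))
      ≡⟨ ∑-+ (suc n) _ _ ⟨
    ∑ (suc n) (λ k → x * (bin n k * (b k * x ^ (n ∸ k))) + bin n k * (b (suc k) * x ^ (n ∸ k)))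
      ≡⟨ ∑-cong< (suc n) (λ { k (s≤s k≤n) → trans
           (solve 5 (λ x c b p d → x :* (c :* (b :* p)) :+ c :* d := c :* (b :* (x :* p) :+ d)) refl x (bin n k) (b k) (x ^ (n ∸ k)) _)
           (cong (λ m → bin n k * (b k * x ^ m + b (suc k) * x ^ (n ∸ k))) (sym (ℕ.+-∸-assoc 1 k≤n))) }) ⟩
    ∑ (suc n) (λ k → bin n k * (b k * x ^ (suc n ∸ k) + b (suc k) * x ^ (n ∸ k)))
      ≡⟨ ∑-pascal n (λ k → b k * x ^ (suc n ∸ k)) ⟨
    ∑ (suc (suc n)) (λ k → bin (suc n) k * (b k * x ^ (suc n ∸ k))) ∎

  appell-0 : ∀ n b → appell 0# n b ≡ b n
  appell-0 zero    b = refl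
  appell-0 (suc n) b = trans (cong₂ _+_ (zeroˡ _) (appell-0 n (b ∘ suc))) (+-identityˡ _)

  -- Umbrally (x - b)^n = (-1)^n (-x + b)^n.
  appell-sgn : ∀ x n b → appell x n (λ k → sgn k * b k) ≡ sgn n * appell (- x) n b
  appell-sgn x zero    b = refl
  appell-sgn x (suc n) b = begin
    x * appell x n (λ k → sgn k * b k) + appell x n (λ k → - sgn k * b (suc k))
      ≡⟨ cong (λ u → x * appell x n (λ k → sgn k * b k) + u) (trans (appell-cong x n (λ k →
           solve 2 (λ s b → :- s :* b := :- (:ι 1) :* (s :* b)) refl _ _)) (appell-*ˡ x n (- 1#) _)) ⟩
    x * appell x n (λ k → sgn k * b k) + - 1# * appell x n (λ k → sgn k * b (suc k))
      ≡⟨ cong₂ (λ u w → x * u + - 1# * w) (appell-sgn x n b) (appell-sgn x n (b ∘ suc)) ⟩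
    x * (sgn n * appell (- x) n b) + - 1# * (sgn n * appell (- x) n (b ∘ suc))
      ≡⟨ solve 4 (λ x s a c → x :* (s :* a) :+ :- (:ι 1) :* (s :* c) := :- s :* (:- x :* a :+ c)) refl _ _ _ _ ⟩
    - sgn n * (- x * appell (- x) n b + appell (- x) n (b ∘ suc)) ∎

  -- The jump B_n(1) - B_n of the Bernoulli polynomials; its Appell sum is the derivative n x^(n-1).
  δ₁ : ℕ → K
  δ₁ zero    = 0#
  δ₁ (suc n) = δ₀ n

  appell-zero : ∀ x n → appell x n (λ _ → 0#) ≡ 0#
  appell-zero x zero    = refl
  appell-zero x (suc n) = trans (cong₂ (λ u w → x * u + w) (appell-zero x n) (appell-zero x n))
    (solve 1 (λ x → x :* :ι 0 :+ :ι 0 := :ι 0) refl _)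

  appell-δ₀ : ∀ x n → appell x n δ₀ ≡ x ^ n
  appell-δ₀ x zero    = refl
  appell-δ₀ x (suc n) = trans (cong₂ (λ u w → x * u + w) (appell-δ₀ x n) (appell-zero x n)) (+-identityʳ _)

  appell-δ₁ : ∀ x n → appell x (suc n) δ₁ ≡ ι (suc n) * x ^ n
  appell-δ₁ x zero    = solve 1 (λ x → x :* :ι 0 :+ :ι 1 := :ι 1 :* :ι 1) refl x
  appell-δ₁ x (suc n) = trans (cong₂ (λ u w → x * u + w) (appell-δ₁ x n) (appell-δ₀ x (suc n)))
    (solve 3 (λ x i p → x :* (i :* p) :+ x :* p := (:ι 1 :+ i) :* (x :* p)) refl _ _ _)

  binomial-theorem : ∀ x n → (x + 1#) ^ n ≡ ∑ (suc n) (λ k → bin n k * x ^ (n ∸ k))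
  binomial-theorem x n = begin
    (x + 1#) ^ n                                  ≡⟨ appell-δ₀ (x + 1#) n ⟨
    appell (x + 1#) n δ₀                          ≡⟨ appell-translate x 1# n δ₀ ⟩
    appell x n (λ j → appell 1# j δ₀)             ≡⟨ appell-cong x n (λ j → trans (appell-δ₀ 1# j) (1^n≡1 j)) ⟩
    appell x n (λ _ → 1#)                         ≡⟨ appell-explicit x n _ ⟩
    ∑ (suc n) (λ k → bin n k * (1# * x ^ (n ∸ k))) ≡⟨ ∑-cong (suc n) (λ k → cong (bin n k *_) (*-identityˡ _)) ⟩
    ∑ (suc n) (λ k → bin n k * x ^ (n ∸ k))       ∎

  bin-codiag : ∀ n → bin (suc n) n ≡ ι (suc n)
  bin-codiag n = begin
    bin (suc n) n             ≡⟨ bin-sym (suc n) n (ℕ.n≤1+n n) ⟩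
    bin (suc n) (suc n ∸ n)   ≡⟨ cong (bin (suc n)) (ℕ.m+n∸n≡m 1 n) ⟩
    bin (suc n) 1             ≡⟨ *-identityˡ _ ⟨
    ι 1 * bin (suc n) 1       ≡⟨ bin-absorb n 0 ⟩
    ι (suc n) * bin n 0       ≡⟨ trans (cong (ι (suc n) *_) (bin-zero n)) (*-identityʳ _) ⟩
    ι (suc n)                 ∎

  appell-1 : ∀ n b → appell 1# (suc n) b ≡ ∑ n (λ k → bin (suc n) k * b k) + ι (suc n) * b n + b (suc n)
  appell-1 n b = trans (appell-explicit 1# (suc n) b) (cong₂ _+_ (cong₂ _+_
      (∑-cong n (λ k → cong (bin (suc n) k *_) (drop k)))
      (cong₂ _*_ (bin-codiag n) (drop n)))
      (trans (cong₂ _*_ (bin-diag (suc n)) (drop (suc n))) (*-identityˡ _)))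
    where
    drop : ∀ k → b k * 1# ^ (suc n ∸ k) ≡ b k
    drop k = trans (cong (b k *_) (1^n≡1 (suc n ∸ k))) (*-identityʳ _)

  private
    leading : ∀ m e → (∀ k → k < m → e k ≡ 0#) →
      appell 1# m e ≡ e m × appell 1# (suc m) e ≡ ι (suc m) * e m + e (suc m)
    leading zero    e e≡0 = refl , refl
    leading (suc m) e e≡0 with leading m e (λ k k<m → e≡0 k (ℕ.m<n⇒m<1+n k<m)) | leading m (e ∘ suc) (λ k k<m → e≡0 (suc k) (s≤s k<m))
    ... | _ , eq₁ | _ , eq₂ = first , (begin
        1# * appell 1# (suc m) e + appell 1# (suc m) (e ∘ suc)
          ≡⟨ cong₂ (λ u w → 1# * u + w) first eq₂ ⟩
        1# * e (suc m) + (ι (suc m) * e (suc m) + e (suc (suc m)))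
          ≡⟨ solve 3 (λ i x y → :ι 1 :* x :+ (i :* x :+ y) := (:ι 1 :+ i) :* x :+ y) refl _ _ _ ⟩
        ι (suc (suc m)) * e (suc m) + e (suc (suc m)) ∎)
      where
      first : appell 1# (suc m) e ≡ e (suc m)
      first = trans eq₁ (trans (cong (λ u → ι (suc m) * u + e (suc m)) (e≡0 m (ℕ.n<1+n m)))
        (solve 2 (λ i x → i :* :ι 0 :+ x := x) refl _ _))

    -- If e is invariant under b ↦ 1 + b and vanishes below n, its value at level n + 1 changes by
    -- (n+1) e_n, so e_n vanishes too.
    fixed-vanish : ∀ e → (∀ n → appell 1# n e ≡ e n) → ∀ n k → k < n → e k ≡ 0#
    fixed-vanish e fixed (suc n) k (s≤s k≤n) with ℕ.m≤n⇒m<n∨m≡n k≤n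
    ... | inj₁ k<n  = fixed-vanish e fixed n k k<n
    ... | inj₂ refl = ι-cancel n (begin
        ι (suc n) * e n                          ≡⟨ solve 2 (λ x y → x := x :+ y :- y) refl _ _ ⟩
        ι (suc n) * e n + e (suc n) - e (suc n)  ≡⟨ cong (_- e (suc n)) (proj₂ (leading n e (fixed-vanish e fixed n))) ⟨
        appell 1# (suc n) e - e (suc n)          ≡⟨ cong (_- e (suc n)) (fixed (suc n)) ⟩
        e (suc n) - e (suc n)                    ≡⟨ solve 2 (λ x i → x :- x := i :* :ι 0) refl _ _ ⟩
        ι (suc n) * 0#                           ∎)

  sgn-square : ∀ n → sgn n * sgn n ≡ 1#
  sgn-square zero    = *-identityˡ 1#
  sgn-square (suc n) = trans (solve 1 (λ x → :- x :* :- x := x :* x) refl _) (sgn-square n)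

  -- The definition solves Σ_{k≤n+1} C(n+2,k) B_k = 0 for its last term, whose coefficient is n + 2.
  bernoulli-definition⇒recurrence : ∀ B → B 0 ≡ 1# →
    (∀ n → B (suc n) ≡ - (∑ (suc n) (λ k → bin (2 ℕ.+ n) k * B k) * ⅟suc (suc n))) →
    ∀ n → appell 1# n B ≡ B n + δ₁ n
  bernoulli-definition⇒recurrence B B₀ Bₙ zero          = sym (+-identityʳ _)
  bernoulli-definition⇒recurrence B B₀ Bₙ (suc zero)    = trans (cong (λ b → 1# * b + B 1) B₀)
    (solve 1 (λ b → :ι 1 :* :ι 1 :+ b := b :+ :ι 1) refl _)
  bernoulli-definition⇒recurrence B B₀ Bₙ (suc (suc n)) = begin
    appell 1# (2 ℕ.+ n) B                                       ≡⟨ appell-1 (suc n) B ⟩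
    R + ι (2 ℕ.+ n) * B (suc n) + B (2 ℕ.+ n)                   ≡⟨ cong (λ b → R + ι (2 ℕ.+ n) * b + B (2 ℕ.+ n)) (Bₙ n) ⟩
    R + ι (2 ℕ.+ n) * - (R * ⅟suc (suc n)) + B (2 ℕ.+ n)        ≡⟨ solve 4 (λ r i v b → r :+ i :* :- (r :* v) :+ b := r :- i :* v :* r :+ b) refl R (ι (2 ℕ.+ n)) (⅟suc (suc n)) _ ⟩
    R - ι (2 ℕ.+ n) * ⅟suc (suc n) * R + B (2 ℕ.+ n)            ≡⟨ cong (λ x → R - x * R + B (2 ℕ.+ n)) (⅟suc-inverse (suc n)) ⟩
    R - 1# * R + B (2 ℕ.+ n)                                    ≡⟨ solve 2 (λ r b → r :- :ι 1 :* r :+ b := b :+ :ι 0) refl _ _ ⟩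
    B (2 ℕ.+ n) + 0#                                            ∎
    where R = ∑ (suc n) (λ k → bin (2 ℕ.+ n) k * B k)

  module _ (B : ℕ → K) (bernoulli-recurrence : ∀ n → appell 1# n B ≡ B n + δ₁ n) where

    -- Both B and n ↦ (−1)ⁿ Σ_k C(n,k) B_k solve the recurrence, and a solution is determined by B₀.
    bernoulli-reflection : ∀ n → sgn n * (B n + δ₁ n) ≡ B n
    bernoulli-reflection n = begin
      sgn n * (B n + δ₁ n)      ≡⟨ solve 2 (λ x y → x := (x :+ :- (:ι 1) :* y) :+ y) refl _ _ ⟩
      e n + B n                 ≡⟨ cong (_+ B n) (fixed-vanish e fixed (suc n) n (ℕ.n<1+n n)) ⟩
      0# + B n                  ≡⟨ +-identityˡ _ ⟩
      B n                       ∎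
      where
      c e : ℕ → K
      c k = sgn k * (B k + δ₁ k)
      e k = c k + - 1# * B k
      c-fixed : ∀ m → appell 1# m c ≡ sgn m * B m
      c-fixed m = begin
        appell 1# m c
          ≡⟨ appell-cong 1# m (λ k → cong (sgn k *_) (bernoulli-recurrence k)) ⟨
        appell 1# m (λ k → sgn k * appell 1# k B)
          ≡⟨ appell-sgn 1# m _ ⟩
        sgn m * appell (- 1#) m (λ k → appell 1# k B)
          ≡⟨ cong (sgn m *_) (appell-translate (- 1#) 1# m B) ⟨
        sgn m * appell (- 1# + 1#) m B
          ≡⟨ cong (λ x → sgn m * appell x m B) (trans (+-comm _ _) (-‿inverseʳ 1#)) ⟩
        sgn m * appell 0# m B
          ≡⟨ cong (sgn m *_) (appell-0 m B) ⟩
        sgn m * B m ∎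
      sgn-δ₁ : ∀ m → sgn m * δ₁ m ≡ - δ₁ m
      sgn-δ₁ zero          = solve 0 (:ι 1 :* :ι 0 := :- (:ι 0)) refl
      sgn-δ₁ (suc zero)    = solve 0 (:- (:ι 1) :* :ι 1 := :- (:ι 1)) refl
      sgn-δ₁ (suc (suc m)) = solve 1 (λ x → x :* :ι 0 := :- (:ι 0)) refl _
      fixed : ∀ m → appell 1# m e ≡ e m
      fixed m = begin
        appell 1# m e
          ≡⟨ trans (appell-+ 1# m _ _) (cong (appell 1# m c +_) (appell-*ˡ 1# m _ _)) ⟩
        appell 1# m c + - 1# * appell 1# m B
          ≡⟨ cong₂ (λ u w → u + - 1# * w) (c-fixed m) (bernoulli-recurrence m) ⟩
        sgn m * B m + - 1# * (B m + δ₁ m)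
          ≡⟨ solve 3 (λ s b d → s :* b :+ :- (:ι 1) :* (b :+ d) := s :* b :+ :- d :+ :- (:ι 1) :* b) refl _ _ _ ⟩
        sgn m * B m + - δ₁ m + - 1# * B m
          ≡⟨ cong (λ u → sgn m * B m + u + - 1# * B m) (sgn-δ₁ m) ⟨
        sgn m * B m + sgn m * δ₁ m + - 1# * B m
          ≡⟨ cong (_+ - 1# * B m) (distribˡ _ _ _) ⟨
        e m ∎

    bernoulli-odd : ∀ n → 0 < n → sgn n ≡ 1# → B (suc n) ≡ 0#
    bernoulli-odd (suc n) _ sgn≡1 = ι-cancel 1 (begin
      ι 2 * B m                          ≡⟨ solve 1 (λ x → :ι 2 :* x := x :+ x) refl _ ⟩
      B m + B m                          ≡⟨ cong (_+ B m) (bernoulli-reflection m) ⟨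
      - sgn (suc n) * (B m + 0#) + B m   ≡⟨ cong (λ s → - s * (B m + 0#) + B m) sgn≡1 ⟩
      - 1# * (B m + 0#) + B m            ≡⟨ solve 1 (λ x → :- (:ι 1) :* (x :+ :ι 0) :+ x := :ι 2 :* :ι 0) refl _ ⟩
      ι 2 * 0#                           ∎)
      where m = suc (suc n)

    -- Faulhaber's formula: the step from m to m + 1 adds the Appell sum of `δ₁`, that is (n+1) m^n.
    appell-ι : ∀ m n → appell (ι m) (suc n) B ≡ B (suc n) + ι (suc n) * ∑ m (λ i → ι i ^ n)
    appell-ι zero    n = trans (appell-0 (suc n) B) (solve 2 (λ b i → b := b :+ i :* :ι 0) refl _ _)
    appell-ι (suc m) n = begin
      appell (ι (suc m)) (suc n) B
        ≡⟨ cong (λ x → appell x (suc n) B) (trans (ι-suc m) (+-comm _ _)) ⟩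
      appell (ι m + 1#) (suc n) B
        ≡⟨ appell-translate (ι m) 1# (suc n) B ⟩
      appell (ι m) (suc n) (λ j → appell 1# j B)
        ≡⟨ trans (appell-cong (ι m) (suc n) bernoulli-recurrence) (appell-+ (ι m) (suc n) B δ₁) ⟩
      appell (ι m) (suc n) B + appell (ι m) (suc n) δ₁
        ≡⟨ cong₂ _+_ (appell-ι m n) (appell-δ₁ (ι m) n) ⟩
      B (suc n) + ι (suc n) * ∑ m (λ i → ι i ^ n) + ι (suc n) * ι m ^ n
        ≡⟨ solve 4 (λ b i s x → b :+ i :* s :+ i :* x := b :+ i :* (s :+ x)) refl _ _ _ _ ⟩
      B (suc n) + ι (suc n) * ∑ (suc m) (λ i → ι i ^ n) ∎

module Congruences (F : ℚ-Algebra) where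
  open Identities F public

  -- Congruences modulo p

  module Localisation (N : ℕ) (p-prime : Prime (suc N)) where
    private
      p : ℕ
      p = suc N

    -- With p = N + 1, Integral is membership in ℤ_(p) and x ≈ y is congruence
    -- modulo p ℤ_(p).
    record Integral (x : K) : Set where
      constructor integral
      field
        denominator   : ℕ
        numerator     : ℤ
        p∤denominator : p ∤ denominator
        x*d≡n         : x * ι denominator ≡ ιℤ numerator

    p∤1 : p ∤ 1
    p∤1 p∣1 with ∣1⇒≡1 p∣1 | prime⇒nonTrivial p-prime
    ... | refl | ()

    p∤* : ∀ {m n} → p ∤ m → p ∤ n → p ∤ m ℕ.* n
    p∤* {m} {n} p∤m p∤n p∣mn = [ p∤m , p∤n ]′ (euclidsLemma m n p-prime p∣mn)

    p∤suc : ∀ {i} → suc i < p → p ∤ suc i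
    p∤suc i<p = >⇒∤ i<p

    int-ιℤ : ∀ i → Integral (ιℤ i)
    int-ιℤ i = integral 1 i p∤1 (*-identityʳ _)

    int-ι : ∀ n → Integral (ι n)
    int-ι n = int-ιℤ (ℤ.+ n)

    int-bin : ∀ n k → Integral (bin n k)
    int-bin n k = subst Integral (sym (bin≡ι n k)) (int-ι (n C k))

    int-+ : ∀ {x y} → Integral x → Integral y → Integral (x + y)
    int-+ {x} {y} (integral d a p∤d eq) (integral e b p∤e eq′) = integral (d ℕ.* e) (a ℤ.* ℤ.+ e ℤ.+ b ℤ.* ℤ.+ d) (p∤* p∤d p∤e) (begin
      (x + y) * ι (d ℕ.* e)                   ≡⟨ cong ((x + y) *_) (ι-* d e) ⟩
      (x + y) * (ι d * ι e)                   ≡⟨ solve 4 (λ x y d e → (x :+ y) :* (d :* e) := x :* d :* e :+ y :* e :* d) refl _ _ _ _ ⟩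
      x * ι d * ι e + y * ι e * ι d           ≡⟨ cong₂ (λ u w → u * ι e + w * ι d) eq eq′ ⟩
      ιℤ a * ι e + ιℤ b * ι d                 ≡⟨ cong₂ _+_ (ιℤ-* a (ℤ.+ e)) (ιℤ-* b (ℤ.+ d)) ⟨
      ιℤ (a ℤ.* ℤ.+ e) + ιℤ (b ℤ.* ℤ.+ d)     ≡⟨ ιℤ-+ (a ℤ.* ℤ.+ e) (b ℤ.* ℤ.+ d) ⟨
      ιℤ (a ℤ.* ℤ.+ e ℤ.+ b ℤ.* ℤ.+ d)        ∎)
      where open ≡-Reasoning

    int-* : ∀ {x y} → Integral x → Integral y → Integral (x * y)
    int-* {x} {y} (integral d a p∤d eq) (integral e b p∤e eq′) = integral (d ℕ.* e) (a ℤ.* b) (p∤* p∤d p∤e) (begin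
      (x * y) * ι (d ℕ.* e)     ≡⟨ cong (x * y *_) (ι-* d e) ⟩
      (x * y) * (ι d * ι e)     ≡⟨ solve 4 (λ x y d e → (x :* y) :* (d :* e) := x :* d :* (y :* e)) refl _ _ _ _ ⟩
      x * ι d * (y * ι e)       ≡⟨ cong₂ _*_ eq eq′ ⟩
      ιℤ a * ιℤ b               ≡⟨ ιℤ-* a b ⟨
      ιℤ (a ℤ.* b)              ∎)
      where open ≡-Reasoning

    int-neg : ∀ {x} → Integral x → Integral (- x)
    int-neg {x} (integral d a p∤d eq) = integral d (ℤ.- a) p∤d
      (trans (solve 2 (λ x d → :- x :* d := :- (x :* d)) refl _ _) (trans (cong -_ eq) (sym (ιℤ-neg a))))

    int-- : ∀ {x y} → Integral x → Integral y → Integral (x - y)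
    int-- x y = int-+ x (int-neg y)

    int-⅟suc : ∀ n → p ∤ suc n → Integral (⅟suc n)
    int-⅟suc n p∤n = integral (suc n) (ℤ.+ 1) p∤n (trans (*-comm _ _) (⅟suc-inverse n))

    int-⅟ : ∀ {n} → suc n < p → Integral (⅟suc n)
    int-⅟ {n} n<p = int-⅟suc n (p∤suc n<p)

    int-∑ : ∀ n {f} → (∀ i → i < n → Integral (f i)) → Integral (∑ n f)
    int-∑ zero    h = int-ι 0
    int-∑ (suc n) h = int-+ (int-∑ n (λ i i<n → h i (ℕ.m<n⇒m<1+n i<n))) (h n (ℕ.n<1+n n))

    int-^ : ∀ {x} n → Integral x → Integral (x ^ n)
    int-^ zero    _ = int-ι 1
    int-^ (suc n) x = int-* x (int-^ n x)

    int-sgn : ∀ n → Integral (sgn n)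
    int-sgn zero    = int-ι 1
    int-sgn (suc n) = int-neg (int-sgn n)

    infix 4 _≈_
    record _≈_ (x y : K) : Set where
      constructor congruent
      field
        quotient     : K
        int-quotient : Integral quotient
        x≡y+p*c      : x ≡ y + ι p * quotient

    ≈-reflexive : ∀ {x y} → x ≡ y → x ≈ y
    ≈-reflexive {x} refl = congruent 0# (int-ι 0) (solve 2 (λ x p → x := x :+ p :* :ι 0) refl _ _)

    ≈-refl : ∀ {x} → x ≈ x
    ≈-refl = ≈-reflexive refl

    ≈-sym : ∀ {x y} → x ≈ y → y ≈ x
    ≈-sym {x} {y} (congruent c int eq) = congruent (- c) (int-neg int)
      (trans (solve 3 (λ y p c → y := y :+ p :* c :+ p :* :- c) refl _ _ _) (cong (_+ ι p * - c) (sym eq)))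

    ≈-trans : ∀ {x y z} → x ≈ y → y ≈ z → x ≈ z
    ≈-trans (congruent c int eq) (congruent d int′ eq′) = congruent (d + c) (int-+ int′ int)
      (trans eq (trans (cong (_+ ι p * c) eq′) (solve 4 (λ z p d c → z :+ p :* d :+ p :* c := z :+ p :* (d :+ c)) refl _ _ _ _)))

    ≈-setoid : Setoid 0ℓ 0ℓ
    ≈-setoid = record { _≈_ = _≈_ ; isEquivalence = record { refl = ≈-refl ; sym = ≈-sym ; trans = ≈-trans } }

    ≈-+ : ∀ {x x′ y y′} → x ≈ x′ → y ≈ y′ → x + y ≈ x′ + y′
    ≈-+ (congruent c int eq) (congruent d int′ eq′) = congruent (c + d) (int-+ int int′)
      (trans (cong₂ _+_ eq eq′) (solve 5 (λ x y p c d → x :+ p :* c :+ (y :+ p :* d) := x :+ y :+ p :* (c :+ d)) refl _ _ _ _ _))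

    ≈-*ˡ : ∀ {a x y} → Integral a → x ≈ y → a * x ≈ a * y
    ≈-*ˡ {a} int-a (congruent c int eq) = congruent (a * c) (int-* int-a int)
      (trans (cong (a *_) eq) (solve 4 (λ a y p c → a :* (y :+ p :* c) := a :* y :+ p :* (a :* c)) refl _ _ _ _))

    ≈-*ʳ : ∀ {a x y} → Integral a → x ≈ y → x * a ≈ y * a
    ≈-*ʳ {a} {x} {y} int-a x≈y = subst₂ _≈_ (*-comm a x) (*-comm a y) (≈-*ˡ int-a x≈y)

    -- From xy - x′y′ = x (y - y′) + (x - x′) y′, whence the choice of factors required to be
    -- integral.
    ≈-* : ∀ {x x′ y y′} → Integral x → Integral y′ → x ≈ x′ → y ≈ y′ → x * y ≈ x′ * y′
    ≈-* int-x int-y′ x≈x′ y≈y′ = ≈-trans (≈-*ˡ int-x y≈y′) (≈-*ʳ int-y′ x≈x′)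

    ≈-neg : ∀ {x y} → x ≈ y → - x ≈ - y
    ≈-neg {x} {y} x≈y = subst₂ _≈_ (neg x) (neg y) (≈-*ˡ (int-neg (int-ι 1)) x≈y)
      where
      neg : ∀ z → - 1# * z ≡ - z
      neg z = solve 1 (λ z → :- (:ι 1) :* z := :- z) refl z

    ≈-- : ∀ {x x′ y y′} → x ≈ x′ → y ≈ y′ → x - y ≈ x′ - y′
    ≈-- x≈x′ y≈y′ = ≈-+ x≈x′ (≈-neg y≈y′)

    ≈-∑ : ∀ n {f g} → (∀ i → i < n → f i ≈ g i) → ∑ n f ≈ ∑ n g
    ≈-∑ zero    h = ≈-refl
    ≈-∑ (suc n) h = ≈-+ (≈-∑ n (λ i i<n → h i (ℕ.m<n⇒m<1+n i<n))) (h n (ℕ.n<1+n n))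

    ≈-∑0 : ∀ n {f} → (∀ i → i < n → f i ≈ 0#) → ∑ n f ≈ 0#
    ≈-∑0 n h = ≈-trans (≈-∑ n h) (≈-reflexive (∑-zero n (λ _ _ → refl)))

    ≈-^ : ∀ {x y} n → Integral x → Integral y → x ≈ y → x ^ n ≈ y ^ n
    ≈-^ zero    _     _     _   = ≈-refl
    ≈-^ (suc n) int-x int-y x≈y = ≈-* int-x (int-^ n int-y) x≈y (≈-^ n int-x int-y x≈y)

    p*≈0 : ∀ {c} → Integral c → ι p * c ≈ 0#
    p*≈0 {c} int = congruent c int (sym (+-identityˡ _))

    p≈0 : ι p ≈ 0#
    p≈0 = congruent 1# (int-ι 1) (solve 1 (λ p → p := :ι 0 :+ p :* :ι 1) refl _)

    ≈-cancel : ∀ {n x y} → p ∤ suc n → ι (suc n) * x ≈ ι (suc n) * y → x ≈ y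
    ≈-cancel {n} {x} {y} p∤n eq = subst₂ _≈_ (cancel x) (cancel y) (≈-*ˡ (int-⅟suc n p∤n) eq)
      where
      open ≡-Reasoning
      cancel : ∀ z → ⅟suc n * (ι (suc n) * z) ≡ z
      cancel z = begin
        ⅟suc n * (ι (suc n) * z)    ≡⟨ solve 3 (λ v i z → v :* (i :* z) := i :* v :* z) refl _ _ _ ⟩
        ι (suc n) * ⅟suc n * z      ≡⟨ cong (_* z) (⅟suc-inverse n) ⟩
        1# * z                      ≡⟨ *-identityˡ z ⟩
        z                           ∎

    module ≈-Reasoning = SetoidReasoning ≈-setoid

    -- Since a ≡ -1 - d modulo p, this is the upper negation C(-1-d,j) = (-1)^j C(j+d,j). For j < p
    -- the induction divides by units only.
    bin-negate : ∀ j a d → j < p → suc (a ℕ.+ d) ≡ p → bin a j ≈ sgn j * bin (j ℕ.+ d) j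
    bin-negate zero    a d j<p a+d = ≈-reflexive (trans (bin-zero a) (sym (trans (*-identityˡ _) (bin-zero d))))
    bin-negate (suc j) a d j<p a+d = ≈-cancel (p∤suc j<p) (begin
      ι (suc j) * bin a (suc j)
        ≡⟨ bin-step a j ⟩
      (ι a - ι j) * bin a j
        ≈⟨ ≈-*ˡ (int-- (int-ι a) (int-ι j)) (bin-negate j a d (ℕ.<-trans (ℕ.n<1+n j) j<p) a+d) ⟩
      (ι a - ι j) * (sgn j * bin (j ℕ.+ d) j)
        ≡⟨ solve 4 (λ a j d x → (a :- j) :* x := (:ι 1 :+ (a :+ d)) :* x :- (:ι 1 :+ (j :+ d)) :* x) refl (ι a) (ι j) (ι d) _ ⟩
      (1# + (ι a + ι d)) * (sgn j * bin (j ℕ.+ d) j) - (1# + (ι j + ι d)) * (sgn j * bin (j ℕ.+ d) j)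
        ≡⟨ cong₂ (λ x y → x * (sgn j * bin (j ℕ.+ d) j) - y * (sgn j * bin (j ℕ.+ d) j))
             (trans (cong (1# +_) (sym (ι-+ a d))) (trans (sym (ι-suc (a ℕ.+ d))) (cong ι a+d)))
             (trans (cong (1# +_) (sym (ι-+ j d))) (sym (ι-suc (j ℕ.+ d)))) ⟩
      ι p * (sgn j * bin (j ℕ.+ d) j) - ι (suc (j ℕ.+ d)) * (sgn j * bin (j ℕ.+ d) j)
        ≈⟨ ≈-- (p*≈0 (int-* (int-sgn j) (int-bin _ j))) ≈-refl ⟩
      0# - ι (suc (j ℕ.+ d)) * (sgn j * bin (j ℕ.+ d) j)
        ≡⟨ solve 3 (λ i s b → :ι 0 :- i :* (s :* b) := :- s :* (i :* b)) refl _ _ _ ⟩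
      - sgn j * (ι (suc (j ℕ.+ d)) * bin (j ℕ.+ d) j)
        ≡⟨ cong (- sgn j *_) (bin-absorb (j ℕ.+ d) j) ⟨
      - sgn j * (ι (suc j) * bin (suc (j ℕ.+ d)) (suc j))
        ≡⟨ solve 3 (λ s i b → s :* (i :* b) := i :* (s :* b)) refl _ _ _ ⟩
      ι (suc j) * (- sgn j * bin (suc j ℕ.+ d) (suc j)) ∎)
      where open ≈-Reasoning

    bin[p-1]≈sgn : ∀ j → j < p → bin N j ≈ sgn j
    bin[p-1]≈sgn j j<p = ≈-trans (bin-negate j N 0 j<p (cong suc (ℕ.+-identityʳ N)))
      (≈-reflexive (trans (cong (λ k → sgn j * bin k j) (ℕ.+-identityʳ j)) (trans (cong (sgn j *_) (bin-diag j)) (*-identityʳ _))))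

    bin[p-1]²≈1 : ∀ j → j < p → sq (bin N j) ≈ 1#
    bin[p-1]²≈1 j j<p = ≈-trans (≈-* (int-bin N j) (int-sgn j) (bin[p-1]≈sgn j j<p) (bin[p-1]≈sgn j j<p)) (≈-reflexive (sgn-square j))

    -- A case of Lucas' theorem: passing from r to r + 1 multiplies the binomial coefficient by
    -- (r+1+p)/(r+1), which is 1 modulo p.
    bin-p≈1 : ∀ r → r < p → bin (r ℕ.+ p) p ≈ 1#
    bin-p≈1 zero    r<p = ≈-reflexive (bin-diag p)
    bin-p≈1 (suc r) r<p = ≈-cancel (p∤suc r<p) (begin
      ι (suc r) * bin (suc r ℕ.+ p) p
        ≡⟨ solve 3 (λ r p b → r :* b := (r :+ p :- p) :* b) refl _ (ι p) _ ⟩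
      (ι (suc r) + ι p - ι p) * bin (suc r ℕ.+ p) p
        ≡⟨ cong (λ x → (x - ι p) * bin (suc r ℕ.+ p) p) (ι-+ (suc r) p) ⟨
      (ι (suc r ℕ.+ p) - ι p) * bin (suc r ℕ.+ p) p
        ≡⟨ bin-step (suc r ℕ.+ p) p ⟨
      ι (suc p) * bin (suc (r ℕ.+ p)) (suc p)
        ≡⟨ bin-absorb (r ℕ.+ p) p ⟩
      ι (suc r ℕ.+ p) * bin (r ℕ.+ p) p
        ≡⟨ trans (cong (_* bin (r ℕ.+ p) p) (ι-+ (suc r) p)) (distribʳ _ _ _) ⟩
      ι (suc r) * bin (r ℕ.+ p) p + ι p * bin (r ℕ.+ p) p
        ≈⟨ ≈-+ (≈-*ˡ (int-ι (suc r)) (bin-p≈1 r (ℕ.<-trans (ℕ.n<1+n r) r<p))) (p*≈0 (int-bin (r ℕ.+ p) p)) ⟩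
      ι (suc r) * 1# + 0#
        ≡⟨ +-identityʳ _ ⟩
      ι (suc r) * 1# ∎)
      where open ≈-Reasoning

    private
      -- Trinomial revision extracts C(N,j+u), and Vandermonde sums the rest. Its lower index comes
      -- out as p for all j and u, so that `bin-p≈1` applies to it.
      Q-inner : ∀ j u → u ≤ j →
        ∑ (suc j) (λ t → bin N (j ℕ.+ t) * bin (j ℕ.+ t) (j ℕ.+ u) * bin (suc (j ℕ.+ j)) (suc (j ℕ.+ t)))
          ≡ bin N (j ℕ.+ u) * bin ((j ∸ u) ℕ.+ p) p
      Q-inner j u u≤j with ≤⊎> (j ℕ.+ u) N
      ... | inj₂ N<s = trans
          (∑-zero (suc j) (λ t _ → [ (λ { (d , j+t≡s+d) → trans (cong (λ x → x * bin (j ℕ.+ t) (j ℕ.+ u) * bin (suc (j ℕ.+ j)) (suc (j ℕ.+ t)))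
                (bin-large N (j ℕ.+ t) (ℕ.<-≤-trans N<s (subst (j ℕ.+ u ≤_) (sym j+t≡s+d) (ℕ.m≤m+n _ d)))))
                (solve 2 (λ x y → :ι 0 :* x :* y := :ι 0) refl _ _) })
            , (λ t<u → trans (cong (λ x → bin N (j ℕ.+ t) * x * bin (suc (j ℕ.+ j)) (suc (j ℕ.+ t))) (bin-large (j ℕ.+ t) (j ℕ.+ u) t<u))
                (solve 2 (λ x y → x :* :ι 0 :* y := :ι 0) refl _ _)) ]′ (≤⊎> (j ℕ.+ u) (j ℕ.+ t))))
          (sym (trans (cong (_* bin ((j ∸ u) ℕ.+ p) p) (bin-large N _ N<s)) (zeroˡ _)))
      ... | inj₁ (e , N≡s+e) = begin
          ∑ (suc j) g
            ≡⟨ cong (λ k → ∑ k g) (trans (cong suc (sym u+f)) (sym (ℕ.+-suc u f))) ⟩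
          ∑ (u ℕ.+ suc f) g
            ≡⟨ ∑-split u (suc f) g ⟩
          ∑ u g + ∑ (suc f) (λ w → g (u ℕ.+ w))
            ≡⟨ cong₂ _+_ (∑-zero u (λ t t<u → trans (cong (λ x → bin N (j ℕ.+ t) * x * bin (suc (j ℕ.+ j)) (suc (j ℕ.+ t)))
                   (bin-large (j ℕ.+ t) (j ℕ.+ u) (ℕ.+-monoʳ-< j t<u)))
                   (solve 2 (λ x y → x :* :ι 0 :* y := :ι 0) refl _ _)))
                 (trans (∑-cong (suc f) term) (∑-*ˡ (suc f) _ _)) ⟩
          0# + bin N r * ∑ (suc f) h
            -- The summand vanishes beyond `f` and also beyond `e`, so one range is exchanged for
            -- the other through a common extension.
            ≡⟨ trans (+-identityˡ _) (cong (bin N r *_) (trans (sym (∑-extend (suc f) (suc f ℕ.+ suc e) (ℕ.m≤m+n _ _) h-large))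
                 (∑-extend (suc e) (suc f ℕ.+ suc e) (ℕ.m≤n+m (suc e) (suc f)) (λ w e<w → trans (cong (_* bin (suc (j ℕ.+ j)) (suc r ℕ.+ w)) (bin-large e w e<w)) (zeroˡ _))))) ⟩
          bin N r * ∑ (suc e) h
            ≡⟨ cong (bin N r *_) (vandermonde e (suc (j ℕ.+ j)) (suc r)) ⟩
          bin N r * bin (e ℕ.+ suc (j ℕ.+ j)) (e ℕ.+ suc r)
            ≡⟨ cong₂ (λ m k → bin N r * bin m k) e+2j+1 e+s+1 ⟩
          bin N r * bin (f ℕ.+ p) p ∎
        where
        open ≡-Reasoning
        f = j ∸ u
        r = j ℕ.+ u
        u+f : u ℕ.+ f ≡ j
        u+f = ℕ.m+[n∸m]≡n u≤j
        g h : ℕ → K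
        g t = bin N (j ℕ.+ t) * bin (j ℕ.+ t) (j ℕ.+ u) * bin (suc (j ℕ.+ j)) (suc (j ℕ.+ t))
        h w = bin e w * bin (suc (j ℕ.+ j)) (suc r ℕ.+ w)
        e+s+1 : e ℕ.+ suc r ≡ p
        e+s+1 = trans (ℕ.+-suc e r) (cong suc (trans (ℕ.+-comm e r) (sym N≡s+e)))
        e+2j+1 : e ℕ.+ suc (j ℕ.+ j) ≡ f ℕ.+ p
        e+2j+1 = trans (cong (λ k → e ℕ.+ suc (j ℕ.+ k)) (sym u+f)) (trans (cong (λ k → e ℕ.+ suc k) (sym (ℕ.+-assoc j u f)))
          (trans (sym (ℕ.+-assoc e (suc r) f)) (trans (ℕ.+-comm _ f) (cong (f ℕ.+_) e+s+1))))
        h-large : ∀ w → f < w → h w ≡ 0#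
        h-large w f<w = trans (cong (bin e w *_) (bin-large _ _ (s≤s (subst (λ k → j ℕ.+ k < r ℕ.+ w) u+f
          (subst (_< r ℕ.+ w) (ℕ.+-assoc j u f) (ℕ.+-monoʳ-< r f<w)))))) (zeroʳ _)
        term : ∀ w → g (u ℕ.+ w) ≡ bin N r * h w
        term w = begin
          bin N (j ℕ.+ (u ℕ.+ w)) * bin (j ℕ.+ (u ℕ.+ w)) r * bin (suc (j ℕ.+ j)) (suc (j ℕ.+ (u ℕ.+ w)))
            ≡⟨ cong (λ k → bin N k * bin k r * bin (suc (j ℕ.+ j)) (suc k)) (sym (ℕ.+-assoc j u w)) ⟩
          bin N (r ℕ.+ w) * bin (r ℕ.+ w) r * bin (suc (j ℕ.+ j)) (suc r ℕ.+ w)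
            ≡⟨ cong (_* bin (suc (j ℕ.+ j)) (suc r ℕ.+ w)) (subst (λ n → bin n (r ℕ.+ w) * bin (r ℕ.+ w) r ≡ bin n r * bin e w) (sym N≡s+e) (bin-trinomial r e w)) ⟩
          bin N r * bin e w * bin (suc (j ℕ.+ j)) (suc r ℕ.+ w)
            ≡⟨ *-assoc _ _ _ ⟩
          bin N r * h w ∎

    Q-expand : ∀ j → Q N j ≡ ∑ (suc j) (λ u → bin N (j ℕ.+ u) * bin (j ℕ.+ u) j * bin j u * bin ((j ∸ u) ℕ.+ p) p)
    Q-expand j = begin
      Q N j
        ≡⟨ ∑-cong (suc j) (λ t → trans (cong (bin N (j ℕ.+ t) * bin (suc (j ℕ.+ j)) (suc (j ℕ.+ t)) *_) (bin-square (j ℕ.+ t) j)) (sym (∑-*ˡ (suc j) _ _))) ⟩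
      ∑ (suc j) (λ t → ∑ (suc j) (λ u → bin N (j ℕ.+ t) * bin (suc (j ℕ.+ j)) (suc (j ℕ.+ t)) * (bin (j ℕ.+ t) (j ℕ.+ u) * bin (j ℕ.+ u) j * bin j u)))
        ≡⟨ ∑-swap (suc j) (suc j) _ ⟩
      ∑ (suc j) (λ u → ∑ (suc j) (λ t → bin N (j ℕ.+ t) * bin (suc (j ℕ.+ j)) (suc (j ℕ.+ t)) * (bin (j ℕ.+ t) (j ℕ.+ u) * bin (j ℕ.+ u) j * bin j u)))
        ≡⟨ ∑-cong< (suc j) (λ { u (s≤s u≤j) → trans (∑-cong (suc j) (λ t →
             solve 5 (λ a b c d e → a :* b :* (c :* d :* e) := d :* e :* (a :* c :* b)) refl _ _ _ _ _)) (trans (∑-*ˡ (suc j) _ _)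
             (trans (cong (bin (j ℕ.+ u) j * bin j u *_) (Q-inner j u u≤j)) (solve 4 (λ a b c d → a :* b :* (c :* d) := c :* a :* b :* d) refl _ _ _ _))) }) ⟩
      ∑ (suc j) (λ u → bin N (j ℕ.+ u) * bin (j ℕ.+ u) j * bin j u * bin ((j ∸ u) ℕ.+ p) p) ∎
      where open ≡-Reasoning

    int-Q : ∀ j → Integral (Q N j)
    int-Q j = int-∑ (suc j) (λ t _ → int-* (int-* (int-bin _ _) (int-bin _ _)) (int-* (int-bin _ _) (int-bin _ _)))

    -- Once the factors C(p+j-u,p) are replaced by 1, the remaining sum is the expansion of
    -- C(p-1,j)² read backwards.
    Q≈1 : ∀ j → j < p → Q N j ≈ 1#
    Q≈1 j j<p = begin
      Q N j
        ≡⟨ Q-expand j ⟩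
      ∑ (suc j) (λ u → bin N (j ℕ.+ u) * bin (j ℕ.+ u) j * bin j u * bin ((j ∸ u) ℕ.+ p) p)
        ≈⟨ ≈-∑ (suc j) (λ u _ → ≈-*ˡ (int-* (int-* (int-bin _ _) (int-bin _ _)) (int-bin _ _)) (bin-p≈1 (j ∸ u) (ℕ.≤-<-trans (ℕ.m∸n≤m j u) j<p))) ⟩
      ∑ (suc j) (λ u → bin N (j ℕ.+ u) * bin (j ℕ.+ u) j * bin j u * 1#)
        ≡⟨ ∑-cong (suc j) (λ u → *-identityʳ _) ⟩
      ∑ (suc j) (λ u → bin N (j ℕ.+ u) * bin (j ℕ.+ u) j * bin j u)
        ≡⟨ bin-square N j ⟨
      sq (bin N j)
        ≈⟨ bin[p-1]²≈1 j j<p ⟩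
      1# ∎
      where open ≈-Reasoning

  -- Power sums with exponent p - 3

  *-^ : ∀ x y n → (x * y) ^ n ≡ x ^ n * y ^ n
  *-^ x y zero    = sym (*-identityˡ 1#)
  *-^ x y (suc n) = trans (cong (x * y *_) (*-^ x y n)) (solve 4 (λ a b c d → a :* b :* (c :* d) := a :* c :* (b :* d)) refl _ _ _ _)

  neg-^ : ∀ x n → (- x) ^ n ≡ sgn n * x ^ n
  neg-^ x zero    = sym (*-identityˡ 1#)
  neg-^ x (suc n) = trans (cong (- x *_) (neg-^ x n)) (solve 3 (λ x s y → :- x :* (s :* y) := :- s :* (x :* y)) refl _ _ _)

  0^n≡0 : ∀ n → 0 < n → 0# ^ n ≡ 0#
  0^n≡0 (suc n) _ = zeroˡ _

  v-6+ : ∀ i → v (6 ℕ.+ i) ≡ v i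
  v-6+ i = solve 2 (λ a b → let c = a :- b ; d = c :- a ; e = d :- c ; f = e :- d in f :- e := b) refl (v (suc i)) (v i)

  v-periodic : ∀ t i → v (t ℕ.+ i ℕ.* 6) ≡ v t
  v-periodic t zero    = cong v (ℕ.+-identityʳ t)
  v-periodic t (suc i) = trans (cong v (+-*-Solver.solve 2 (λ t x → t N.:+ (N.con 6 N.:+ x) N.:= N.con 6 N.:+ (t N.:+ x)) refl t (i ℕ.* 6)))
    (trans (v-6+ (t ℕ.+ i ℕ.* 6)) (v-periodic t i))
    where module N = +-*-Solver

  ∑-*6 : ∀ m (w : ℕ → K) → let col = λ t → ∑ m (λ i → w (t ℕ.+ i ℕ.* 6)) in
    ∑ (m ℕ.* 6) w ≡ col 0 + col 1 + col 2 + col 3 + col 4 + col 5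
  ∑-*6 zero    w = solve 0 (:ι 0 := :ι 0 :+ :ι 0 :+ :ι 0 :+ :ι 0 :+ :ι 0 :+ :ι 0) refl
  ∑-*6 (suc m) w = trans (cong (λ x → x + w (m ℕ.* 6) + w (1 ℕ.+ m ℕ.* 6) + w (2 ℕ.+ m ℕ.* 6) + w (3 ℕ.+ m ℕ.* 6) + w (4 ℕ.+ m ℕ.* 6) + w (5 ℕ.+ m ℕ.* 6)) (∑-*6 m w))
    (solve 12 (λ a b c d e f a′ b′ c′ d′ e′ f′ → a :+ b :+ c :+ d :+ e :+ f :+ a′ :+ b′ :+ c′ :+ d′ :+ e′ :+ f′
      := (a :+ a′) :+ (b :+ b′) :+ (c :+ c′) :+ (d :+ d′) :+ (e :+ e′) :+ (f :+ f′)) refl _ _ _ _ _ _ _ _ _ _ _ _)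

  -- n is p − 3, so that φ i = i^n is congruent to 1/i² and extends it to i = 0.
  module PowerSums (N n : ℕ) (p-prime : Prime (suc N)) (3<p : 3 < suc N) (N≡2+n : N ≡ 2 ℕ.+ n) (sgn-n : sgn n ≡ 1#) where
    private
      p : ℕ
      p = suc N
    open Localisation N p-prime public
    open ≈-Reasoning

    0<n : 0 < n
    0<n = ℕ.s≤s⁻¹ (ℕ.s≤s⁻¹ (subst (2 <_) N≡2+n (ℕ.s≤s⁻¹ 3<p)))

    p∤2 : p ∤ 2
    p∤2 = p∤suc (ℕ.<-trans (ℕ.n<1+n 2) 3<p)
    p∤3 : p ∤ 3
    p∤3 = p∤suc 3<p
    p∤6 : p ∤ 6
    p∤6 = p∤* {2} {3} p∤2 p∤3

    bin-p≈0 : ∀ k → k < N → bin p (suc k) ≈ 0#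
    bin-p≈0 k k<N = ≈-cancel (p∤suc (s≤s k<N)) (begin
      ι (suc k) * bin p (suc k)   ≡⟨ bin-absorb N k ⟩
      ι p * bin N k               ≈⟨ p*≈0 (int-bin N k) ⟩
      0#                          ≡⟨ zeroʳ _ ⟨
      ι (suc k) * 0#              ∎)

    fermat : ∀ a → ι a ^ p ≈ ι a
    fermat zero    = ≈-reflexive (zeroˡ _)
    fermat (suc a) = begin
      ι (suc a) ^ p
        ≡⟨ cong (_^ p) (trans (ι-suc a) (+-comm _ _)) ⟩
      (ι a + 1#) ^ p
        ≡⟨ trans (binomial-theorem (ι a) p) (∑-head p _) ⟩
      bin p 0 * ι a ^ p + (∑ N (λ k → bin p (suc k) * ι a ^ (p ∸ suc k)) + bin p p * ι a ^ (p ∸ p))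
        ≈⟨ ≈-+ (≈-reflexive (trans (cong (_* ι a ^ p) (bin-zero p)) (*-identityˡ _)))
             (≈-+ (≈-∑0 N (λ k k<N → ≈-trans (≈-*ʳ (int-^ (p ∸ suc k) (int-ι a)) (bin-p≈0 k k<N)) (≈-reflexive (zeroˡ _))))
               (≈-reflexive (cong₂ (λ x m → x * ι a ^ m) (bin-diag p) (ℕ.n∸n≡0 p)))) ⟩
      ι a ^ p + (0# + 1# * 1#)
        ≈⟨ ≈-+ (fermat a) ≈-refl ⟩
      ι a + (0# + 1# * 1#)
        ≡⟨ solve 1 (λ x → x :+ (:ι 0 :+ :ι 1 :* :ι 1) := :ι 1 :+ x) refl _ ⟩
      1# + ι a
        ≡⟨ ι-suc a ⟨
      ι (suc a) ∎

    φ : ℕ → K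
    φ i = ι i ^ n

    int-φ : ∀ i → Integral (φ i)
    int-φ i = int-^ n (int-ι i)

    φ-zero : φ 0 ≡ 0#
    φ-zero = 0^n≡0 n 0<n

    φ-inverse : ∀ i → p ∤ suc i → sq (ι (suc i)) * φ (suc i) ≈ 1#
    φ-inverse i p∤i = ≈-cancel p∤i (begin
      ι (suc i) * (sq (ι (suc i)) * φ (suc i))
        ≡⟨ solve 2 (λ a x → a :* (a :* a :* x) := a :* (a :* (a :* x))) refl _ _ ⟩
      ι (suc i) ^ (3 ℕ.+ n)
        ≡⟨ cong (λ m → ι (suc i) ^ suc m) N≡2+n ⟨
      ι (suc i) ^ p
        ≈⟨ fermat (suc i) ⟩
      ι (suc i)
        ≡⟨ *-identityʳ _ ⟨
      ι (suc i) * 1# ∎)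

    φ≈⅟² : ∀ {i} → i < N → φ (suc i) ≈ ⅟suc i * ⅟suc i
    φ≈⅟² {i} i<N = begin
      φ (suc i)
        ≡⟨ trans (*-identityˡ _) (*-identityˡ _) ⟨
      1# * (1# * φ (suc i))
        ≡⟨ cong (λ u → u * (u * φ (suc i))) (⅟suc-inverse i) ⟨
      ι (suc i) * ⅟suc i * (ι (suc i) * ⅟suc i * φ (suc i))
        ≡⟨ solve 3 (λ a v x → a :* v :* (a :* v :* x) := v :* v :* (a :* a :* x)) refl _ _ _ ⟩
      ⅟suc i * ⅟suc i * (sq (ι (suc i)) * φ (suc i))
        ≈⟨ ≈-*ˡ (int-* int int) (φ-inverse i (p∤suc (s≤s i<N))) ⟩
      ⅟suc i * ⅟suc i * 1#
        ≡⟨ *-identityʳ _ ⟩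
      ⅟suc i * ⅟suc i ∎
      where int = int-⅟ (s≤s i<N)

    φ-cong : ∀ a b → ι a ≈ ι b → φ a ≈ φ b
    φ-cong a b = ≈-^ n (int-ι a) (int-ι b)

    φ-even : ∀ a b → ι a ≈ - ι b → φ a ≈ φ b
    φ-even a b eq = ≈-trans (≈-^ n (int-ι a) (int-neg (int-ι b)) eq) (≈-reflexive
      (trans (neg-^ (ι b) n) (trans (cong (_* φ b) sgn-n) (*-identityˡ _))))

    φ-*-cong : ∀ a b c → ι a ≈ ι b * ι c → φ a ≈ φ b * φ c
    φ-*-cong a b c eq = ≈-trans (φ-cong a (b ℕ.* c) (≈-trans eq (≈-reflexive (sym (ι-* b c)))))
      (≈-reflexive (trans (cong (_^ n) (ι-* b c)) (*-^ (ι b) (ι c) n)))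

    ι-p+ : ∀ i → ι (p ℕ.+ i) ≈ ι i
    ι-p+ i = ≈-trans (≈-reflexive (ι-+ p i)) (≈-trans (≈-+ p≈0 ≈-refl) (≈-reflexive (+-identityˡ _)))

    ι-*p : ∀ k → ι (k ℕ.* p) ≈ 0#
    ι-*p k = ≈-trans (≈-reflexive (trans (ι-* k p) (*-comm _ _))) (p*≈0 (int-ι k))

    φ-p : φ p ≈ 0#
    φ-p = ≈-trans (φ-cong p 0 p≈0) (≈-reflexive φ-zero)

    Φ : ℕ → K
    Φ m = ∑ m φ

    int-Φ : ∀ m → Integral (Φ m)
    int-Φ m = int-∑ m (λ i _ → int-φ i)

    Φ-p+ : ∀ m → Φ (p ℕ.+ m) ≈ Φ p + Φ m
    Φ-p+ m = ≈-trans (≈-reflexive (∑-split p m φ)) (≈-+ ≈-refl (≈-∑ m (λ i _ → φ-cong (p ℕ.+ i) i (ι-p+ i))))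

    Φ-shift : ∀ a m → ∑ m (λ i → φ (a ℕ.+ i)) ≡ Φ (a ℕ.+ m) - Φ a
    Φ-shift a m = trans (solve 2 (λ x y → y := x :+ y :- x) refl (Φ a) _) (cong (_- Φ a) (sym (∑-split a m φ)))

    Φ-1+*p : ∀ k → Φ (1 ℕ.+ k ℕ.* p) ≈ ι k * Φ p
    Φ-1+*p zero    = ≈-reflexive (trans (cong (0# +_) φ-zero) (trans (+-identityˡ _) (sym (zeroˡ _))))
    Φ-1+*p (suc k) = begin
      Φ (1 ℕ.+ (p ℕ.+ k ℕ.* p))     ≡⟨ cong Φ (ℕ.+-suc p (k ℕ.* p)) ⟨
      Φ (p ℕ.+ (1 ℕ.+ k ℕ.* p))     ≈⟨ Φ-p+ (1 ℕ.+ k ℕ.* p) ⟩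
      Φ p + Φ (1 ℕ.+ k ℕ.* p)       ≈⟨ ≈-+ ≈-refl (Φ-1+*p k) ⟩
      Φ p + ι k * Φ p               ≡⟨ solve 2 (λ x k → x :+ k :* x := (:ι 1 :+ k) :* x) refl _ _ ⟩
      (1# + ι k) * Φ p              ≡⟨ cong (_* Φ p) (ι-suc k) ⟨
      ι (suc k) * Φ p               ∎

    -- The indices a + i and b - 1 - i add up to k p, and `φ` is even. As a + b ≡ 1, this is the
    -- reflection x ↦ 1 - x.
    Φ-reflect : ∀ k a b → a ℕ.+ b ≡ 1 ℕ.+ k ℕ.* p → Φ a + Φ b ≈ ι k * Φ p
    Φ-reflect k a b a+b = begin
      Φ a + Φ b                              ≈⟨ ≈-+ ≈-refl (reflected b a+b) ⟨
      Φ a + ∑ b (λ i → φ (a ℕ.+ i))          ≡⟨ ∑-split a b φ ⟨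
      Φ (a ℕ.+ b)                            ≡⟨ cong Φ a+b ⟩
      Φ (1 ℕ.+ k ℕ.* p)                      ≈⟨ Φ-1+*p k ⟩
      ι k * Φ p                              ∎
      where
      reflected : ∀ b → a ℕ.+ b ≡ 1 ℕ.+ k ℕ.* p → ∑ b (λ i → φ (a ℕ.+ i)) ≈ Φ b
      reflected zero    _  = ≈-refl
      reflected (suc b) eq = ≈-trans (≈-∑ (suc b) (λ { i (s≤s i≤b) → φ-even (a ℕ.+ i) (b ∸ i) (begin
        ι (a ℕ.+ i)
          ≡⟨ solve 2 (λ x y → x := x :+ y :- y) refl _ (ι (b ∸ i)) ⟩
        ι (a ℕ.+ i) + ι (b ∸ i) - ι (b ∸ i)
          ≡⟨ cong (_- ι (b ∸ i)) (trans (sym (ι-+ (a ℕ.+ i) (b ∸ i))) (cong ι (trans (ℕ.+-assoc a i (b ∸ i))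
               (trans (cong (a ℕ.+_) (ℕ.m+[n∸m]≡n i≤b)) (ℕ.suc-injective (trans (sym (ℕ.+-suc a b)) eq)))))) ⟩
        ι (k ℕ.* p) - ι (b ∸ i)
          ≈⟨ ≈-- (ι-*p k) ≈-refl ⟩
        0# - ι (b ∸ i)
          ≡⟨ +-identityˡ _ ⟩
        - ι (b ∸ i) ∎) })) (≈-reflexive (sym (∑-reverse b φ)))

    -- Here e is 1/2 modulo p. Even indices 2i contribute φ(2) φ(i), odd ones 2i + 1 ≡ 2 (e + i)
    -- contribute φ(2) φ(e + i): the duplication formula.
    Φ-double : ∀ k e m → e ℕ.+ e ≡ 1 ℕ.+ k ℕ.* p → Φ (m ℕ.+ m) ≈ φ 2 * (Φ m + (Φ (e ℕ.+ m) - Φ e))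
    Φ-double k e m e+e≡ = ≈-trans (go m) (≈-reflexive (cong (λ x → φ 2 * (Φ m + x)) (Φ-shift e m)))
      where
      e+e≈1 : ι e + ι e ≈ 1#
      e+e≈1 = begin
        ι e + ι e           ≡⟨ trans (sym (ι-+ e e)) (trans (cong ι e+e≡) (ι-suc (k ℕ.* p))) ⟩
        1# + ι (k ℕ.* p)    ≈⟨ ≈-+ ≈-refl (ι-*p k) ⟩
        1# + 0#             ≡⟨ +-identityʳ _ ⟩
        1#                  ∎
      go : ∀ m → Φ (m ℕ.+ m) ≈ φ 2 * (Φ m + ∑ m (λ i → φ (e ℕ.+ i)))
      go zero    = ≈-reflexive (solve 1 (λ x → :ι 0 := x :* (:ι 0 :+ :ι 0)) refl _)
      go (suc m) = begin
        Φ (suc m ℕ.+ suc m)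
          ≡⟨ cong (Φ ∘ suc) (ℕ.+-suc m m) ⟩
        Φ (m ℕ.+ m) + φ (m ℕ.+ m) + φ (suc (m ℕ.+ m))
          ≈⟨ ≈-+ (≈-+ (go m) (φ-*-cong (m ℕ.+ m) 2 m (≈-reflexive (trans (ι-+ m m) (solve 1 (λ x → x :+ x := :ι 2 :* x) refl _)))))
               (φ-*-cong (suc (m ℕ.+ m)) 2 (e ℕ.+ m) odd) ⟩
        φ 2 * (Φ m + ∑ m (λ i → φ (e ℕ.+ i))) + φ 2 * φ m + φ 2 * φ (e ℕ.+ m)
          ≡⟨ solve 5 (λ t a b c d → t :* (a :+ b) :+ t :* c :+ t :* d := t :* (a :+ c :+ (b :+ d))) refl _ _ _ _ _ ⟩
        φ 2 * (Φ m + φ m + (∑ m (λ i → φ (e ℕ.+ i)) + φ (e ℕ.+ m))) ∎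
        where
        odd : ι (suc (m ℕ.+ m)) ≈ ι 2 * ι (e ℕ.+ m)
        odd = begin
          ι (suc (m ℕ.+ m))          ≡⟨ trans (ι-suc (m ℕ.+ m)) (cong (1# +_) (ι-+ m m)) ⟩
          1# + (ι m + ι m)           ≈⟨ ≈-+ e+e≈1 ≈-refl ⟨
          ι e + ι e + (ι m + ι m)    ≡⟨ solve 2 (λ e m → e :+ e :+ (m :+ m) := :ι 2 :* (e :+ m)) refl _ _ ⟩
          ι 2 * (ι e + ι m)          ≡⟨ cong (ι 2 *_) (ι-+ e m) ⟨
          ι 2 * ι (e ℕ.+ m)          ∎

    φ2*4≈1 : ι 4 * φ 2 ≈ 1#
    φ2*4≈1 = ≈-trans (≈-reflexive (cong (_* φ 2) (ι-* 2 2))) (φ-inverse 1 p∤2)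

    φ6*36≈1 : ι 36 * φ 6 ≈ 1#
    φ6*36≈1 = ≈-trans (≈-reflexive (cong (_* φ 6) (ι-* 6 6))) (φ-inverse 5 p∤6)

    int-v : ∀ t → Integral (v t)
    int-v zero          = int-ι 2
    int-v (suc zero)    = int-ι 1
    int-v (suc (suc t)) = int-- (int-v (suc t)) (int-v t)

    -- h represents 1/6 modulo p, hence f s is the power sum up to s/6.
    module AtSixths (h k : ℕ) (h*6≡ : 6 ℕ.* h ≡ 1 ℕ.+ k ℕ.* p) where
      -- Duplication over a full period gives 2 Φ(p) ≡ φ(2) · 2 Φ(p). As φ(2) ≡ 1/4, multiplying by
      -- 4 leaves 6 Φ(p) ≡ 0.
      Φp≈0 : Φ p ≈ 0#
      Φp≈0 = ≈-cancel p∤6 (begin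
        ι 6 * Φ p
          ≡⟨ solve 1 (λ x → :ι 6 :* x := :ι 4 :* (x :+ x) :- :ι 2 :* x) refl _ ⟩
        ι 4 * (Φ p + Φ p) - ι 2 * Φ p
          ≈⟨ ≈-- (≈-*ˡ (int-ι 4) (≈-trans (≈-sym (Φ-p+ p)) (≈-trans (Φ-double k e p e+e≡) (≈-*ˡ (int-φ 2) (≈-+ ≈-refl
               (≈-- (≈-trans (≈-reflexive (cong Φ (ℕ.+-comm e p))) (Φ-p+ e)) ≈-refl)))))) ≈-refl ⟩
        ι 4 * (φ 2 * (Φ p + (Φ p + Φ e - Φ e))) - ι 2 * Φ p
          ≡⟨ solve 3 (λ f x y → :ι 4 :* (f :* (x :+ (x :+ y :- y))) :- :ι 2 :* x := (:ι 4 :* f) :* (:ι 2 :* x) :- :ι 2 :* x) refl _ _ _ ⟩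
        ι 4 * φ 2 * (ι 2 * Φ p) - ι 2 * Φ p
          ≈⟨ ≈-- (≈-*ʳ (int-* (int-ι 2) (int-Φ p)) φ2*4≈1) ≈-refl ⟩
        1# * (ι 2 * Φ p) - ι 2 * Φ p
          ≡⟨ solve 1 (λ x → :ι 1 :* (:ι 2 :* x) :- :ι 2 :* x := :ι 6 :* :ι 0) refl _ ⟩
        ι 6 * 0# ∎)
        where
        e = 3 ℕ.* h
        e+e≡ : e ℕ.+ e ≡ 1 ℕ.+ k ℕ.* p
        e+e≡ = trans (sym (ℕ.*-distribʳ-+ h 3 3)) h*6≡

      f : ℕ → K
      f s = Φ (s ℕ.* h)

      -- The ratios f(s)/f(2). Reflection makes them antisymmetric about s = 3, and duplication
      -- gives 4 f(2) ≡ f(1) + f(4) - f(3) ≡ f(1) - f(2), hence the 5.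
      coeff : ℕ → K
      coeff 1 = ι 5
      coeff 2 = 1#
      coeff 4 = - 1#
      coeff 5 = - ι 5
      coeff _ = 0#

      f-reflect : ∀ s t → s ℕ.+ t ≡ 6 → f s ≈ - f t
      f-reflect s t s+t = begin
        f s                ≡⟨ solve 2 (λ x y → x := x :+ y :- y) refl _ _ ⟩
        f s + f t - f t    ≈⟨ ≈-- (≈-trans (Φ-reflect k (s ℕ.* h) (t ℕ.* h)
                                (trans (sym (ℕ.*-distribʳ-+ h s t)) (trans (cong (ℕ._* h) s+t) h*6≡)))
                                (≈-trans (≈-*ˡ (int-ι k) Φp≈0) (≈-reflexive (zeroʳ _)))) ≈-refl ⟩
        0# - f t           ≡⟨ +-identityˡ _ ⟩
        - f t              ∎

      f3≈0 : f 3 ≈ 0#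
      f3≈0 = ≈-cancel p∤2 (begin
        ι 2 * f 3       ≡⟨ solve 1 (λ x → :ι 2 :* x := x :+ x) refl _ ⟩
        f 3 + f 3       ≈⟨ ≈-+ ≈-refl (f-reflect 3 3 refl) ⟩
        f 3 + - f 3     ≡⟨ solve 1 (λ x → x :- x := :ι 2 :* :ι 0) refl _ ⟩
        ι 2 * 0#        ∎)

      f1≈5*f2 : f 1 ≈ ι 5 * f 2
      f1≈5*f2 = begin
        f 1
          ≡⟨ solve 2 (λ x y → x := :ι 1 :* (x :+ (:- y :- :ι 0)) :+ y) refl _ _ ⟩
        1# * (f 1 + (- f 2 - 0#)) + f 2
          ≈⟨ ≈-+ (≈-* (int-ι 1) int (≈-sym φ2*4≈1) (≈-+ ≈-refl (≈-- (≈-sym (f-reflect 4 2 refl)) (≈-sym f3≈0)))) ≈-refl ⟩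
        ι 4 * φ 2 * (f 1 + (f 4 - f 3)) + f 2
          ≡⟨ cong (_+ f 2) (*-assoc _ _ _) ⟩
        ι 4 * (φ 2 * (f 1 + (f 4 - f 3))) + f 2
          ≈⟨ ≈-+ (≈-*ˡ (int-ι 4) double) ≈-refl ⟨
        ι 4 * f 2 + f 2
          ≡⟨ solve 1 (λ x → :ι 4 :* x :+ x := :ι 5 :* x) refl _ ⟩
        ι 5 * f 2 ∎
        where
        int : Integral (f 1 + (f 4 - f 3))
        int = int-+ (int-Φ (1 ℕ.* h)) (int-- (int-Φ (4 ℕ.* h)) (int-Φ (3 ℕ.* h)))
        double : f 2 ≈ φ 2 * (f 1 + (f 4 - f 3))
        double = ≈-trans (≈-reflexive (cong Φ (ℕ.*-distribʳ-+ h 1 1)))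
          (≈-trans (Φ-double k (3 ℕ.* h) (1 ℕ.* h) (trans (sym (ℕ.*-distribʳ-+ h 3 3)) h*6≡))
            (≈-reflexive (cong (λ m → φ 2 * (f 1 + (Φ m - f 3))) (sym (ℕ.*-distribʳ-+ h 3 1)))))

      f≈coeff : ∀ s → s ≤ 6 → f s ≈ coeff s * f 2
      f≈coeff 0 _ = ≈-reflexive (sym (zeroˡ _))
      f≈coeff 1 _ = f1≈5*f2
      f≈coeff 2 _ = ≈-reflexive (sym (*-identityˡ _))
      f≈coeff 3 _ = ≈-trans f3≈0 (≈-reflexive (sym (zeroˡ _)))
      f≈coeff 4 _ = ≈-trans (f-reflect 4 2 refl) (≈-reflexive (solve 1 (λ x → :- x := :- (:ι 1) :* x) refl _))
      f≈coeff 5 _ = ≈-trans (f-reflect 5 1 refl) (≈-trans (≈-neg f1≈5*f2) (≈-reflexive (solve 1 (λ x → :- (:ι 5 :* x) := :- (:ι 5) :* x) refl _)))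
      f≈coeff 6 _ = ≈-trans (f-reflect 6 0 refl) (≈-reflexive (solve 1 (λ x → :- (:ι 0) := :ι 0 :* x) refl _))
      f≈coeff (suc (suc (suc (suc (suc (suc (suc s))))))) (s≤s (s≤s (s≤s (s≤s (s≤s (s≤s ()))))))

      -- On indices congruent to t modulo 6 the factor v is constant, and t + 6i ≡ 6 (t h + i) turns
      -- the column into consecutive values of `φ`.
      column : ∀ t m → ∑ m (λ i → v (t ℕ.+ i ℕ.* 6) * φ (t ℕ.+ i ℕ.* 6)) ≈ φ 6 * (v t * (Φ (t ℕ.* h ℕ.+ m) - f t))
      column t m = begin
        ∑ m (λ i → v (t ℕ.+ i ℕ.* 6) * φ (t ℕ.+ i ℕ.* 6))
          ≈⟨ ≈-∑ m (λ i _ → ≈-trans (≈-reflexive (cong (_* φ (t ℕ.+ i ℕ.* 6)) (v-periodic t i)))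
               (≈-trans (≈-*ˡ (int-v t) (φ-*-cong (t ℕ.+ i ℕ.* 6) 6 (t ℕ.* h ℕ.+ i) (index i)))
                 (≈-reflexive (solve 3 (λ v x y → v :* (x :* y) := x :* v :* y) refl _ _ _)))) ⟩
        ∑ m (λ i → φ 6 * v t * φ (t ℕ.* h ℕ.+ i))
          ≡⟨ trans (∑-*ˡ m _ _) (trans (*-assoc _ _ _) (cong (λ x → φ 6 * (v t * x)) (Φ-shift (t ℕ.* h) m))) ⟩
        φ 6 * (v t * (Φ (t ℕ.* h ℕ.+ m) - f t)) ∎
        where
        index : ∀ i → ι (t ℕ.+ i ℕ.* 6) ≈ ι 6 * ι (t ℕ.* h ℕ.+ i)
        index i = begin
          ι (t ℕ.+ i ℕ.* 6)
            ≡⟨ trans (ι-+ t (i ℕ.* 6)) (cong₂ _+_ (sym (*-identityʳ _)) (ι-* i 6)) ⟩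
          ι t * 1# + ι i * ι 6
            ≈⟨ ≈-+ (≈-*ˡ (int-ι t) (≈-sym h*6≈1)) ≈-refl ⟩
          ι t * (ι 6 * ι h) + ι i * ι 6
            ≡⟨ solve 4 (λ t s h i → t :* (s :* h) :+ i :* s := s :* (t :* h :+ i)) refl _ _ _ _ ⟩
          ι 6 * (ι t * ι h + ι i)
            ≡⟨ cong (ι 6 *_) (trans (ι-+ (t ℕ.* h) i) (cong (_+ ι i) (ι-* t h))) ⟨
          ι 6 * ι (t ℕ.* h ℕ.+ i) ∎
          where
          h*6≈1 : ι 6 * ι h ≈ 1#
          h*6≈1 = begin
            ι 6 * ι h             ≡⟨ trans (sym (ι-* 6 h)) (trans (cong ι h*6≡) (ι-suc (k ℕ.* p))) ⟩
            1# + ι (k ℕ.* p)      ≈⟨ ≈-+ ≈-refl (ι-*p k) ⟩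
            1# + 0#               ≡⟨ +-identityʳ _ ⟩
            1#                    ∎

      column-value : ∀ t m s → t ≤ 6 → s ≤ 6 → Φ (t ℕ.* h ℕ.+ m) ≈ f s →
        ∑ m (λ i → v (t ℕ.+ i ℕ.* 6) * φ (t ℕ.+ i ℕ.* 6)) ≈ φ 6 * (v t * (coeff s * f 2 - coeff t * f 2))
      column-value t m s t≤6 s≤6 eq = ≈-trans (column t m) (≈-*ˡ (int-φ 6) (≈-*ˡ (int-v t) (≈-- (≈-trans eq (f≈coeff s s≤6)) (f≈coeff t t≤6))))

  -- χ is the Legendre symbol (p/3), and h represents 1/6 modulo p.
  data Residue (p h : ℕ) (χ : K) : Set where
    one  : ∀ q → p ≡ 1 ℕ.+ q ℕ.* 6 → h ≡ 1 ℕ.+ q ℕ.* 5 → χ ≡ 1# → Residue p h χ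
    five : ∀ q → p ≡ 5 ℕ.+ q ℕ.* 6 → h ≡ 1 ℕ.+ q → χ ≡ - 1# → Residue p h χ

  sgn-*6 : ∀ q → sgn (q ℕ.* 6) ≡ 1#
  sgn-*6 zero    = refl
  sgn-*6 (suc q) = trans (solve 1 (λ x → :- (:- (:- (:- (:- (:- x))))) := x) refl _) (sgn-*6 q)

  sgn-residue : ∀ {p h χ} → Residue p h χ → sgn p ≡ - 1#
  sgn-residue (one q p≡ _ _)  = trans (cong sgn p≡) (cong -_ (sgn-*6 q))
  sgn-residue (five q p≡ _ _) = trans (cong sgn p≡) (trans (cong (λ x → - - - - - x) (sgn-*6 q))
    (solve 1 (λ x → :- (:- (:- (:- (:- x)))) := :- x) refl _))

  v-residue : ∀ {p h χ} → Residue p h χ → v p ≡ 1#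
  v-residue (one q p≡ _ _)  = trans (cong v p≡) (v-periodic 1 q)
  v-residue (five q p≡ _ _) = trans (cong v p≡) (trans (v-periodic 5 q)
    (solve 0 (let v₂ = :ι 1 :- :ι 2 ; v₃ = v₂ :- :ι 1 ; v₄ = v₃ :- v₂ in v₄ :- v₃ := :ι 1) refl))

  private
    module N = +-*-Solver

  sixth : ∀ {p h χ} → Residue p h χ → ∃ λ k → 6 ℕ.* h ≡ 1 ℕ.+ k ℕ.* p
  sixth (one q p≡ h≡ _)  = 5 , trans (cong (6 ℕ.*_) h≡) (trans
    (N.solve 1 (λ q → N.con 6 N.:* (N.con 1 N.:+ q N.:* N.con 5) N.:= N.con 1 N.:+ N.con 5 N.:* (N.con 1 N.:+ q N.:* N.con 6)) refl q)
    (cong (λ p → 1 ℕ.+ 5 ℕ.* p) (sym p≡)))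
  sixth (five q p≡ h≡ _) = 1 , trans (cong (6 ℕ.*_) h≡) (trans
    (N.solve 1 (λ q → N.con 6 N.:* (N.con 1 N.:+ q) N.:= N.con 1 N.:+ N.con 1 N.:* (N.con 5 N.:+ q N.:* N.con 6)) refl q)
    (cong (λ p → 1 ℕ.+ 1 ℕ.* p) (sym p≡)))

  -- Harmonic and central binomial sums modulo p

  module HarmonicSums (N n : ℕ) (p-prime : Prime (suc N)) (3<p : 3 < suc N) (N≡2+n : N ≡ 2 ℕ.+ n) (sgn-n : sgn n ≡ 1#) where
    private
      p : ℕ
      p = suc N
    open PowerSums N n p-prime 3<p N≡2+n sgn-n public
    open ≈-Reasoning

    module _ {h : ℕ} {χ : K} (residue : Residue p h χ) where
      open AtSixths h (proj₁ (sixth residue)) (proj₂ (sixth residue)) public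

      ∑1/i²≈0 : ∑1/i² N ≈ 0#
      ∑1/i²≈0 = begin
        ∑1/i² N                      ≈⟨ ≈-∑ N (λ i i<N → ≈-sym (φ≈⅟² i<N)) ⟩
        ∑ N (λ i → φ (suc i))        ≡⟨ trans (∑-head N φ) (trans (cong (_+ ∑ N (λ i → φ (suc i))) φ-zero) (+-identityˡ _)) ⟨
        Φ p                          ≈⟨ Φp≈0 ⟩
        0#                           ∎

      private
        vφ : ℕ → K
        vφ i = v i * φ i

        -- For p = 1 + 6q the columns t = 1, ..., 6 run from t/6 to (t-1)/6 modulo p; for p = 5 + 6q
        -- the columns t = 0, ..., 5 run from t/6 to (t+1)/6. The opposite directions account for
        -- the sign χ, and Σ v_t times the differences of `coeff` is -18 or 18.
        ∑vφ : Residue p h χ → ∑ N (λ i → vφ (suc i)) ≈ φ 6 * (- χ * (ι 18 * f 2))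
        ∑vφ (one q p≡ h≡ χ≡) = begin
          ∑ N (λ i → vφ (suc i))
            ≡⟨ trans (cong (λ m → ∑ m (λ i → vφ (suc i))) (ℕ.suc-injective p≡)) (∑-*6 q (λ i → vφ (suc i))) ⟩
          col 1 + col 2 + col 3 + col 4 + col 5 + col 6
            ≈⟨ ≈-+ (≈-+ (≈-+ (≈-+ (≈-+ (value 0 (s≤s z≤n)) (value 1 (s≤s (s≤s z≤n)))) (value 2 (s≤s (s≤s (s≤s z≤n)))))
                 (value 3 (s≤s (s≤s (s≤s (s≤s z≤n)))))) (value 4 (s≤s (s≤s (s≤s (s≤s (s≤s z≤n)))))))
                 (value 5 (s≤s (s≤s (s≤s (s≤s (s≤s (s≤s z≤n)))))))  ⟩
          val 1 + val 2 + val 3 + val 4 + val 5 + val 6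
            ≡⟨ solve 2 (λ y x → let v₂ = :ι 1 :- :ι 2 ; v₃ = v₂ :- :ι 1 ; v₄ = v₃ :- v₂ ; v₅ = v₄ :- v₃ ; v₆ = v₅ :- v₄ in
                 y :* (:ι 1 :* (:ι 0 :* x :- :ι 5 :* x)) :+ y :* (v₂ :* (:ι 5 :* x :- :ι 1 :* x)) :+ y :* (v₃ :* (:ι 1 :* x :- :ι 0 :* x))
                 :+ y :* (v₄ :* (:ι 0 :* x :- (:- (:ι 1)) :* x)) :+ y :* (v₅ :* ((:- (:ι 1)) :* x :- (:- (:ι 5)) :* x))
                 :+ y :* (v₆ :* ((:- (:ι 5)) :* x :- :ι 0 :* x))
                 := y :* (:- (:ι 1) :* (:ι 18 :* x))) refl (φ 6) (f 2) ⟩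
          φ 6 * (- 1# * (ι 18 * f 2))
            ≡⟨ cong (λ c → φ 6 * (- c * (ι 18 * f 2))) χ≡ ⟨
          φ 6 * (- χ * (ι 18 * f 2)) ∎
          where
          col val : ℕ → K
          col t = ∑ q (λ i → vφ (t ℕ.+ i ℕ.* 6))
          val t = φ 6 * (v t * (coeff (t ∸ 1) * f 2 - coeff t * f 2))
          value : ∀ t → suc t ≤ 6 → col (suc t) ≈ val (suc t)
          value t t<6 = column-value (suc t) q t t<6 (ℕ.<⇒≤ t<6) (≈-trans (≈-reflexive (cong Φ index))
            (≈-trans (Φ-p+ (t ℕ.* h)) (≈-trans (≈-+ Φp≈0 ≈-refl) (≈-reflexive (+-identityˡ _)))))
            where
            index : suc t ℕ.* h ℕ.+ q ≡ p ℕ.+ t ℕ.* h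
            index = trans (cong (λ x → x ℕ.+ t ℕ.* h ℕ.+ q) h≡) (trans
              (N.solve 2 (λ q y → N.con 1 N.:+ q N.:* N.con 5 N.:+ y N.:+ q N.:= N.con 1 N.:+ q N.:* N.con 6 N.:+ y) refl q (t ℕ.* h))
              (cong (ℕ._+ t ℕ.* h) (sym p≡)))
        ∑vφ (five q p≡ h≡ χ≡) = begin
          ∑ N (λ i → vφ (suc i))
            -- The terms at 0 and p, both zero modulo p, fill the range up to length p + 1 = 6 (q +
            -- 1).
            ≡⟨ solve 3 (λ a b c → b := (a :+ b :+ c) :- (a :+ c)) refl (vφ 0) _ (vφ p) ⟩
          (vφ 0 + ∑ N (λ i → vφ (suc i)) + vφ p) - (vφ 0 + vφ p)
            ≈⟨ ≈-- (≈-reflexive (trans (cong (_+ vφ p) (sym (∑-head N vφ))) (trans (cong (λ m → ∑ (suc m) vφ) p≡) (∑-*6 (suc q) vφ))))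
                 (≈-+ (≈-reflexive (cong (v 0 *_) φ-zero)) (≈-*ˡ (int-v p) φ-p)) ⟩
          col 0 + col 1 + col 2 + col 3 + col 4 + col 5 - (v 0 * 0# + v p * 0#)
            ≈⟨ ≈-- (≈-+ (≈-+ (≈-+ (≈-+ (≈-+ (value 0 (s≤s z≤n)) (value 1 (s≤s (s≤s z≤n)))) (value 2 (s≤s (s≤s (s≤s z≤n)))))
                 (value 3 (s≤s (s≤s (s≤s (s≤s z≤n)))))) (value 4 (s≤s (s≤s (s≤s (s≤s (s≤s z≤n)))))))
                 (value 5 (s≤s (s≤s (s≤s (s≤s (s≤s (s≤s z≤n)))))))) ≈-refl ⟩
          val 0 + val 1 + val 2 + val 3 + val 4 + val 5 - (v 0 * 0# + v p * 0#)
            ≡⟨ solve 3 (λ y x z → let v₂ = :ι 1 :- :ι 2 ; v₃ = v₂ :- :ι 1 ; v₄ = v₃ :- v₂ ; v₅ = v₄ :- v₃ in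
                 y :* (:ι 2 :* (:ι 5 :* x :- :ι 0 :* x)) :+ y :* (:ι 1 :* (:ι 1 :* x :- :ι 5 :* x)) :+ y :* (v₂ :* (:ι 0 :* x :- :ι 1 :* x))
                 :+ y :* (v₃ :* ((:- (:ι 1)) :* x :- :ι 0 :* x)) :+ y :* (v₄ :* ((:- (:ι 5)) :* x :- (:- (:ι 1)) :* x))
                 :+ y :* (v₅ :* (:ι 0 :* x :- (:- (:ι 5)) :* x)) :- (:ι 2 :* :ι 0 :+ z :* :ι 0)
                 := y :* (:- (:- (:ι 1)) :* (:ι 18 :* x))) refl (φ 6) (f 2) (v p) ⟩
          φ 6 * (- - 1# * (ι 18 * f 2))
            ≡⟨ cong (λ c → φ 6 * (- c * (ι 18 * f 2))) χ≡ ⟨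
          φ 6 * (- χ * (ι 18 * f 2)) ∎
          where
          col val : ℕ → K
          col t = ∑ (suc q) (λ i → vφ (t ℕ.+ i ℕ.* 6))
          val t = φ 6 * (v t * (coeff (suc t) * f 2 - coeff t * f 2))
          value : ∀ t → suc t ≤ 6 → col t ≈ val t
          value t t<6 = column-value t (suc q) (suc t) (ℕ.<⇒≤ t<6) t<6
            (≈-reflexive (cong Φ (trans (cong (t ℕ.* h ℕ.+_) (sym h≡)) (ℕ.+-comm (t ℕ.* h) h))))

      int-χ : Residue p h χ → Integral χ
      int-χ (one _ _ _ χ≡)  = subst Integral (sym χ≡) (int-ι 1)
      int-χ (five _ _ _ χ≡) = subst Integral (sym χ≡) (int-neg (int-ι 1))

      ∑v/i² : K
      ∑v/i² = ∑ N (λ i → v (suc i) * (⅟suc i * ⅟suc i))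

      -- The factor 2 · 18 = 36 cancels φ(6) ≡ 1/36.
      ∑v/i²≈ : ι 2 * ∑v/i² ≈ - χ * f 2
      ∑v/i²≈ = begin
        ι 2 * ∑v/i²
          ≈⟨ ≈-*ˡ (int-ι 2) (≈-trans (≈-∑ N (λ i i<N → ≈-*ˡ (int-v (suc i)) (≈-sym (φ≈⅟² i<N)))) (∑vφ residue)) ⟩
        ι 2 * (φ 6 * (- χ * (ι 18 * f 2)))
          ≡⟨ solve 3 (λ y c x → :ι 2 :* (y :* (c :* (:ι 18 :* x))) := :ι 36 :* y :* (c :* x)) refl _ _ _ ⟩
        ι 36 * φ 6 * (- χ * f 2)
          ≈⟨ ≈-*ʳ (int-* (int-neg (int-χ residue)) (int-Φ (2 ℕ.* h))) φ6*36≈1 ⟩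
        1# * (- χ * f 2)
          ≡⟨ *-identityˡ _ ⟩
        - χ * f 2 ∎

      int-⅟² : ∀ {i} → i < N → Integral (⅟suc i * ⅟suc i)
      int-⅟² i<N = int-* (int-⅟ (s≤s i<N)) (int-⅟ (s≤s i<N))

      -- Wolstenholme's theorem: 1/i + 1/(p-i) = p/(i (p-i)), and the cofactors 1/(i (p-i)) ≡ -1/i²
      -- add up to 0 modulo p.
      ∑1/i-quotient : ∃ λ z → z ≈ 0# × ∑1/i N ≡ ι p * z
      ∑1/i-quotient = ⅟suc 1 * ∑ N pair
        , ≈-trans (≈-*ˡ (int-⅟suc 1 p∤2) ∑pair≈0) (≈-reflexive (zeroʳ _))
        , ι-cancel 1 (trans doubled (trans (sym (*-identityˡ _)) (trans (cong (_* (ι p * ∑ N pair)) (sym (⅟suc-inverse 1)))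
            (solve 4 (λ t h p s → t :* h :* (p :* s) := t :* (p :* (h :* s))) refl _ _ _ _))))
        where
        a b pair : ℕ → K
        a = ⅟suc
        -- This is 1/(p - (i+1)), because p = n + 3.
        b i = ⅟suc (suc n ∸ i)
        pair i = a i * b i
        a+b : ∀ i → i < N → a i + b i ≡ ι p * pair i
        a+b i i<N = trans (trans (solve 2 (λ a b → a :+ b := :ι 1 :* a :+ :ι 1 :* b) refl _ _)
          (trans (cong₂ (λ x y → x * a i + y * b i) (sym (⅟suc-inverse (suc n ∸ i))) (sym (⅟suc-inverse i)))
            (solve 4 (λ x y a b → y :* b :* a :+ x :* a :* b := (x :+ y) :* (a :* b)) refl _ _ _ _)))
          (cong (_* pair i) (trans (sym (ι-+ (suc i) (suc (suc n ∸ i)))) (cong ι (trans (ℕ.+-suc (suc i) _)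
            (trans (cong (λ x → suc (suc x)) (ℕ.m+[n∸m]≡n (ℕ.s≤s⁻¹ (subst (i <_) N≡2+n i<N)))) (cong suc (sym N≡2+n)))))))
        reversed : ∑ N a ≡ ∑ N b
        reversed = trans (cong (λ m → ∑ m a) N≡2+n) (trans (∑-reverse (suc n) a) (cong (λ m → ∑ m b) (sym N≡2+n)))
        doubled : ι 2 * ∑1/i N ≡ ι p * ∑ N pair
        doubled = trans (solve 1 (λ x → :ι 2 :* x := x :+ x) refl _) (trans (cong (∑ N a +_) reversed)
          (trans (sym (∑-+ N a b)) (trans (∑-cong< N a+b) (∑-*ˡ N _ _))))
        ∑pair≈0 : ∑ N pair ≈ 0#
        ∑pair≈0 = begin
          ∑ N pair
            ≡⟨ solve 2 (λ x y → x := (x :+ y) :- y) refl _ _ ⟩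
          ∑ N pair + ∑1/i² N - ∑1/i² N
            ≈⟨ ≈-- (≈-trans (≈-reflexive (sym (∑-+ N pair _))) (≈-∑0 N pair+a²≈0)) ∑1/i²≈0 ⟩
          0# - 0#
            ≡⟨ -‿inverseʳ 0# ⟩
          0# ∎
          where
          pair+a²≈0 : ∀ i → i < N → pair i + a i * a i ≈ 0#
          pair+a²≈0 i i<N = ≈-trans (≈-reflexive (trans (solve 2 (λ a b → a :* b :+ a :* a := a :* (a :+ b)) refl _ _)
            (trans (cong (a i *_) (a+b i i<N)) (solve 3 (λ a b p → a :* (p :* (a :* b)) := p :* (a :* a :* b)) refl _ _ _))))
            (p*≈0 (int-* (int-⅟² i<N) (int-⅟ (s≤s (subst (suc n ∸ i <_) (sym N≡2+n) (s≤s (ℕ.m∸n≤m (suc n) i)))))))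

      ∑1/i≈0 : ∑1/i N ≈ 0#
      ∑1/i≈0 = ≈-trans (≈-reflexive (proj₂ (proj₂ ∑1/i-quotient)))
        (≈-trans (≈-*ˡ (int-ι p) (proj₁ (proj₂ ∑1/i-quotient))) (≈-reflexive (zeroʳ _)))

      fib-central : ∀ w → (∀ j → j < p → Integral (w j)) → fib N w ≈ ∑ p (λ j → cb j * w j)
      fib-central w int-w = ≈-trans (≈-reflexive (fib-explicit N w)) (≈-∑ p (λ { j j<p@(s≤s j≤N) → begin
        bin (N ∸ j) j * (sgn j * w j)
          ≈⟨ ≈-*ʳ (int-* (int-sgn j) (int-w j j<p)) (bin-negate j (N ∸ j) j j<p (cong suc (ℕ.m∸n+n≡m j≤N))) ⟩
        sgn j * cb j * (sgn j * w j)
          ≡⟨ solve 3 (λ s c w → s :* c :* (s :* w) := (s :* s) :* (c :* w)) refl _ _ _ ⟩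
        sgn j * sgn j * (cb j * w j)
          ≡⟨ trans (cong (_* (cb j * w j)) (sgn-square j)) (*-identityˡ _) ⟩
        cb j * w j ∎ }))

      int-recip : ∀ j → j < p → Integral (recip j)
      int-recip zero    _   = int-ι 0
      int-recip (suc j) j<p = int-⅟ j<p

      int-fib : ∀ m w → (∀ j → j ≤ m → Integral (w j)) → Integral (fib m w)
      int-fib zero          w int-w = int-w 0 z≤n
      int-fib (suc zero)    w int-w = int-w 0 z≤n
      int-fib (suc (suc m)) w int-w = int-- (int-fib (suc m) w (λ j j≤m → int-w j (ℕ.m≤n⇒m≤1+n j≤m)))
        (int-fib m (w ∘ suc) (λ j j≤m → int-w (suc j) (s≤s (ℕ.m≤n⇒m≤1+n j≤m))))

      -- As v_p = 1, the sum with weight 1/j does not change from p - 1 to p. The right side of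
      -- `fib-recip²-step` is then that sum itself, while the left side carries the factor p.
      ∑cb/i≈0 : ∑ N (λ j → cb (suc j) * ⅟suc j) ≈ 0#
      ∑cb/i≈0 = begin
        ∑ N (λ j → cb (suc j) * ⅟suc j)
          ≡⟨ trans (∑-head N (λ j → cb j * recip j)) (trans (cong (_+ ∑ N (λ j → cb (suc j) * ⅟suc j)) (zeroʳ _)) (+-identityˡ _)) ⟨
        ∑ p (λ j → cb j * recip j)
          ≈⟨ fib-central recip int-recip ⟨
        fib N recip
          ≡⟨ solve 1 (λ x → x := :ι 2 :* (x :+ :ι 0) :- x) refl _ ⟩
        ι 2 * (fib N recip + 0#) - fib N recip
          ≡⟨ cong (λ x → ι 2 * x - fib N recip) (trans (fib-recip-step N) (cong (fib N recip +_)
               (trans (cong (λ x → ⅟suc N * (x - 1#)) (v-residue residue)) (trans (cong (⅟suc N *_) (-‿inverseʳ 1#)) (zeroʳ _))))) ⟨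
        ι 2 * fib p recip - fib N recip
          ≡⟨ fib-recip²-step N ⟨
        ι p * (fib p recip² - fib N recip²)
          -- Rewritten in this way the increment involves only the weights 1/(j+1)² with j + 1 < p,
          -- so it is integral.
          ≡⟨ cong (ι p *_) (subst (λ m → fib (suc m) recip² - fib m recip² ≡ - fib (suc n) (recip² ∘ suc)) (sym N≡2+n)
               (solve 2 (λ x y → x :- y :- x := :- y) refl _ _)) ⟩
        ι p * (- fib (suc n) (recip² ∘ suc))
          ≈⟨ p*≈0 (int-neg (int-fib (suc n) _ (λ j j≤ → int-⅟² (subst (j <_) (sym N≡2+n) (s≤s j≤))))) ⟩
        0# ∎

      -- One copy of `∑v/i²` is explicit in `fib-recip²-alt`; the other is the transform, whose
      -- coefficients (-1)^j C(p-1,j) are 1 modulo p. The harmonic terms vanish.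
      ∑cb/i²≈ : ∑ N (λ j → cb (suc j) * (⅟suc j * ⅟suc j)) ≈ ι 2 * ∑v/i²
      ∑cb/i²≈ = begin
        ∑ N (λ j → cb (suc j) * (⅟suc j * ⅟suc j))
          ≡⟨ trans (∑-head N (λ j → cb j * recip² j)) (trans (cong (_+ ∑ N (λ j → cb (suc j) * (⅟suc j * ⅟suc j)))
               (solve 1 (λ x → x :* (:ι 0 :* :ι 0) := :ι 0) refl _)) (+-identityˡ _)) ⟨
        ∑ p (λ j → cb j * recip² j)
          ≈⟨ fib-central recip² int-recip² ⟨
        fib N recip²
          ≈⟨ ≈-cancel p∤2 (begin
               ι 2 * fib N recip²
                 ≡⟨ fib-recip²-alt N ⟩
               ι 2 * alt N (λ j → v j * recip² j) + ι 2 * ∑v/i² + (∑1/i N * ∑1/i N - ∑1/i² N)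
                 ≈⟨ ≈-+ (≈-+ (≈-*ˡ (int-ι 2) alt≈) ≈-refl) (≈-- (≈-* int-∑1/i (int-ι 0) ∑1/i≈0 ∑1/i≈0) ∑1/i²≈0) ⟩
               ι 2 * ∑v/i² + ι 2 * ∑v/i² + (0# * 0# - 0#)
                 ≡⟨ solve 1 (λ x → :ι 2 :* x :+ :ι 2 :* x :+ (:ι 0 :* :ι 0 :- :ι 0) := :ι 2 :* (:ι 2 :* x)) refl _ ⟩
               ι 2 * (ι 2 * ∑v/i²) ∎) ⟩
        ι 2 * ∑v/i² ∎
        where
        int-recip² : ∀ j → j < p → Integral (recip² j)
        int-recip² j j<p = int-* (int-recip j j<p) (int-recip j j<p)
        int-∑1/i : Integral (∑1/i N)
        int-∑1/i = int-∑ N (λ i i<N → int-⅟ (s≤s i<N))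
        alt≈ : alt N (λ j → v j * recip² j) ≈ ∑v/i²
        alt≈ = begin
          alt N (λ j → v j * recip² j)
            ≡⟨ alt-explicit N _ ⟩
          ∑ p (λ j → bin N j * (sgn j * (v j * recip² j)))
            ≈⟨ ≈-∑ p (λ j j<p → ≈-trans (≈-*ʳ (int-* (int-sgn j) (int-* (int-v j) (int-recip² j j<p))) (bin[p-1]≈sgn j j<p))
                 (≈-reflexive (trans (sym (*-assoc _ _ _)) (trans (cong (_* (v j * recip² j)) (sgn-square j)) (*-identityˡ _))))) ⟩
          ∑ p (λ j → v j * recip² j)
            ≡⟨ trans (∑-head N _) (trans (cong (_+ ∑v/i²) (solve 0 (:ι 2 :* (:ι 0 :* :ι 0) := :ι 0) refl)) (+-identityˡ _)) ⟩
          ∑v/i² ∎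

      private
        o : ℕ → K
        o j = ι 2 * ι (suc j) + 1#

        int-o : ∀ j → Integral (o j)
        int-o j = int-+ (int-* (int-ι 2) (int-ι (suc j))) (int-ι 1)

        o*⅟² : ∀ j → o j * (⅟suc j * ⅟suc j) ≡ ι 2 * ⅟suc j + ⅟suc j * ⅟suc j
        o*⅟² j = trans (solve 2 (λ i v → (:ι 2 :* i :+ :ι 1) :* (v :* v) := :ι 2 :* (i :* v) :* v :+ v :* v) refl _ _)
          (trans (cong (λ x → ι 2 * x * ⅟suc j + ⅟suc j * ⅟suc j) (⅟suc-inverse j))
            (solve 1 (λ v → :ι 2 :* :ι 1 :* v :+ v :* v := :ι 2 :* v :+ v :* v) refl _))

        int-⅟³ : ∀ {i} → i < N → Integral (⅟suc i * ⅟suc i * ⅟suc i)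
        int-⅟³ i<N = int-* (int-⅟² i<N) (int-⅟ (s≤s i<N))

      -- With (2k+1)/k² = 2/k + 1/k² the surviving sum splits into the two central binomial sums,
      -- the first of which vanishes.
      ∑S/i²≈ : ∑S/i² N ≈ χ * f 2
      ∑S/i²≈ = begin
        ∑S/i² N
          ≡⟨ ∑S/i²-decomposition N ⟩
        ∑1/i² N - ∑ N (λ j → o j * cb (suc j) * (⅟suc j * ⅟suc j) * sq (bin N j))
          + ι p * ∑ N (λ j → ι 2 * o j * (⅟suc j * ⅟suc j * ⅟suc j) * Q N j)
          ≈⟨ ≈-+ (≈-- ∑1/i²≈0 (≈-∑ N (λ j j<N → term j j<N)))
               (p*≈0 (int-∑ N (λ j j<N → int-* (int-* (int-* (int-ι 2) (int-o j)) (int-⅟³ j<N)) (int-Q j)))) ⟩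
        0# - ∑ N (λ j → ι 2 * (cb (suc j) * ⅟suc j) + cb (suc j) * (⅟suc j * ⅟suc j)) + 0#
          ≡⟨ trans (+-identityʳ _) (trans (+-identityˡ _) (cong -_ (trans (∑-+ N _ _) (cong (_+ ∑ N (λ j → cb (suc j) * (⅟suc j * ⅟suc j))) (∑-*ˡ N _ _))))) ⟩
        - (ι 2 * ∑ N (λ j → cb (suc j) * ⅟suc j) + ∑ N (λ j → cb (suc j) * (⅟suc j * ⅟suc j)))
          ≈⟨ ≈-neg (≈-+ (≈-*ˡ (int-ι 2) ∑cb/i≈0) (≈-trans ∑cb/i²≈ ∑v/i²≈)) ⟩
        - (ι 2 * 0# + - χ * f 2)
          ≡⟨ solve 2 (λ c x → :- (:ι 2 :* :ι 0 :+ (:- c) :* x) := c :* x) refl _ _ ⟩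
        χ * f 2 ∎
        where
        term : ∀ j → j < N → o j * cb (suc j) * (⅟suc j * ⅟suc j) * sq (bin N j) ≈ ι 2 * (cb (suc j) * ⅟suc j) + cb (suc j) * (⅟suc j * ⅟suc j)
        term j j<N = ≈-trans (≈-*ˡ (int-* (int-* (int-o j) (int-bin _ _)) (int-⅟² j<N)) (bin[p-1]²≈1 j (ℕ.m<n⇒m<1+n j<N)))
          (≈-reflexive (trans (solve 3 (λ o c v → o :* c :* (v :* v) :* :ι 1 := o :* (v :* v) :* c) refl _ _ _)
            (trans (cong (_* cb (suc j)) (o*⅟² j)) (solve 2 (λ c v → (:ι 2 :* v :+ v :* v) :* c := :ι 2 :* (c :* v) :+ c :* (v :* v)) refl _ _))))

      -- Modulo p the cofactor consists of H_{p-1}/p, Σ 1/i² and Σ (2k+1)/k² times a quotient `Q`.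
      -- The last is 2 H_{p-1} + Σ 1/i² since `Q` is 1 modulo p, so all three vanish.
      ∑S/i-quotient : ∃ λ z → z ≈ 0# × ∑S/i N ≡ ι p * ∑S/i² N + ι p * z
      ∑S/i-quotient = (z - ∑1/i² N) + W + ι p * R
        , ≈-trans (≈-+ (≈-+ (≈-- z≈0 ∑1/i²≈0) W≈0) (p*≈0 (int-∑ N int-R))) (≈-reflexive (solve 0 (:ι 0 :- :ι 0 :+ :ι 0 :+ :ι 0 := :ι 0) refl))
        , trans (∑S/i-decomposition N) (trans (cong (λ x → ι p * ∑S/i² N + (x - ι p * ∑1/i² N) + ι p * W + ι p * ι p * R) ∑1/i≡)
            (solve 6 (λ p s z h w r → p :* s :+ (p :* z :- p :* h) :+ p :* w :+ p :* p :* r := p :* s :+ p :* (z :- h :+ w :+ p :* r)) refl _ _ _ _ _ _))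
        where
        z = proj₁ ∑1/i-quotient
        z≈0 = proj₁ (proj₂ ∑1/i-quotient)
        ∑1/i≡ = proj₂ (proj₂ ∑1/i-quotient)
        W R : K
        r : ℕ → K
        W = ∑ N (λ j → o j * (⅟suc j * ⅟suc j) * Q N j)
        r j = ⅟suc 1 * (o j * cb (suc j) * (⅟suc j * ⅟suc j) * sq (bin N j)) * ⅟suc j - ι 2 * o j * (⅟suc j * ⅟suc j * ⅟suc j) * Q N j
        R = ∑ N r
        int-R : ∀ j → j < N → Integral (r j)
        int-R j j<N = int-- (int-* (int-* (int-⅟suc 1 p∤2) (int-* (int-* (int-* (int-o j) (int-bin _ _)) (int-⅟² j<N)) (int-* (int-bin _ _) (int-bin _ _)))) (int-⅟ (s≤s j<N)))
          (int-* (int-* (int-* (int-ι 2) (int-o j)) (int-⅟³ j<N)) (int-Q j))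
        W≈0 : W ≈ 0#
        W≈0 = begin
          W
            ≈⟨ ≈-∑ N (λ j j<N → ≈-*ˡ (int-* (int-o j) (int-⅟² j<N)) (Q≈1 j (ℕ.m<n⇒m<1+n j<N))) ⟩
          ∑ N (λ j → o j * (⅟suc j * ⅟suc j) * 1#)
            ≡⟨ trans (∑-cong N (λ j → trans (*-identityʳ _) (o*⅟² j))) (trans (∑-+ N _ _) (cong (_+ ∑1/i² N) (∑-*ˡ N _ _))) ⟩
          ι 2 * ∑1/i N + ∑1/i² N
            ≈⟨ ≈-+ (≈-*ˡ (int-ι 2) ∑1/i≈0) ∑1/i²≈0 ⟩
          ι 2 * 0# + 0#
            ≡⟨ solve 0 (:ι 2 :* :ι 0 :+ :ι 0 := :ι 0) refl ⟩
          0# ∎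

      module _ (B : ℕ → K) (bernoulli-recurrence : ∀ m → appell 1# m B ≡ B m + δ₁ m) where

        -- The recurrence for B_{k+1} divides by k + 2 only, which is less than p in this range.
        int-bernoulli : ∀ m → m < N → Integral (B m)
        int-bernoulli m m<N = below (suc m) m (ℕ.n<1+n m) m<N
          where
          B0≡1 : B 0 ≡ 1#
          B0≡1 = trans (solve 2 (λ a b → a := :ι 1 :* a :+ b :- b) refl _ (B 1)) (trans (cong (_- B 1) (bernoulli-recurrence 1))
            (solve 1 (λ b → b :+ :ι 1 :- b := :ι 1) refl _))
          below : ∀ m k → k < m → k < N → Integral (B k)
          below (suc m) zero    _         _   = subst Integral (sym B0≡1) (int-ι 1)
          below (suc m) (suc k) (s≤s k<m) k<N = subst Integral (sym value)
            (int-* (int-⅟ (s≤s k<N)) (int-neg (int-∑ (suc k) (λ i i<k → int-* (int-bin _ _)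
              (below m i (ℕ.<-≤-trans i<k k<m) (ℕ.<-trans i<k k<N))))))
            where
            R = ∑ (suc k) (λ i → bin (2 ℕ.+ k) i * B i)
            total : R + ι (2 ℕ.+ k) * B (suc k) + B (2 ℕ.+ k) ≡ B (2 ℕ.+ k)
            total = trans (sym (appell-1 (suc k) B)) (trans (bernoulli-recurrence (2 ℕ.+ k)) (+-identityʳ _))
            value : B (suc k) ≡ ⅟suc (suc k) * - R
            value = ι-cancel (suc k) (trans (solve 3 (λ r x b → x := r :+ x :+ b :- b :- r) refl R _ (B (2 ℕ.+ k)))
              (trans (cong (λ x → x - B (2 ℕ.+ k) - R) total) (trans (solve 2 (λ b r → b :- b :- r := :ι 1 :* :- r) refl _ _)
                (trans (cong (_* - R) (sym (⅟suc-inverse (suc k)))) (*-assoc _ _ _)))))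

        -- Integrality of the value at y is proved along with the congruence, since multiplying
        -- congruences requires it.
        appell-≈ : ∀ {x y} → Integral x → Integral y → x ≈ y → ∀ m b → (∀ j → j ≤ m → Integral (b j)) →
          Integral (appell y m b) × appell x m b ≈ appell y m b
        appell-≈ int-x int-y x≈y zero    b int-b = int-b 0 z≤n , ≈-refl
        appell-≈ int-x int-y x≈y (suc m) b int-b
          with appell-≈ int-x int-y x≈y m b (λ j j≤m → int-b j (ℕ.m≤n⇒m≤1+n j≤m))
             | appell-≈ int-x int-y x≈y m (b ∘ suc) (λ j j≤m → int-b (suc j) (s≤s j≤m))
        ... | int₁ , eq₁ | int₂ , eq₂ = int-+ (int-* int-y int₁) int₂ , ≈-+ (≈-* int-x int₁ x≈y eq₁) eq₂

        -- Modulo p the argument 1/3 is the natural number 2h, to which Faulhaber's formula applies.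
        -- Its constant term B_{p-2} is zero, and its factor n + 1 = p - 2 is congruent to -2.
        bernoulli-third : appell (⅟suc 2) (suc n) B ≈ - (ι 2 * f 2)
        bernoulli-third = begin
          appell (⅟suc 2) (suc n) B
            ≈⟨ proj₂ (appell-≈ (int-⅟suc 2 p∤3) (int-ι (2 ℕ.* h)) third (suc n) B (λ j j≤ → int-bernoulli j (subst (j <_) (sym N≡2+n) (s≤s j≤)))) ⟩
          appell (ι (2 ℕ.* h)) (suc n) B
            ≡⟨ appell-ι B bernoulli-recurrence (2 ℕ.* h) n ⟩
          B (suc n) + ι (suc n) * f 2
            ≡⟨ cong (_+ ι (suc n) * f 2) (bernoulli-odd B bernoulli-recurrence n 0<n sgn-n) ⟩
          0# + ι (suc n) * f 2
            ≡⟨ solve 2 (λ i x → :ι 0 :+ i :* x := (:ι 1 :+ (:ι 1 :+ i)) :* x :- :ι 2 :* x) refl _ _ ⟩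
          ι (3 ℕ.+ n) * f 2 - ι 2 * f 2
            ≡⟨ cong (λ m → ι (suc m) * f 2 - ι 2 * f 2) N≡2+n ⟨
          ι p * f 2 - ι 2 * f 2
            ≈⟨ ≈-- (p*≈0 (int-Φ (2 ℕ.* h))) ≈-refl ⟩
          0# - ι 2 * f 2
            ≡⟨ +-identityˡ _ ⟩
          - (ι 2 * f 2) ∎
          where
          third : ⅟suc 2 ≈ ι (2 ℕ.* h)
          third = ≈-cancel p∤3 (begin
            ι 3 * ⅟suc 2
              ≡⟨ ⅟suc-inverse 2 ⟩
            1#
              ≡⟨ +-identityʳ _ ⟨
            1# + 0#
              ≈⟨ ≈-+ ≈-refl (ι-*p k) ⟨
            1# + ι (k ℕ.* p)
              ≡⟨ trans (sym (ι-suc (k ℕ.* p))) (trans (cong ι (trans (sym (proj₂ (sixth residue))) (ℕ.*-assoc 3 2 h))) (ι-* 3 (2 ℕ.* h))) ⟩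
            ι 3 * ι (2 ℕ.* h) ∎)
            where k = proj₁ (sixth residue)

        ∑S/i²≈bernoulli : ∑S/i² N ≈ - (⅟suc 1 * χ * appell (⅟suc 2) (suc n) B)
        ∑S/i²≈bernoulli = begin
          ∑S/i² N
            ≈⟨ ∑S/i²≈ ⟩
          χ * f 2
            ≡⟨ *-identityˡ _ ⟨
          1# * (χ * f 2)
            ≡⟨ cong (_* (χ * f 2)) (⅟suc-inverse 1) ⟨
          ι 2 * ⅟suc 1 * (χ * f 2)
            ≡⟨ solve 3 (λ h c x → :ι 2 :* h :* (c :* x) := :- (h :* c :* :- (:ι 2 :* x))) refl _ _ _ ⟩
          - (⅟suc 1 * χ * - (ι 2 * f 2))
            ≈⟨ ≈-neg (≈-*ˡ (int-* (int-⅟suc 1 p∤2) (int-χ residue)) bernoulli-third) ⟨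
          - (⅟suc 1 * χ * appell (⅟suc 2) (suc n) B) ∎

-- Specialisation to ℚ

open import Data.Integer using (+_)
open import Data.Rational using (_/_)

/1-injective : ∀ {i j} → toℚ i ≡ toℚ j → i ≡ j
/1-injective {i} {j} eq with ℚ.fromℚᵘ-injective {mkℚᵘ i 0} {mkℚᵘ j 0} eq
... | *≡* i*1≡j*1 = trans (sym (ℤ.*-identityʳ i)) (trans i*1≡j*1 (ℤ.*-identityʳ j))

toℚ-+ : ∀ i j → toℚ (i ℤ.+ j) ≡ toℚ i ℚ.+ toℚ j
toℚ-+ i j = ℚ.toℚᵘ-injective (begin-equality
  ℚ.toℚᵘ (toℚ (i ℤ.+ j))                 ≃⟨ ℚ.toℚᵘ-fromℚᵘ (mkℚᵘ (i ℤ.+ j) 0) ⟩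
  mkℚᵘ (i ℤ.+ j) 0                       ≃⟨ *≡* (cong (ℤ._* + 1) (cong₂ ℤ._+_ (sym (ℤ.*-identityʳ i)) (sym (ℤ.*-identityʳ j)))) ⟩
  mkℚᵘ i 0 ℚᵘ.+ mkℚᵘ j 0                 ≃⟨ ℚᵘ.+-cong (ℚ.toℚᵘ-fromℚᵘ (mkℚᵘ i 0)) (ℚ.toℚᵘ-fromℚᵘ (mkℚᵘ j 0)) ⟨
  ℚ.toℚᵘ (toℚ i) ℚᵘ.+ ℚ.toℚᵘ (toℚ j)     ≃⟨ ℚ.toℚᵘ-homo-+ (toℚ i) (toℚ j) ⟨
  ℚ.toℚᵘ (toℚ i ℚ.+ toℚ j)               ∎)
  where open ℚᵘ.≤-Reasoning

/-*-cancel : ∀ i d → (i / suc d) ℚ.* toℚ (+ suc d) ≡ toℚ i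
/-*-cancel i d = ℚ.toℚᵘ-injective (begin-equality
  ℚ.toℚᵘ (i / suc d ℚ.* toℚ (+ suc d))                   ≃⟨ ℚ.toℚᵘ-homo-* (i / suc d) (toℚ (+ suc d)) ⟩
  ℚ.toℚᵘ (i / suc d) ℚᵘ.* ℚ.toℚᵘ (toℚ (+ suc d))         ≃⟨ ℚᵘ.*-cong (ℚ.toℚᵘ-fromℚᵘ (mkℚᵘ i d)) (ℚ.toℚᵘ-fromℚᵘ (mkℚᵘ (+ suc d) 0)) ⟩
  mkℚᵘ i d ℚᵘ.* mkℚᵘ (+ suc d) 0                         ≃⟨ *≡* (trans (ℤ.*-identityʳ _) (cong (λ n → i ℤ.* + n) (sym (ℕ.*-identityʳ (suc d))))) ⟩
  mkℚᵘ i 0                                               ≃⟨ ℚ.toℚᵘ-fromℚᵘ (mkℚᵘ i 0) ⟨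
  ℚ.toℚᵘ (toℚ i)                                         ∎)
  where open ℚᵘ.≤-Reasoning

numeral-toℚ : ∀ n → numeral 0ℚ 1ℚ ℚ._+_ n ≡ toℚ (+ n)
numeral-toℚ zero          = refl
numeral-toℚ (suc zero)    = refl
numeral-toℚ (suc (suc n)) = trans (cong (1ℚ ℚ.+_) (numeral-toℚ (suc n))) (sym (toℚ-+ (+ 1) (+ suc n)))

ℚ-algebra : ℚ-Algebra
ℚ-algebra = record
  { isCommutativeRing = ℚ.+-*-isCommutativeRing
  ; ⅟suc              = λ n → + 1 / suc n
  ; ⅟suc-inverse      = λ n → trans (ℚ.*-comm (numeral 0ℚ 1ℚ ℚ._+_ (suc n)) (+ 1 / suc n))
                          (trans (cong (+ 1 / suc n ℚ.*_) (numeral-toℚ (suc n))) (/-*-cancel (+ 1) n))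
  }

open ≡-Reasoning

module ℚA = Congruences ℚ-algebra

ι≡toℚ : ∀ n → ℚA.ι n ≡ toℚ (+ n)
ι≡toℚ = numeral-toℚ

ιℤ≡toℚ : ∀ i → ℚA.ιℤ i ≡ toℚ i
ιℤ≡toℚ (+ n)    = ι≡toℚ n
ιℤ≡toℚ -[1+ n ] = cong ℚ.-_ (ι≡toℚ (suc n))

ιℤ-injective : ∀ {i j} → ℚA.ιℤ i ≡ ℚA.ιℤ j → i ≡ j
ιℤ-injective {i} {j} eq = /1-injective (trans (sym (ιℤ≡toℚ i)) (trans eq (ιℤ≡toℚ j)))

/-unique : ∀ a d {x} → ℚA.ι a ≡ ℚA.ι (suc d) ℚ.* x → + a / suc d ≡ x
/-unique a d {x} eq = ℚA.ι-cancel d {+ a / suc d} {x} (begin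
  ℚA.ι (suc d) ℚ.* (+ a / suc d)          ≡⟨ cong (ℚ._* (+ a / suc d)) (ι≡toℚ (suc d)) ⟩
  toℚ (+ suc d) ℚ.* (+ a / suc d)         ≡⟨ ℚ.*-comm (toℚ (+ suc d)) (+ a / suc d) ⟩
  (+ a / suc d) ℚ.* toℚ (+ suc d)         ≡⟨ /-*-cancel (+ a) d ⟩
  toℚ (+ a)                               ≡⟨ ι≡toℚ a ⟨
  ℚA.ι a                                  ≡⟨ eq ⟩
  ℚA.ι (suc d) ℚ.* x                      ∎)

Σℚ≡∑ : ∀ n (f : ℕ → ℚ) → Σℚ< n f ≡ ℚA.∑ n f
Σℚ≡∑ zero    f = refl
Σℚ≡∑ (suc n) f = cong (ℚ._+ f n) (Σℚ≡∑ n f)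

ι-Σℕ : ∀ n (f : ℕ → ℕ) → ℚA.ι (Σℕ< n f) ≡ ℚA.∑ n (λ i → ℚA.ι (f i))
ι-Σℕ zero    f = refl
ι-Σℕ (suc n) f = trans (ℚA.ι-+ (Σℕ< n f) (f n)) (cong (ℚ._+ ℚA.ι (f n)) (ι-Σℕ n f))

2*≡+ : ∀ k → 2 ℕ.* k ≡ k ℕ.+ k
2*≡+ k = cong (k ℕ.+_) (ℕ.+-identityʳ k)

ι-central : ∀ k → ℚA.ι ((2 ℕ.* k) C k) ≡ ℚA.cb k
ι-central k = trans (cong (λ m → ℚA.ι (m C k)) (2*≡+ k)) (sym (ℚA.bin≡ι (k ℕ.+ k) k))

ι-Scoeff : ∀ n k → ℚA.ι (Scoeff n k) ≡ ℚA.s n k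
ι-Scoeff n k = trans (ℚA.ι-* ((n C k) ℕ.* (n C k) ℕ.* ((2 ℕ.* k) C k)) (2 ℕ.* k ℕ.+ 1)) (cong₂ ℚ._*_
  (trans (ℚA.ι-* ((n C k) ℕ.* (n C k)) ((2 ℕ.* k) C k)) (cong₂ ℚ._*_
    (trans (ℚA.ι-* (n C k) (n C k)) (sym (cong₂ ℚ._*_ (ℚA.bin≡ι n k) (ℚA.bin≡ι n k))))
    (ι-central k)))
  (trans (ℚA.ι-+ (2 ℕ.* k) 1) (cong (ℚ._+ 1ℚ) (ℚA.ι-* 2 k))))

ι-S : ∀ n → ℚA.ι (S n) ≡ ℚA.S′ n
ι-S n = trans (ι-Σℕ (suc n) (Scoeff n)) (ℚA.∑-cong (suc n) (ι-Scoeff n))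

-- Integers among the rationals and the first claim

IsInteger : ℚ → Set
IsInteger x = ∃ λ z → x ≡ ℚA.ιℤ z

integer-+ : ∀ {x y} → IsInteger x → IsInteger y → IsInteger (x ℚ.+ y)
integer-+ (a , eq) (b , eq′) = a ℤ.+ b , trans (cong₂ ℚ._+_ eq eq′) (sym (ℚA.ιℤ-+ a b))

integer-* : ∀ {x y} → IsInteger x → IsInteger y → IsInteger (x ℚ.* y)
integer-* (a , eq) (b , eq′) = a ℤ.* b , trans (cong₂ ℚ._*_ eq eq′) (sym (ℚA.ιℤ-* a b))

integer-bin : ∀ n k → IsInteger (ℚA.bin n k)
integer-bin n k = + (n C k) , ℚA.bin≡ι n k

integer-∑ : ∀ n {f} → (∀ i → IsInteger (f i)) → IsInteger (ℚA.∑ n f)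
integer-∑ zero    h = + 0 , refl
integer-∑ (suc n) h = integer-+ (integer-∑ n h) (h n)

catalan≡ : ∀ k → catalan k ≡ ℚA.⅟suc k ℚ.* ℚA.cb k
catalan≡ k = /-unique ((2 ℕ.* k) C k) k (begin
  ℚA.ι ((2 ℕ.* k) C k)                                 ≡⟨ ι-central k ⟩
  ℚA.cb k                                              ≡⟨ ℚ.*-identityˡ (ℚA.cb k) ⟨
  1ℚ ℚ.* ℚA.cb k                                       ≡⟨ cong (ℚ._* ℚA.cb k) (ℚA.⅟suc-inverse k) ⟨
  ℚA.ι (suc k) ℚ.* ℚA.⅟suc k ℚ.* ℚA.cb k               ≡⟨ ℚ.*-assoc (ℚA.ι (suc k)) (ℚA.⅟suc k) (ℚA.cb k) ⟩
  ℚA.ι (suc k) ℚ.* (ℚA.⅟suc k ℚ.* ℚA.cb k)             ∎)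

catalan-integer : ∀ k → IsInteger (ℚA.⅟suc k ℚ.* ℚA.cb k)
catalan-integer k = subst IsInteger (sym (ℚA.catalan-integral k))
  (integer-+ (integer-bin (k ℕ.+ k) k) (ℤ.- + ((k ℕ.+ k) C suc k) ,
    trans (cong ℚ.-_ (ℚA.bin≡ι (k ℕ.+ k) (suc k))) (sym (ℚA.ιℤ-neg (+ ((k ℕ.+ k) C suc k))))))

integer-Q : ∀ m j → IsInteger (ℚA.Q m j)
integer-Q m j = integer-∑ (suc j) (λ t → integer-* (integer-* (integer-bin _ _) (integer-bin _ _)) (integer-* (integer-bin _ _) (integer-bin _ _)))

ΣS/n² : ∀ m → (+ Σℕ< (suc m) S) / (suc m ℕ.* suc m) ≡ ℚA.∑ (suc m) (λ k → ℚA.sq (ℚA.bin m k) ℚ.* (ℚA.⅟suc k ℚ.* ℚA.cb k))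
-- The successor of the second argument is (m+1)² by computation.
ΣS/n² m = /-unique (Σℕ< (suc m) S) (m ℕ.+ m ℕ.* suc m) (begin
  ℚA.ι (Σℕ< (suc m) S)            ≡⟨ trans (ι-Σℕ (suc m) S) (ℚA.∑-cong (suc m) ι-S) ⟩
  ℚA.∑ (suc m) ℚA.S′              ≡⟨ ℚA.∑S m ⟩
  ℚA.ι (suc m) ℚ.* ℚA.ι (suc m) ℚ.* R  ≡⟨ cong (ℚ._* R) (ℚA.ι-* (suc m) (suc m)) ⟨
  ℚA.ι (suc m ℕ.* suc m) ℚ.* R    ∎)
  where R = ℚA.∑ (suc m) (λ k → ℚA.sq (ℚA.bin m k) ℚ.* (ℚA.⅟suc k ℚ.* ℚA.cb k))

part-i : ∀ m →
  ((+ Σℕ< (suc m) S) / (suc m ℕ.* suc m) ≡ Σℚ< (suc m) (λ k → toℚ (+ ((m C k) ℕ.* (m C k))) ℚ.* catalan k))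
  × (∃ λ (z : ℤ) → (+ Σℕ< (suc m) S) / (suc m ℕ.* suc m) ≡ toℚ z)
  × (∃ λ (Q : ℕ → ℤ) → (j : ℕ) → (+ suc m) ℤ.* Q j ≡ + Σℕ< (suc m) (λ k → Scoeff k j))
part-i m = trans (ΣS/n² m) (sym (trans (Σℚ≡∑ (suc m) _) (ℚA.∑-cong (suc m) (λ k → cong₂ ℚ._*_ (square k) (catalan≡ k)))))
  , (proj₁ integer , trans (ΣS/n² m) (trans (proj₂ integer) (ιℤ≡toℚ (proj₁ integer))))
  -- The witness is the integer represented by `ℚA.Q m j`; the identity is proved in the rationals
  -- and pulled back.
  , (λ j → proj₁ (integer-Q m j)) , λ j → ιℤ-injective (begin
      ℚA.ιℤ (+ suc m ℤ.* proj₁ (integer-Q m j))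
        ≡⟨ trans (ℚA.ιℤ-* (+ suc m) (proj₁ (integer-Q m j))) (cong (ℚA.ι (suc m) ℚ.*_) (sym (proj₂ (integer-Q m j)))) ⟩
      ℚA.ι (suc m) ℚ.* ℚA.Q m j
        ≡⟨ ℚA.∑-bin-square-divisible m j ⟨
      (ℚA.ι 2 ℚ.* ℚA.ι j ℚ.+ 1ℚ) ℚ.* ℚA.cb j ℚ.* ℚA.∑ (suc m) (λ k → ℚA.sq (ℚA.bin k j))
        ≡⟨ ℚA.∑-*ˡ (suc m) ((ℚA.ι 2 ℚ.* ℚA.ι j ℚ.+ 1ℚ) ℚ.* ℚA.cb j) (λ k → ℚA.sq (ℚA.bin k j)) ⟨
      ℚA.∑ (suc m) (λ k → (ℚA.ι 2 ℚ.* ℚA.ι j ℚ.+ 1ℚ) ℚ.* ℚA.cb j ℚ.* ℚA.sq (ℚA.bin k j))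
        ≡⟨ ℚA.∑-cong (suc m) (λ k → trans (rearrange (ℚA.ι 2 ℚ.* ℚA.ι j ℚ.+ 1ℚ) (ℚA.cb j) (ℚA.sq (ℚA.bin k j))) (sym (ι-Scoeff k j))) ⟩
      ℚA.∑ (suc m) (λ k → ℚA.ι (Scoeff k j))
        ≡⟨ ι-Σℕ (suc m) (λ k → Scoeff k j) ⟨
      ℚA.ι (Σℕ< (suc m) (λ k → Scoeff k j)) ∎)
  where
  square : ∀ k → toℚ (+ ((m C k) ℕ.* (m C k))) ≡ ℚA.sq (ℚA.bin m k)
  square k = trans (sym (ι≡toℚ ((m C k) ℕ.* (m C k)))) (trans (ℚA.ι-* (m C k) (m C k)) (sym (cong₂ ℚ._*_ (ℚA.bin≡ι m k) (ℚA.bin≡ι m k))))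
  integer : IsInteger (ℚA.∑ (suc m) (λ k → ℚA.sq (ℚA.bin m k) ℚ.* (ℚA.⅟suc k ℚ.* ℚA.cb k)))
  integer = integer-∑ (suc m) (λ k → integer-* (integer-* (integer-bin m k) (integer-bin m k)) (catalan-integer k))
  rearrange : ∀ a b c → a ℚ.* b ℚ.* c ≡ c ℚ.* b ℚ.* a
  rearrange a b c = trans (ℚ.*-comm (a ℚ.* b) c) (trans (cong (c ℚ.*_) (ℚ.*-comm a b)) (sym (ℚ.*-assoc c b a)))

weighted : ℕ → ℕ → List ℚ → ℚ
weighted m k []       = 0ℚ
weighted m k (b ∷ bs) = toℚ (+ (m C k)) ℚ.* b ℚ.+ weighted m (suc k) bs

-- A recursion on lists is determined by its two equations, which makes it possible to identify a
-- function that cannot be named.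
weighted-unique : (w : ℕ → ℕ → List ℚ → ℚ) → (∀ m k → w m k [] ≡ 0ℚ) →
  (∀ m k b bs → w m k (b ∷ bs) ≡ toℚ (+ (m C k)) ℚ.* b ℚ.+ w m (suc k) bs) →
  ∀ m k bs → w m k bs ≡ weighted m k bs
weighted-unique w nil cns m k []       = nil m k
weighted-unique w nil cns m k (b ∷ bs) = trans (cns m k b bs) (cong (toℚ (+ (m C k)) ℚ.* b ℚ.+_) (weighted-unique w nil cns m (suc k) bs))

-- The sum wsum inside bernoulliUpTo is private to Defs.  After its arguments and
-- the operations around it have been abstracted, unification solves wsum′ by it.
mutual
  wsum′ : ℕ → ℕ → List ℚ → ℚ
  wsum′ = _

  bernoulliUpTo-suc : ∀ n → bernoulliUpTo (suc n) ≡ bernoulliUpTo n ++ [ ℚ.- (weighted (suc (suc n)) 0 (bernoulliUpTo n) ℚ.* ((+ 1) / suc (suc n))) ]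
  bernoulliUpTo-suc n with (+ 1) / suc (suc n)
  ... | c with ℚ._*_ | ℚ.-_
  ... | _⊛_ | neg with suc (suc n)
  ... | m with bernoulliUpTo n
  ... | bs with 0
  ... | k = cong (λ x → bs ++ [ neg (x ⊛ c) ]) (weighted-unique wsum′ (λ _ _ → refl) (λ _ _ _ _ → refl) m k bs)

-- Divisibility of numerators in lowest terms

p²∣-lift : ∀ {p} → Prime p → ∀ n d m e → p ∤ d → n ℕ.* d ≡ p ℕ.* (p ℕ.* m) ℕ.* e → p ℕ.^ 2 ∣ n × p ∣ n
p²∣-lift {suc p-1} p-prime n d m e p∤d eq with euclidsLemma n d p-prime (divides (p ℕ.* m ℕ.* e)
    (trans eq (trans (ℕ.*-assoc p (p ℕ.* m) e) (ℕ.*-comm p (p ℕ.* m ℕ.* e)))))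
  where p = suc p-1
... | inj₂ p∣d = ⊥-elim (p∤d p∣d)
... | inj₁ (divides n′ refl) with euclidsLemma n′ d p-prime (divides (m ℕ.* e) (ℕ.*-cancelˡ-≡ (n′ ℕ.* d) (m ℕ.* e ℕ.* p) p (begin
    p ℕ.* (n′ ℕ.* d)        ≡⟨ +-*-Solver.solve 3 (λ p n d → p N.:* (n N.:* d) N.:= n N.:* p N.:* d) refl p n′ d ⟩
    n′ ℕ.* p ℕ.* d          ≡⟨ eq ⟩
    p ℕ.* (p ℕ.* m) ℕ.* e   ≡⟨ +-*-Solver.solve 3 (λ p m e → p N.:* (p N.:* m) N.:* e N.:= p N.:* (m N.:* e N.:* p)) refl p m e ⟩
    p ℕ.* (m ℕ.* e ℕ.* p)   ∎)))
  where
  p = suc p-1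
  module N = +-*-Solver
...   | inj₂ p∣d = ⊥-elim (p∤d p∣d)
...   | inj₁ (divides n″ refl) = divides n″ (trans (ℕ.*-assoc n″ p p) (cong (λ x → n″ ℕ.* (p ℕ.* x)) (sym (ℕ.*-identityʳ p)))) , divides n′ refl
  where p = suc p-1

coprime-↥↧ : ∀ x → Coprime ℤ.∣ ↥ x ∣ (↧ₙ x)
coprime-↥↧ (mkℚ _ _ coprime) = recompute coprime

*-↧ : ∀ x → x ℚ.* ℚA.ι (↧ₙ x) ≡ ℚA.ιℤ (↥ x)
*-↧ x@(mkℚ n d-1 _) = begin
  x ℚ.* ℚA.ι (suc d-1)                  ≡⟨ cong₂ ℚ._*_ (sym (ℚ.↥p/↧p≡p x)) (ι≡toℚ (suc d-1)) ⟩
  (n / suc d-1) ℚ.* toℚ (+ suc d-1)     ≡⟨ /-*-cancel n d-1 ⟩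
  toℚ n                                 ≡⟨ ιℤ≡toℚ n ⟨
  ℚA.ιℤ n                               ∎

module _ (N : ℕ) (p-prime : Prime (suc N)) where
  private
    p : ℕ
    p = suc N
  open ℚA.Localisation N p-prime using (Integral; integral; p∤1)

  -- Clearing denominators puts p² into the numerator of a - b times a number prime to p, hence into
  -- the numerator. In lowest terms a numerator divisible by p keeps p out of the denominator.
  congModPow² : ∀ a b c → Integral c → a ℚ.- b ≡ ℚA.ι p ℚ.* (ℚA.ι p ℚ.* c) → CongModPow p 2 a b
  congModPow² a b c (integral d m p∤d c*d≡m) eq = proj₁ divisible , λ p∣↧ → p∤1 (subst (p ∣_) (coprime-↥↧ x (proj₂ divisible , p∣↧)) (divides 1 (sym (ℕ.*-identityˡ p))))
    where
    x : ℚ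
    x = a ℚ.- b
    P D : ℚ
    P = ℚA.ι p
    D = ℚA.ι d
    e : ℕ
    e = ↧ₙ x
    cleared : ↥ x ℤ.* + d ≡ + p ℤ.* (+ p ℤ.* m) ℤ.* + e
    cleared = ιℤ-injective (begin
      ℚA.ιℤ (↥ x ℤ.* + d)
        ≡⟨ trans (ℚA.ιℤ-* (↥ x) (+ d)) (cong (ℚ._* D) (sym (*-↧ x))) ⟩
      x ℚ.* ℚA.ι e ℚ.* D
        ≡⟨ cong (λ y → y ℚ.* ℚA.ι e ℚ.* D) eq ⟩
      P ℚ.* (P ℚ.* c) ℚ.* ℚA.ι e ℚ.* D
        ≡⟨ ℚA.solve 4 (λ P c e d → P ℚA.:* (P ℚA.:* c) ℚA.:* e ℚA.:* d ℚA.:= P ℚA.:* (P ℚA.:* (c ℚA.:* d)) ℚA.:* e) refl P c (ℚA.ι e) D ⟩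
      P ℚ.* (P ℚ.* (c ℚ.* D)) ℚ.* ℚA.ι e
        ≡⟨ cong (λ y → P ℚ.* (P ℚ.* y) ℚ.* ℚA.ι e) c*d≡m ⟩
      P ℚ.* (P ℚ.* ℚA.ιℤ m) ℚ.* ℚA.ι e
        ≡⟨ trans (ℚA.ιℤ-* (+ p ℤ.* (+ p ℤ.* m)) (+ e)) (cong (ℚ._* ℚA.ι e)
             (trans (ℚA.ιℤ-* (+ p) (+ p ℤ.* m)) (cong (P ℚ.*_) (ℚA.ιℤ-* (+ p) m)))) ⟨
      ℚA.ιℤ (+ p ℤ.* (+ p ℤ.* m) ℤ.* + e) ∎)
    divisible : p ℕ.^ 2 ∣ ℤ.∣ ↥ x ∣ × p ∣ ℤ.∣ ↥ x ∣
    divisible = p²∣-lift p-prime ℤ.∣ ↥ x ∣ d ℤ.∣ m ∣ e p∤d (begin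
      ℤ.∣ ↥ x ∣ ℕ.* d                             ≡⟨ ℤ.abs-* (↥ x) (+ d) ⟨
      ℤ.∣ ↥ x ℤ.* + d ∣                           ≡⟨ cong ℤ.∣_∣ cleared ⟩
      ℤ.∣ + p ℤ.* (+ p ℤ.* m) ℤ.* + e ∣           ≡⟨ trans (ℤ.abs-* (+ p ℤ.* (+ p ℤ.* m)) (+ e)) (cong (ℕ._* e)
                                                       (trans (ℤ.abs-* (+ p) (+ p ℤ.* m)) (cong (p ℕ.*_) (ℤ.abs-* (+ p) m)))) ⟩
      p ℕ.* (p ℕ.* ℤ.∣ m ∣) ℕ.* e                 ∎)

-- The Bernoulli numbers and polynomials of the statement

nth-++ˡ : ∀ bs cs i → i < length bs → nth (bs ++ cs) i ≡ nth bs i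
nth-++ˡ (b ∷ bs) cs zero    _         = refl
nth-++ˡ (b ∷ bs) cs (suc i) (s≤s i<n) = nth-++ˡ bs cs i i<n

nth-++-length : ∀ bs c → nth (bs ++ [ c ]) (length bs) ≡ c
nth-++-length []       c = refl
nth-++-length (b ∷ bs) c = nth-++-length bs c

length-bernoulliUpTo : ∀ n → length (bernoulliUpTo n) ≡ suc n
length-bernoulliUpTo zero    = refl
length-bernoulliUpTo (suc n) = trans (length-snoc (bernoulliUpTo n) _) (cong suc (length-bernoulliUpTo n))
  where
  length-snoc : ∀ (bs : List ℚ) c → length (bs ++ [ c ]) ≡ suc (length bs)
  length-snoc []       c = refl
  length-snoc (b ∷ bs) c = cong suc (length-snoc bs c)

nth-bernoulliUpTo : ∀ n i → i ≤ n → nth (bernoulliUpTo n) i ≡ bernoulli i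
nth-bernoulliUpTo zero    zero z≤n = refl
nth-bernoulliUpTo (suc n) i i≤1+n with ℕ.m≤n⇒m<n∨m≡n i≤1+n
... | inj₂ refl = refl
... | inj₁ (s≤s i≤n) = trans (nth-++ˡ (bernoulliUpTo n) _ i (subst (i <_) (sym (length-bernoulliUpTo n)) (s≤s i≤n))) (nth-bernoulliUpTo n i i≤n)

weighted-∑ : ∀ m k bs → weighted m k bs ≡ ℚA.∑ (length bs) (λ i → ℚA.bin m (k ℕ.+ i) ℚ.* nth bs i)
weighted-∑ m k []       = refl
weighted-∑ m k (b ∷ bs) = trans (cong₂ ℚ._+_
    (cong (ℚ._* b) (trans (sym (ι≡toℚ (m C k))) (trans (sym (ℚA.bin≡ι m k)) (cong (ℚA.bin m) (sym (ℕ.+-identityʳ k))))))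
    (trans (weighted-∑ m (suc k) bs) (ℚA.∑-cong (length bs) (λ i → cong (λ l → ℚA.bin m l ℚ.* nth bs i) (sym (ℕ.+-suc k i))))))
  (sym (ℚA.∑-head (length bs) (λ i → ℚA.bin m (k ℕ.+ i) ℚ.* nth (b ∷ bs) i)))

bernoulli-suc : ∀ n → bernoulli (suc n) ≡ ℚ.- (ℚA.∑ (suc n) (λ k → ℚA.bin (2 ℕ.+ n) k ℚ.* bernoulli k) ℚ.* ℚA.⅟suc (suc n))
bernoulli-suc n = begin
  nth (bernoulliUpTo (suc n)) (suc n)
    ≡⟨ cong₂ nth (bernoulliUpTo-suc n) (sym (length-bernoulliUpTo n)) ⟩
  nth (bernoulliUpTo n ++ [ last ]) (length (bernoulliUpTo n))
    ≡⟨ nth-++-length (bernoulliUpTo n) last ⟩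
  ℚ.- (weighted (2 ℕ.+ n) 0 (bernoulliUpTo n) ℚ.* ℚA.⅟suc (suc n))
    ≡⟨ cong (λ x → ℚ.- (x ℚ.* ℚA.⅟suc (suc n))) (trans (weighted-∑ (2 ℕ.+ n) 0 (bernoulliUpTo n))
         (trans (cong (λ l → ℚA.∑ l (λ k → ℚA.bin (2 ℕ.+ n) k ℚ.* nth (bernoulliUpTo n) k)) (length-bernoulliUpTo n))
           (ℚA.∑-cong< (suc n) (λ { k (s≤s k≤n) → cong (ℚA.bin (2 ℕ.+ n) k ℚ.*_) (nth-bernoulliUpTo n k k≤n) })))) ⟩
  ℚ.- (ℚA.∑ (suc n) (λ k → ℚA.bin (2 ℕ.+ n) k ℚ.* bernoulli k) ℚ.* ℚA.⅟suc (suc n)) ∎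
  where
  last : ℚ
  last = ℚ.- (weighted (2 ℕ.+ n) 0 (bernoulliUpTo n) ℚ.* ℚA.⅟suc (suc n))

powℚ≡^ : ∀ x n → powℚ x n ≡ x ℚA.^ n
powℚ≡^ x zero    = refl
powℚ≡^ x (suc n) = cong (x ℚ.*_) (powℚ≡^ x n)

bernoulliPoly≡appell : ∀ n x → bernoulliPoly n x ≡ ℚA.appell x n bernoulli
bernoulliPoly≡appell n x = trans (Σℚ≡∑ (suc n) _) (trans (ℚA.∑-cong (suc n) (λ k →
  trans (cong₂ (λ b y → b ℚ.* bernoulli k ℚ.* y) (trans (sym (ι≡toℚ (n C k))) (sym (ℚA.bin≡ι n k))) (powℚ≡^ x (n ∸ k)))
    (ℚ.*-assoc (ℚA.bin n k) (bernoulli k) (x ℚA.^ (n ∸ k))))) (sym (ℚA.appell-explicit x n bernoulli)))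

bernoulli-recurrence : ∀ n → ℚA.appell 1ℚ n bernoulli ≡ bernoulli n ℚ.+ ℚA.δ₁ n
bernoulli-recurrence = ℚA.bernoulli-definition⇒recurrence bernoulli refl bernoulli-suc

/≡*⅟ : ∀ a d → + a / suc d ≡ ℚA.ι a ℚ.* ℚA.⅟suc d
/≡*⅟ a d = /-unique a d (begin
  A                          ≡⟨ ℚ.*-identityʳ A ⟨
  A ℚ.* 1ℚ                   ≡⟨ cong (A ℚ.*_) (ℚA.⅟suc-inverse d) ⟨
  A ℚ.* (D ℚ.* V)            ≡⟨ ℚA.solve 3 (λ a d v → a ℚA.:* (d ℚA.:* v) ℚA.:= d ℚA.:* (a ℚA.:* v)) refl A D V ⟩
  D ℚ.* (A ℚ.* V)            ∎)
  where
  A D V : ℚ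
  A = ℚA.ι a
  D = ℚA.ι (suc d)
  V = ℚA.⅟suc d

/≡*⅟² : ∀ a d → + a / (suc d ℕ.* suc d) ≡ ℚA.ι a ℚ.* (ℚA.⅟suc d ℚ.* ℚA.⅟suc d)
/≡*⅟² a d = /-unique a (d ℕ.+ d ℕ.* suc d) (begin
  A                                      ≡⟨ ℚA.solve 1 (λ a → a ℚA.:= a ℚA.:* (ℚA.:ι 1 ℚA.:* ℚA.:ι 1)) refl A ⟩
  A ℚ.* (1ℚ ℚ.* 1ℚ)                      ≡⟨ cong (λ x → A ℚ.* (x ℚ.* x)) (ℚA.⅟suc-inverse d) ⟨
  A ℚ.* (D ℚ.* V ℚ.* (D ℚ.* V))          ≡⟨ ℚA.solve 3 (λ a d v → a ℚA.:* (d ℚA.:* v ℚA.:* (d ℚA.:* v)) ℚA.:= d ℚA.:* d ℚA.:* (a ℚA.:* (v ℚA.:* v))) refl A D V ⟩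
  D ℚ.* D ℚ.* (A ℚ.* (V ℚ.* V))          ≡⟨ cong (ℚ._* (A ℚ.* (V ℚ.* V))) (ℚA.ι-* (suc d) (suc d)) ⟨
  ℚA.ι (suc d ℕ.* suc d) ℚ.* (A ℚ.* (V ℚ.* V)) ∎)
  where
  A D V : ℚ
  A = ℚA.ι a
  D = ℚA.ι (suc d)
  V = ℚA.⅟suc d

ΣS/i≡ : ∀ N → Σℚ< N (λ i → (+ S (suc i)) / suc i) ≡ ℚA.∑S/i N
ΣS/i≡ N = trans (Σℚ≡∑ N _) (ℚA.∑-cong N (λ i → trans (/≡*⅟ (S (suc i)) i) (cong (ℚ._* ℚA.⅟suc i) (ι-S (suc i)))))

ΣS/i²≡ : ∀ N → Σℚ< N (λ i → (+ S (suc i)) / (suc i ℕ.* suc i)) ≡ ℚA.∑S/i² N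
ΣS/i²≡ N = trans (Σℚ≡∑ N _) (ℚA.∑-cong N (λ i → trans (/≡*⅟² (S (suc i)) i) (cong (ℚ._* (ℚA.⅟suc i ℚ.* ℚA.⅟suc i)) (ι-S (suc i)))))

-- Primes modulo 6 and the Legendre symbol

no-divisor : ∀ {p d} .{{_ : ℕ.NonTrivial d}} → Prime p → d < p → ¬ d ∣ p
no-divisor (prime notComposite) d<p d∣p = notComposite (composite d<p d∣p)

prime-mod-6 : ∀ p → Prime p → 3 < p → (∃ λ q → p ≡ 1 ℕ.+ q ℕ.* 6) ⊎ (∃ λ q → p ≡ 5 ℕ.+ q ℕ.* 6)
prime-mod-6 p p-prime 3<p = cases (p % 6) (p ℕ./ 6) (m%n<n p 6) (m≡m%n+[m/n]*n p 6)
  where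
  module N = +-*-Solver
  2<p : 2 < p
  2<p = ℕ.<-trans (ℕ.n<1+n 2) 3<p
  cases : ∀ r q → r < 6 → p ≡ r ℕ.+ q ℕ.* 6 → (∃ λ q → p ≡ 1 ℕ.+ q ℕ.* 6) ⊎ (∃ λ q → p ≡ 5 ℕ.+ q ℕ.* 6)
  cases 0 q _ eq = ⊥-elim (no-divisor p-prime 2<p (divides (q ℕ.* 3) (trans eq (N.solve 1 (λ q → q N.:* N.con 6 N.:= q N.:* N.con 3 N.:* N.con 2) refl q))))
  cases 1 q _ eq = inj₁ (q , eq)
  cases 2 q _ eq = ⊥-elim (no-divisor p-prime 2<p (divides (1 ℕ.+ q ℕ.* 3) (trans eq (N.solve 1 (λ q → N.con 2 N.:+ q N.:* N.con 6 N.:= (N.con 1 N.:+ q N.:* N.con 3) N.:* N.con 2) refl q))))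
  cases 3 q _ eq = ⊥-elim (no-divisor p-prime 3<p (divides (1 ℕ.+ q ℕ.* 2) (trans eq (N.solve 1 (λ q → N.con 3 N.:+ q N.:* N.con 6 N.:= (N.con 1 N.:+ q N.:* N.con 2) N.:* N.con 3) refl q))))
  cases 4 q _ eq = ⊥-elim (no-divisor p-prime 2<p (divides (2 ℕ.+ q ℕ.* 3) (trans eq (N.solve 1 (λ q → N.con 4 N.:+ q N.:* N.con 6 N.:= (N.con 2 N.:+ q N.:* N.con 3) N.:* N.con 2) refl q))))
  cases 5 q _ eq = inj₂ (q , eq)
  cases (suc (suc (suc (suc (suc (suc r)))))) q (s≤s (s≤s (s≤s (s≤s (s≤s (s≤s ())))))) eq

%3-from-%6 : ∀ p r q → p ≡ r ℕ.+ q ℕ.* 6 → p % 3 ≡ r % 3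
%3-from-%6 p r q eq = trans (cong (_% 3) (trans eq (cong (r ℕ.+_) (N.solve 1 (λ q → q N.:* N.con 6 N.:= q N.:* N.con 2 N.:* N.con 3) refl q))))
  ([m+kn]%n≡m%n r (q ℕ.* 2) 3)
  where module N = +-*-Solver

legendre3-1 : ∀ a → a % 3 ≡ 1 → legendre3 a ≡ + 1
legendre3-1 a eq rewrite eq = refl

legendre3-2 : ∀ a → a % 3 ≡ 2 → legendre3 a ≡ ℤ.- + 1
legendre3-2 a eq rewrite eq = refl

residue : ∀ p → Prime p → 3 < p → ∃ λ h → ℚA.Residue p h (ℚA.ιℤ (legendre3 p))
residue p p-prime 3<p with prime-mod-6 p p-prime 3<p
... | inj₁ (q , eq) = 1 ℕ.+ q ℕ.* 5 , ℚA.one q eq refl (cong ℚA.ιℤ (legendre3-1 p (%3-from-%6 p 1 q eq)))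
... | inj₂ (q , eq) = 1 ℕ.+ q , ℚA.five q eq refl (cong ℚA.ιℤ (legendre3-2 p (%3-from-%6 p 5 q eq)))

part-ii : ∀ p → Prime p → 3 < p →
  CongModPow p 2
    (Σℚ< (p ∸ 1) (λ i → (+ S (suc i)) / suc i))
    (toℚ (+ p) ℚ.* Σℚ< (p ∸ 1) (λ i → (+ S (suc i)) / (suc i ℕ.* suc i)))
  × CongModPow p 2
    (toℚ (+ p) ℚ.* Σℚ< (p ∸ 1) (λ i → (+ S (suc i)) / (suc i ℕ.* suc i)))
    (ℚ.- ((+ p / 2) ℚ.* toℚ (legendre3 p) ℚ.* bernoulliPoly (p ∸ 2) ((+ 1) / 3)))
part-ii zero      _       ()
part-ii p@(suc N) p-prime 3<p =
    congModPow² N p-prime a b (quotient z≈0) (int-quotient z≈0) (begin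
      a ℚ.- b
        ≡⟨ cong₂ ℚ._-_ (trans (ΣS/i≡ N) ∑S/i≡) pΣS/i²≡ ⟩
      P ℚ.* L ℚ.+ P ℚ.* z ℚ.- P ℚ.* L
        ≡⟨ ℚA.solve 2 (λ x y → x ℚA.:+ y ℚA.:- x ℚA.:= y) refl (P ℚ.* L) (P ℚ.* z) ⟩
      P ℚ.* z
        ≡⟨ cong (P ℚ.*_) (trans (x≡y+p*c z≈0) (ℚ.+-identityˡ (P ℚ.* quotient z≈0))) ⟩
      P ℚ.* (P ℚ.* quotient z≈0) ∎)
  , congModPow² N p-prime b c (quotient L≈) (int-quotient L≈) (begin
      b ℚ.- c
        ≡⟨ cong₂ (λ x y → x ℚ.- ℚ.- y) (trans pΣS/i²≡ (cong (P ℚ.*_) (x≡y+p*c L≈)))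
             (cong₂ ℚ._*_ (cong₂ ℚ._*_ (/≡*⅟ p 1) (sym (ιℤ≡toℚ (legendre3 p))))
               (trans (cong (λ m → bernoulliPoly (m ∸ 1) (+ 1 / 3)) N≡2+n) (bernoulliPoly≡appell (suc n) (+ 1 / 3)))) ⟩
      P ℚ.* (ℚ.- (½ ℚ.* χ ℚ.* B) ℚ.+ P ℚ.* quotient L≈) ℚ.- ℚ.- (P ℚ.* ½ ℚ.* χ ℚ.* B)
        ≡⟨ ℚA.solve 5 (λ P h c b q → P ℚA.:* (ℚA.:- (h ℚA.:* c ℚA.:* b) ℚA.:+ P ℚA.:* q) ℚA.:- (ℚA.:- (P ℚA.:* h ℚA.:* c ℚA.:* b)) ℚA.:= P ℚA.:* (P ℚA.:* q))
             refl P ½ χ B (quotient L≈) ⟩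
      P ℚ.* (P ℚ.* quotient L≈) ∎)
  where
  a b c : ℚ
  a = Σℚ< N (λ i → (+ S (suc i)) / suc i)
  b = toℚ (+ p) ℚ.* Σℚ< N (λ i → (+ S (suc i)) / (suc i ℕ.* suc i))
  c = ℚ.- ((+ p / 2) ℚ.* toℚ (legendre3 p) ℚ.* bernoulliPoly (p ∸ 2) ((+ 1) / 3))
  n : ℕ
  n = N ∸ 2
  N≡2+n : N ≡ 2 ℕ.+ n
  N≡2+n = sym (ℕ.m+[n∸m]≡n (ℕ.<⇒≤ (ℕ.s≤s⁻¹ 3<p)))
  P L ½ χ B : ℚ
  P = ℚA.ι p
  L = ℚA.∑S/i² N
  ½ = ℚA.⅟suc 1
  χ = ℚA.ιℤ (legendre3 p)
  B = ℚA.appell (ℚA.⅟suc 2) (suc n) bernoulli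
  h : ℕ
  h = proj₁ (residue p p-prime 3<p)
  p-residue : ℚA.Residue p h χ
  p-residue = proj₂ (residue p p-prime 3<p)
  sgn-n : ℚA.sgn n ≡ 1ℚ
  -- Four sign changes give sgn(n) = sgn(n+4) = -sgn(p), and p = n + 3 is odd.
  sgn-n = trans (ℚA.solve 1 (λ x → x ℚA.:= ℚA.:- (ℚA.:- (ℚA.:- (ℚA.:- x)))) refl (ℚA.sgn n))
    (cong ℚ.-_ (trans (cong (ℚA.sgn ∘ suc) (sym N≡2+n)) (ℚA.sgn-residue p-residue)))
  module Mod = ℚA.HarmonicSums N n p-prime 3<p N≡2+n sgn-n
  open Mod._≈_
  z : ℚ
  z = proj₁ (Mod.∑S/i-quotient p-residue)
  z≈0 : z Mod.≈ 0ℚ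
  z≈0 = proj₁ (proj₂ (Mod.∑S/i-quotient p-residue))
  ∑S/i≡ : ℚA.∑S/i N ≡ P ℚ.* L ℚ.+ P ℚ.* z
  ∑S/i≡ = proj₂ (proj₂ (Mod.∑S/i-quotient p-residue))
  L≈ : L Mod.≈ ℚ.- (½ ℚ.* χ ℚ.* B)
  L≈ = Mod.∑S/i²≈bernoulli p-residue bernoulli bernoulli-recurrence
  pΣS/i²≡ : b ≡ P ℚ.* L
  pΣS/i²≡ = cong₂ ℚ._*_ (sym (ι≡toℚ p)) (ΣS/i²≡ N)

theorem1p4 : ((m : ℕ) →
    ((+ Σℕ< (suc m) S) / (suc m ℕ.* suc m)
    ≡ Σℚ< (suc m) (λ k → toℚ (+ ((m C k) ℕ.* (m C k))) ℚ.* catalan k))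
    × (∃ λ (z : ℤ) → (+ Σℕ< (suc m) S) / (suc m ℕ.* suc m) ≡ toℚ z)
    × (∃ λ (Q : ℕ → ℤ) →
    (j : ℕ) → (+ suc m) ℤ.* Q j ≡ + Σℕ< (suc m) (λ k → Scoeff k j)))
    ×
    ((p : ℕ) → Prime p → 3 < p →
    CongModPow p 2
    (Σℚ< (p ∸ 1) (λ i → (+ S (suc i)) / suc i))
    (toℚ (+ p) ℚ.* Σℚ< (p ∸ 1) (λ i → (+ S (suc i)) / (suc i ℕ.* suc i)))
    × CongModPow p 2
    (toℚ (+ p) ℚ.* Σℚ< (p ∸ 1) (λ i → (+ S (suc i)) / (suc i ℕ.* suc i)))
    (ℚ.- ((+ p / 2) ℚ.* toℚ (legendre3 p) ℚ.* bernoulliPoly (p ∸ 2) ((+ 1) / 3))))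
theorem1p4 = part-i , part-ii
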